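{- There exists an absolute constant $C>0$ such that for every integer $N\ge 2$, $$\delta(N)\ \le\ C\,N^{1/2}(\log N)^{ -1/4}.$$
   Context: For a finite set $P\subset\mathbb{R}^2$, $\Delta(P)$ denotes the maximal cardinality of a subset $Q\subset P$ such that all the $\binom{|Q|}{2}$ pairwise Euclidean distances between elements of $Q$ are distinct (that is, distinct unordered pairs of distinct points of $Q$ determine distinct distances). For a positive integer $N$, $\delta(N)$ denotes the minimum of $\Delta(P)$ over all $N$-element sets $P\subset\mathbb{R}^2$. -}

module Defs where

open import Data.Empty using (⊥; ⊥-elim)
open import Data.Fin using (Fin; toℕ)
open import Data.Fin.Properties using (toℕ-injective)
open import Data.Fin.Subset as Subset using (Subset; _∈_)
import Data.Fin.Subset.Properties as SubsetP
open import Data.Integer as ℤ using (ℤ; +_; -[1+_])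
import Data.Integer.Properties as ℤP
open import Data.Nat as ℕ using (ℕ; zero; suc; z≤n; s≤s)
open import Data.Nat.Coprimality using (Coprime)
import Data.Nat.Properties as ℕP
open import Data.Product using (Σ; ∃; _×_; _,_; proj₁; proj₂; Σ-syntax; ∃-syntax)
open import Data.Rational
open import Data.Rational.Properties
open import Data.Rational.Solver using (module +-*-Solver)
import Data.Rational.Unnormalised as ℚᵘ
import Data.Rational.Unnormalised.Properties as ℚᵘP
open import Data.Sum using (_⊎_; inj₁; inj₂)
open import Function.Definitions using (Injective)
open import Relation.Binary.Definitions using (tri<; tri≈; tri>)
open import Relation.Binary.PropositionalEquality
  using (_≡_; _≢_; refl; sym; trans; cong; cong₂; subst; subst₂)
open import Relation.Nullary using (¬_; yes; no)
open +-*-Solver using (solve; _:=_; _:+_; _:*_; _:-_; :-_; con)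

------------------------------------------------------------------------
-- Rational arithmetic

pos⇒< : ∀ {p q} r → 0ℚ < r → p + r ≡ q → p < q
pos⇒< {p} r 0<r refl = subst (_< p + r) (+-identityʳ p) (+-monoʳ-< p 0<r)

nonNeg⇒≤ : ∀ {p q} r → 0ℚ ≤ r → p + r ≡ q → p ≤ q
nonNeg⇒≤ {p} r 0≤r refl = subst (_≤ p + r) (+-identityʳ p) (+-monoʳ-≤ p 0≤r)

<⇒pos : ∀ {p q} → p < q → 0ℚ < q - p
<⇒pos {p} {q} p<q = subst (_< q - p) (+-inverseʳ p) (+-monoˡ-< (- p) p<q)

≤⇒nonNeg : ∀ {p q} → p ≤ q → 0ℚ ≤ q - p
≤⇒nonNeg {p} {q} p≤q = subst (_≤ q - p) (+-inverseʳ p) (+-monoˡ-≤ (- p) p≤q)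

0<-* : ∀ {p q} → 0ℚ < p → 0ℚ < q → 0ℚ < p * q
0<-* {p} {q} 0<p 0<q =
  subst (_< p * q) (*-zeroʳ p) (*-monoʳ-<-pos p {{positive 0<p}} 0<q)

0≤-* : ∀ {p q} → 0ℚ ≤ p → 0ℚ ≤ q → 0ℚ ≤ p * q
0≤-* {p} {q} 0≤p 0≤q =
  subst (_≤ p * q) (*-zeroʳ p) (*-monoˡ-≤-nonNeg p {{nonNegative 0≤p}} 0≤q)

0<-+ : ∀ {p q} → 0ℚ < p → 0ℚ < q → 0ℚ < p + q
0<-+ {p} {q} 0<p 0<q = +-mono-< {0ℚ} {p} {0ℚ} {q} 0<p 0<q

0≤-+ : ∀ {p q} → 0ℚ ≤ p → 0ℚ ≤ q → 0ℚ ≤ p + q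
0≤-+ {p} {q} 0≤p 0≤q = +-mono-≤ {0ℚ} {p} {0ℚ} {q} 0≤p 0≤q

0<½ : 0ℚ < ½
0<½ = positive⁻¹ ½

0<½* : ∀ {p} → 0ℚ < p → 0ℚ < ½ * p
0<½* = 0<-* 0<½

p≤∣p∣ : ∀ p → p ≤ ∣ p ∣
p≤∣p∣ p with ≤-total 0ℚ p
... | inj₁ 0≤p = ≤-reflexive (sym (0≤p⇒∣p∣≡p 0≤p))
... | inj₂ p≤0 = ≤-trans p≤0 (0≤∣p∣ p)

∣p-q∣≡∣q-p∣ : ∀ p q → ∣ p - q ∣ ≡ ∣ q - p ∣
∣p-q∣≡∣q-p∣ p q = trans (sym (∣-p∣≡∣p∣ (p - q)))
  (cong ∣_∣ (solve 2 (λ p q → :- (p :- q) := q :- p) refl p q))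

∣-∣<⇒< : ∀ p q {ε} → ∣ p - q ∣ < ε → p < q + ε
∣-∣<⇒< p q {ε} h = subst (_< q + ε)
  (solve 2 (λ p q → q :+ (p :- q) := p) refl p q)
  (+-monoʳ-< q (≤-<-trans (p≤∣p∣ (p - q)) h))

<⇒∣-∣< : ∀ {p q ε} → p < q + ε → q < p + ε → ∣ p - q ∣ < ε
<⇒∣-∣< {p} {q} {ε} h k with ∣p∣≡p∨∣p∣≡-p (p - q)
... | inj₁ e = subst₂ _<_ (sym e) (solve 2 (λ q ε → q :+ ε :- q := ε) refl q ε)
                 (+-monoˡ-< (- q) h)
... | inj₂ e = subst₂ _<_
  (trans (solve 2 (λ p q → q :- p := :- (p :- q)) refl p q) (sym e))
  (solve 2 (λ p ε → p :+ ε :- p := ε) refl p ε)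
                 (+-monoˡ-< (- p) k)

fromℕℚ : ℕ → ℚ
fromℕℚ n = + n / 1

toℚᵘ-/ : ∀ i n → toℚᵘ (i / suc n) ℚᵘ.≃ ℚᵘ.mkℚᵘ i n
toℚᵘ-/ i n = toℚᵘ-fromℚᵘ (ℚᵘ.mkℚᵘ i n)

fromℕℚ-* : ∀ m n → fromℕℚ (m ℕ.* n) ≡ fromℕℚ m * fromℕℚ n
fromℕℚ-* m n = toℚᵘ-injective (ℚᵘP.≃-trans (toℚᵘ-/ (+ (m ℕ.* n)) 0)
  (ℚᵘP.≃-trans (ℚᵘ.*≡* (cong (ℤ._* + 1) (ℤP.pos-* m n)))
  (ℚᵘP.≃-sym (ℚᵘP.≃-trans (toℚᵘ-homo-* (fromℕℚ m) (fromℕℚ n))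
     (ℚᵘP.*-cong (toℚᵘ-/ (+ m) 0) (toℚᵘ-/ (+ n) 0))))))

fromℕℚ-+ : ∀ m n → fromℕℚ (m ℕ.+ n) ≡ fromℕℚ m + fromℕℚ n
fromℕℚ-+ m n = toℚᵘ-injective (ℚᵘP.≃-trans (toℚᵘ-/ (+ (m ℕ.+ n)) 0)
  (ℚᵘP.≃-trans (ℚᵘ.*≡* (cong (ℤ._* + 1) (trans (ℤP.pos-+ m n)
      (cong₂ ℤ._+_ (sym (ℤP.*-identityʳ (+ m))) (sym (ℤP.*-identityʳ (+ n)))))))
  (ℚᵘP.≃-sym (ℚᵘP.≃-trans (toℚᵘ-homo-+ (fromℕℚ m) (fromℕℚ n))
     (ℚᵘP.+-cong (toℚᵘ-/ (+ m) 0) (toℚᵘ-/ (+ n) 0))))))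

fromℕℚ-≤ : ∀ {m n} → m ℕ.≤ n → fromℕℚ m ≤ fromℕℚ n
fromℕℚ-≤ {m} {n} m≤n = toℚᵘ-cancel-≤
  (ℚᵘP.≤-respˡ-≃ (ℚᵘP.≃-sym (toℚᵘ-/ (+ m) 0))
  (ℚᵘP.≤-respʳ-≃ (ℚᵘP.≃-sym (toℚᵘ-/ (+ n) 0))
  (ℚᵘ.*≤* (ℤP.*-monoʳ-≤-nonNeg (+ 1) (ℤ.+≤+ m≤n)))))

fromℕℚ-< : ∀ {m n} → m ℕ.< n → fromℕℚ m < fromℕℚ n
fromℕℚ-< {m} {n} m<n = toℚᵘ-cancel-<
  (ℚᵘP.<-respˡ-≃ (ℚᵘP.≃-sym (toℚᵘ-/ (+ m) 0))
  (ℚᵘP.<-respʳ-≃ (ℚᵘP.≃-sym (toℚᵘ-/ (+ n) 0))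
  (ℚᵘ.*<* (ℤP.*-monoʳ-<-pos (+ 1) (ℤ.+<+ m<n)))))

0≤fromℕℚ : ∀ n → 0ℚ ≤ fromℕℚ n
0≤fromℕℚ n = fromℕℚ-≤ {0} {n} z≤n

0<fromℕℚ-suc : ∀ n → 0ℚ < fromℕℚ (suc n)
0<fromℕℚ-suc n = fromℕℚ-< {0} {suc n} (s≤s z≤n)

/-*-cancel : ∀ k n → (+ k / suc n) * fromℕℚ (suc n) ≡ fromℕℚ k
/-*-cancel k n = toℚᵘ-injective
  (ℚᵘP.≃-trans (toℚᵘ-homo-* (+ k / suc n) (fromℕℚ (suc n)))
  (ℚᵘP.≃-trans (ℚᵘP.*-cong (toℚᵘ-/ (+ k) n) (toℚᵘ-/ (+ suc n) 0))
  (ℚᵘP.≃-trans (ℚᵘ.*≡* (trans (ℤP.*-identityʳ (+ k ℤ.* + suc n))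
                   (cong (λ z → + k ℤ.* + z) (sym (ℕP.*-identityʳ (suc n))))))
  (ℚᵘP.≃-sym (toℚᵘ-/ (+ k) 0)))))

*-cancelʳ-≡ : ∀ {p q} r → 0ℚ < r → p * r ≡ q * r → p ≡ q
*-cancelʳ-≡ r 0<r e = ≤-antisym
  (*-cancelʳ-≤-pos r {{positive 0<r}} (≤-reflexive e))
  (*-cancelʳ-≤-pos r {{positive 0<r}} (≤-reflexive (sym e)))

unit : ℕ → ℚ
unit n = + 1 / suc n

unit-* : ∀ n → unit n * fromℕℚ (suc n) ≡ 1ℚ
unit-* n = /-*-cancel 1 n

0<unit : ∀ n → 0ℚ < unit n
0<unit n = *-cancelʳ-<-nonNeg (fromℕℚ (suc n)) {{nonNegative (0≤fromℕℚ (suc n))}}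
  (subst₂ _<_ (sym (*-zeroˡ (fromℕℚ (suc n)))) (sym (unit-* n)) (positive⁻¹ 1ℚ))

unit-anti : ∀ {m n} → m ℕ.≤ n → unit n ≤ unit m
unit-anti {m} {n} m≤n = *-cancelʳ-≤-pos (fromℕℚ (suc n)) {{positive (0<fromℕℚ-suc n)}}
  (subst (_≤ unit m * fromℕℚ (suc n)) (trans (unit-* m) (sym (unit-* n)))
    (*-monoˡ-≤-nonNeg (unit m) {{nonNegative (<⇒≤ (0<unit m))}} (fromℕℚ-≤ (s≤s m≤n))))

unit-strict : ∀ n → unit (suc n) < unit n
unit-strict n = *-cancelʳ-<-nonNeg (fromℕℚ (2 ℕ.+ n)) {{nonNegative (0≤fromℕℚ (2 ℕ.+ n))}}
  (subst (_< unit n * fromℕℚ (2 ℕ.+ n)) (trans (unit-* n) (sym (unit-* (suc n))))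
    (*-monoʳ-<-pos (unit n) {{positive (0<unit n)}} (fromℕℚ-< {suc n} {2 ℕ.+ n} ℕP.≤-refl)))

archimedean : ∀ {ε} → 0ℚ < ε → ∃ λ M → ∀ n → M ℕ.≤ n → unit n < ε
archimedean {ε@(mkℚ -[1+ a ] d c)} h with positive h
... | ()
archimedean {ε@(mkℚ (+ zero) d c)} h with positive h
... | ()
archimedean {ε@(mkℚ (+ suc a) d c)} h = suc d , λ n M≤n →
  ≤-<-trans (unit-anti M≤n) (<-≤-trans (unit-strict d) le)
  where
  le : unit d ≤ ε
  le = toℚᵘ-cancel-≤ (ℚᵘP.≤-respˡ-≃ (ℚᵘP.≃-sym (toℚᵘ-/ (+ 1) d))
    (ℚᵘ.*≤* (ℤP.*-monoʳ-≤-nonNeg (+ suc d) {+ 1} {+ suc a} (ℤ.+≤+ (s≤s z≤n)))))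

------------------------------------------------------------------------
-- Real numbers: Cauchy sequences of rationals, up to _≈ᴿ_

Eventually : (ℕ → Set) → Set
Eventually P = ∃[ M ] ∀ n → M ℕ.≤ n → P n

IsCauchy : (ℕ → ℚ) → Set
IsCauchy x = ∀ ε → 0ℚ < ε → ∃[ M ] ∀ m n → M ℕ.≤ m → M ℕ.≤ n → ∣ x m - x n ∣ < ε

record ℝ : Set where
  constructor mkℝ
  field
    seq    : ℕ → ℚ
    cauchy : IsCauchy seq

open ℝ public

infix 4 _≈ᴿ_ _<ᴿ_ _≤ᴿ_

_≈ᴿ_ : ℝ → ℝ → Set
x ≈ᴿ y = ∀ ε → 0ℚ < ε → Eventually λ n → ∣ seq x n - seq y n ∣ < ε

_<ᴿ_ : ℝ → ℝ → Set
x <ᴿ y = ∃[ ε ] 0ℚ < ε × Eventually λ n → seq x n + ε < seq y n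

_≤ᴿ_ : ℝ → ℝ → Set
x ≤ᴿ y = ¬ (y <ᴿ x)

oneSided : ∀ {x} →
  (∀ ε → 0ℚ < ε → ∃[ M ] ∀ m n → M ℕ.≤ m → M ℕ.≤ n → x m < x n + ε) → IsCauchy x
oneSided h ε 0<ε with h ε 0<ε
... | M , p = M , λ m n M≤m M≤n → <⇒∣-∣< (p m n M≤m M≤n) (p n m M≤n M≤m)

fromℚ : ℚ → ℝ
fromℚ q = mkℝ (λ _ → q) λ ε 0<ε → 0 , λ _ _ _ _ →
  subst (λ z → ∣ z ∣ < ε) (sym (+-inverseʳ q)) 0<ε

0ᴿ : ℝ
0ᴿ = fromℚ 0ℚ

fromℕ : ℕ → ℝ
fromℕ n = fromℚ (+ n / 1)

infixl 6 _+ᴿ_ _-ᴿ_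
infixl 7 _*ᴿ_
infix  8 -ᴿ_

_+ᴿ_ : ℝ → ℝ → ℝ
x +ᴿ y = mkℝ (λ n → seq x n + seq y n) (oneSided go)
  where
  go : ∀ ε → 0ℚ < ε → _
  go ε 0<ε with cauchy x (½ * ε) (0<½* 0<ε) | cauchy y (½ * ε) (0<½* 0<ε)
  ... | M , p | N , q = M ℕ.⊔ N , λ m n M≤m M≤n → subst (seq x m + seq y m <_)
    (solve 3 (λ a b e → (a :+ con ½ :* e) :+ (b :+ con ½ :* e) := (a :+ b) :+ e)
       refl (seq x n) (seq y n) ε)
    (+-mono-< {seq x m} {seq x n + ½ * ε} {seq y m} {seq y n + ½ * ε}
      (∣-∣<⇒< (seq x m) (seq x n) (p m n (ℕP.m⊔n≤o⇒m≤o M N M≤m) (ℕP.m⊔n≤o⇒m≤o M N M≤n)))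
      (∣-∣<⇒< (seq y m) (seq y n) (q m n (ℕP.m⊔n≤o⇒n≤o M N M≤m) (ℕP.m⊔n≤o⇒n≤o M N M≤n))))

-ᴿ_ : ℝ → ℝ
-ᴿ x = mkℝ (λ n → - seq x n) λ ε 0<ε → proj₁ (cauchy x ε 0<ε) , λ m n M≤m M≤n →
  subst (_< ε)
    (trans (sym (∣-p∣≡∣p∣ (seq x m - seq x n)))
      (cong ∣_∣ (solve 2 (λ a b → :- (a :- b) := :- a :- :- b) refl (seq x m) (seq x n))))
    (proj₂ (cauchy x ε 0<ε) m n M≤m M≤n)

_-ᴿ_ : ℝ → ℝ → ℝ
x -ᴿ y = x +ᴿ -ᴿ y

bounded : ∀ x → ∃[ B ] 0ℚ < B × Eventually λ n → ∣ seq x n ∣ < B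
bounded x with cauchy x 1ℚ (positive⁻¹ 1ℚ)
... | M , p = ∣ seq x M ∣ + 1ℚ , 0<B , M , λ n M≤n →
  ≤-<-trans (subst (λ z → ∣ z ∣ ≤ ∣ seq x M ∣ + ∣ seq x n - seq x M ∣)
      (solve 2 (λ a b → a :+ (b :- a) := b) refl (seq x M) (seq x n))
      (∣p+q∣≤∣p∣+∣q∣ (seq x M) (seq x n - seq x M)))
    (+-monoʳ-< ∣ seq x M ∣ (p n M M≤n ℕP.≤-refl))
  where
  0<B : 0ℚ < ∣ seq x M ∣ + 1ℚ
  0<B = +-mono-≤-< {0ℚ} {∣ seq x M ∣} {0ℚ} {1ℚ} (0≤∣p∣ (seq x M)) (positive⁻¹ 1ℚ)

-- 1/q, with the value 0 at q = 0
inv : ℚ → ℚ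
inv q with q ≟ 0ℚ
... | yes _   = 0ℚ
... | no  q≢0 = (1/ q) {{≢-nonZero q≢0}}

inv-inverseʳ : ∀ {q} → 0ℚ < q → q * inv q ≡ 1ℚ
inv-inverseʳ {q} 0<q with q ≟ 0ℚ
... | yes q≡0 = ⊥-elim (<⇒≢ 0<q (sym q≡0))
... | no  q≢0 = *-inverseʳ q {{≢-nonZero q≢0}}

0<inv : ∀ {q} → 0ℚ < q → 0ℚ < inv q
0<inv {q} 0<q = *-cancelˡ-<-nonNeg q {{nonNegative (<⇒≤ 0<q)}}
  (subst₂ _<_ (sym (*-zeroʳ q)) (sym (inv-inverseʳ 0<q)) (positive⁻¹ 1ℚ))

*-close : ∀ {a b c d B e} → ∣ a ∣ < B → ∣ d ∣ < B → 0ℚ < e →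
  ∣ a - b ∣ < e → ∣ c - d ∣ < e → ∣ a * c - b * d ∣ < B * e + B * e
*-close {a} {b} {c} {d} {B} {e} a<B d<B 0<e ab cd = ≤-<-trans
  (subst (λ z → ∣ z ∣ ≤ ∣ a ∣ * ∣ c - d ∣ + ∣ d ∣ * ∣ a - b ∣)
    (solve 4 (λ a b c d → a :* (c :- d) :+ d :* (a :- b) := a :* c :- b :* d) refl a b c d)
    (≤-trans (∣p+q∣≤∣p∣+∣q∣ (a * (c - d)) (d * (a - b)))
      (≤-reflexive (cong₂ _+_ (∣p*q∣≡∣p∣*∣q∣ a (c - d)) (∣p*q∣≡∣p∣*∣q∣ d (a - b))))))
  (+-mono-< (part a (c - d) a<B cd) (part d (a - b) d<B ab))
  where
  part : ∀ u v → ∣ u ∣ < B → ∣ v ∣ < e → ∣ u ∣ * ∣ v ∣ < B * e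
  part u v u<B v<e = ≤-<-trans
    (*-monoˡ-≤-nonNeg ∣ u ∣ {{∣-∣-nonNeg u}} (<⇒≤ v<e))
    (*-monoˡ-<-pos e {{positive 0<e}} u<B)

split-ε : ∀ c ε → c * inv c ≡ 1ℚ → c * (½ * ε * inv c) + c * (½ * ε * inv c) ≡ ε
split-ε c ε c*i≡1 = trans
  (solve 3 (λ c i ε → c :* (con ½ :* ε :* i) :+ c :* (con ½ :* ε :* i) := (c :* i) :* ε) refl c (inv c) ε)
  (trans (cong (_* ε) c*i≡1) (*-identityˡ ε))

*-cauchy : ∀ {x y : ℕ → ℚ} {C ε e} K L → 0ℚ < e → C * e + C * e ≡ ε →
  (∀ n → K ℕ.≤ n → ∣ x n ∣ < C) → (∀ n → L ℕ.≤ n → ∣ y n ∣ < C) →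
  (∃[ M ] ∀ m n → M ℕ.≤ m → M ℕ.≤ n → ∣ x m - x n ∣ < e) →
  (∃[ M ] ∀ m n → M ℕ.≤ m → M ℕ.≤ n → ∣ y m - y n ∣ < e) →
  ∃[ M ] ∀ m n → M ℕ.≤ m → M ℕ.≤ n → ∣ x m * y m - x n * y n ∣ < ε
*-cauchy {x} {y} {C} {ε} {e} K L 0<e eq x<C y<C (M , p) (N , q) =
  (K ℕ.⊔ L) ℕ.⊔ (M ℕ.⊔ N) , λ m n ≤m ≤n →
    let mK = ℕP.m⊔n≤o⇒m≤o K L (ℕP.m⊔n≤o⇒m≤o (K ℕ.⊔ L) (M ℕ.⊔ N) ≤m)
        nL = ℕP.m⊔n≤o⇒n≤o K L (ℕP.m⊔n≤o⇒m≤o (K ℕ.⊔ L) (M ℕ.⊔ N) ≤n)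
        m' = ℕP.m⊔n≤o⇒n≤o (K ℕ.⊔ L) (M ℕ.⊔ N) ≤m
        n' = ℕP.m⊔n≤o⇒n≤o (K ℕ.⊔ L) (M ℕ.⊔ N) ≤n
    in subst (∣ x m * y m - x n * y n ∣ <_) eq
      (*-close {x m} {x n} {y m} {y n} {C} {e} (x<C m mK) (y<C n nL) 0<e
        (p m n (ℕP.m⊔n≤o⇒m≤o M N m') (ℕP.m⊔n≤o⇒m≤o M N n'))
        (q m n (ℕP.m⊔n≤o⇒n≤o M N m') (ℕP.m⊔n≤o⇒n≤o M N n')))

_*ᴿ_ : ℝ → ℝ → ℝ
x *ᴿ y = mkℝ (λ n → seq x n * seq y n) (go (bounded x) (bounded y))
  where
  go : (∃[ B ] 0ℚ < B × Eventually λ n → ∣ seq x n ∣ < B) →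
       (∃[ B ] 0ℚ < B × Eventually λ n → ∣ seq y n ∣ < B) →
       IsCauchy (λ n → seq x n * seq y n)
  go (A , 0<A , K , x<A) (B , 0<B , L , y<B) ε 0<ε =
    *-cauchy {seq x} {seq y} {A + B} {ε} {e} K L 0<e
      (split-ε (A + B) ε (inv-inverseʳ 0<A+B))
      (λ n K≤n → <-trans (x<A n K≤n) (pos⇒< B 0<B refl))
      (λ n L≤n → <-trans (y<B n L≤n) (pos⇒< A 0<A (+-comm B A)))
      (cauchy x e 0<e) (cauchy y e 0<e)
    where
    0<A+B : 0ℚ < A + B
    0<A+B = 0<-+ 0<A 0<B
    e : ℚ
    e = ½ * ε * inv (A + B)
    0<e : 0ℚ < e
    0<e = 0<-* (0<½* 0<ε) (0<inv 0<A+B)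

-- u = inv a, v = inv b: u - v = u v (b - a) < u v c² ε ≤ ε
inv-close : ∀ {a b c ε} → 0ℚ < c → c < a → c < b → 0ℚ < ε →
  b < a + ε * (c * c) → inv a < inv b + ε
inv-close {a} {b} {c} {ε} 0<c c<a c<b 0<ε h = pos⇒< r 0<r eq
  where
  u = inv a
  v = inv b
  0<a = <-trans 0<c c<a
  0<b = <-trans 0<c c<b
  0<u = 0<inv 0<a
  0<v = 0<inv 0<b
  ua = inv-inverseʳ 0<a
  vb = inv-inverseʳ 0<b
  r₁ = u * v * (a + ε * (c * c) - b)
  0<r₁ : 0ℚ < r₁
  0<r₁ = 0<-* (0<-* 0<u 0<v) (<⇒pos h)
  -- 1 - (uc)(vc) = u (a - c) + u c v (b - c)
  r₂ = ε * (u * (a - c) + u * c * (v * (b - c)))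
  0<r₂ : 0ℚ < r₂
  0<r₂ = 0<-* 0<ε (0<-+ (0<-* 0<u (<⇒pos c<a)) (0<-* (0<-* 0<u 0<c) (0<-* 0<v (<⇒pos c<b))))
  r = r₁ + r₂
  0<r : 0ℚ < r
  0<r = 0<-+ 0<r₁ 0<r₂
  lhs = a * u
  eq : u + r ≡ v + ε
  eq = trans (solve 6 (λ a b c ε u v →
      u :+ (u :* v :* (a :+ ε :* (c :* c) :- b) :+ ε :* (u :* (a :- c) :+ u :* c :* (v :* (b :- c))))
      := u :+ (a :* u) :* v :- u :* (b :* v) :+ ε :* (a :* u) :+ ε :* (c :* u) :* (b :* v :- con 1ℚ))
      refl a b c ε u v)
    (trans (cong₂ (λ s t → u + s * v - u * t + ε * s + ε * (c * u) * (t - 1ℚ)) ua vb)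
     (solve 4 (λ c ε u v → u :+ con 1ℚ :* v :- u :* con 1ℚ :+ ε :* con 1ℚ :+ ε :* (c :* u) :* (con 1ℚ :- con 1ℚ) := v :+ ε)
       refl c ε u v))

recip : (x : ℝ) → 0ᴿ <ᴿ x → ℝ
recip x (c , 0<c , K , c<x) = mkℝ (λ n → inv (seq x n)) (oneSided go)
  where
  c<x' : ∀ n → K ℕ.≤ n → c < seq x n
  c<x' n K≤n = subst (_< seq x n) (+-identityˡ c) (c<x n K≤n)
  go : ∀ ε → 0ℚ < ε → _
  go ε 0<ε with cauchy x (ε * (c * c)) (0<-* 0<ε (0<-* 0<c 0<c))
  ... | M , p = K ℕ.⊔ M , λ m n ≤m ≤n →
    inv-close 0<c (c<x' m (ℕP.m⊔n≤o⇒m≤o K M ≤m)) (c<x' n (ℕP.m⊔n≤o⇒m≤o K M ≤n)) 0<ε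
      (∣-∣<⇒< (seq x n) (seq x m) (p n m (ℕP.m⊔n≤o⇒n≤o K M ≤n) (ℕP.m⊔n≤o⇒n≤o K M ≤m)))

------------------------------------------------------------------------
-- Square roots

isqrt : ℕ → ℕ
isqrt zero    = zero
isqrt (suc n) with suc (isqrt n) ℕ.* suc (isqrt n) ℕ.≤? suc n
... | yes _ = suc (isqrt n)
... | no  _ = isqrt n

isqrt-lower : ∀ n → isqrt n ℕ.* isqrt n ℕ.≤ n
isqrt-lower zero    = z≤n
isqrt-lower (suc n) with suc (isqrt n) ℕ.* suc (isqrt n) ℕ.≤? suc n
... | yes h = h
... | no  _ = ℕP.m≤n⇒m≤1+n (isqrt-lower n)

isqrt-upper : ∀ n → n ℕ.< suc (isqrt n) ℕ.* suc (isqrt n)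
isqrt-upper zero    = s≤s z≤n
isqrt-upper (suc n) with suc (isqrt n) ℕ.* suc (isqrt n) ℕ.≤? suc n
... | no  h = ℕP.≰⇒> h
... | yes _ = ℕP.<-≤-trans (s≤s (isqrt-upper n))
                (ℕP.*-mono-< (ℕP.n<1+n (suc (isqrt n))) (ℕP.n<1+n (suc (isqrt n))))

-- For q = a/(d+1) ≥ 0, the largest multiple s of 1/((d+1)(n+1)) with s² ≤ q.
sqrtℚ : ℕ → ℚ → ℚ
sqrtℚ n (mkℚ (+ a)    d _) = + isqrt (a ℕ.* suc d ℕ.* (suc n ℕ.* suc n)) / (suc d ℕ.* suc n)
sqrtℚ n (mkℚ -[1+ _ ] _ _) = 0ℚ

≤-scale : ∀ {p q} r → 0ℚ < r → p * r ≤ q * r → p ≤ q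
≤-scale r 0<r = *-cancelʳ-≤-pos r {{positive 0<r}}

<-scale : ∀ {p q} r → 0ℚ < r → p * r < q * r → p < q
<-scale r 0<r = *-cancelʳ-<-nonNeg r {{nonNegative (<⇒≤ 0<r)}}

sq-mono-≤ : ∀ {p q} → 0ℚ ≤ p → p ≤ q → p * p ≤ q * q
sq-mono-≤ {p} {q} 0≤p p≤q = ≤-trans
  (*-monoˡ-≤-nonNeg p {{nonNegative 0≤p}} p≤q)
  (*-monoʳ-≤-nonNeg q {{nonNegative (≤-trans 0≤p p≤q)}} p≤q)

mkℚ-*-cancel : ∀ a d .(c : Coprime a (suc d)) → mkℚ (+ a) d c * fromℕℚ (suc d) ≡ fromℕℚ a
mkℚ-*-cancel a d c = toℚᵘ-injective
  (ℚᵘP.≃-trans (toℚᵘ-homo-* (mkℚ (+ a) d c) (fromℕℚ (suc d)))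
  (ℚᵘP.≃-trans (ℚᵘP.*-congˡ {ℚᵘ.mkℚᵘ (+ a) d} (toℚᵘ-/ (+ suc d) 0))
  (ℚᵘP.≃-trans (ℚᵘ.*≡* (trans (ℤP.*-identityʳ (+ a ℤ.* + suc d))
                   (cong (λ z → + a ℤ.* + z) (sym (ℕP.*-identityʳ (suc d))))))
  (ℚᵘP.≃-sym (toℚᵘ-/ (+ a) 0)))))

module Scaled (a d n : ℕ) (q : ℚ) (q*D≡a : q * fromℕℚ (suc d) ≡ fromℕℚ a) where
  X k : ℕ
  X = a ℕ.* suc d ℕ.* (suc n ℕ.* suc n)
  k = isqrt X
  s D m P : ℚ
  s = + k / (suc d ℕ.* suc n)
  D = fromℕℚ (suc d)
  m = fromℕℚ (suc n)
  P = fromℕℚ (suc d ℕ.* suc n)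

  P≡D*m : P ≡ D * m
  P≡D*m = fromℕℚ-* (suc d) (suc n)

  0<P*P : 0ℚ < P * P
  0<P*P = 0<-* (0<fromℕℚ-suc (n ℕ.+ d ℕ.* suc n)) (0<fromℕℚ-suc (n ℕ.+ d ℕ.* suc n))

  s*P : s * P ≡ fromℕℚ k
  s*P = /-*-cancel k (n ℕ.+ d ℕ.* suc n)

  q*PP : q * (P * P) ≡ fromℕℚ X
  q*PP = trans (cong (λ z → q * (z * z)) P≡D*m)
    (trans (solve 3 (λ q D m → q :* ((D :* m) :* (D :* m)) := (q :* D) :* D :* (m :* m)) refl q D m)
    (trans (cong (λ z → z * D * (m * m)) q*D≡a)
    (trans (cong₂ _*_ (sym (fromℕℚ-* a (suc d))) (sym (fromℕℚ-* (suc n) (suc n))))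
      (sym (fromℕℚ-* (a ℕ.* suc d) (suc n ℕ.* suc n))))))

  lower : s * s ≤ q
  lower = ≤-scale (P * P) 0<P*P (subst₂ _≤_
    (trans (fromℕℚ-* k k) (trans (cong₂ _*_ (sym s*P) (sym s*P))
      (solve 2 (λ s P → (s :* P) :* (s :* P) := (s :* s) :* (P :* P)) refl s P)))
    (sym q*PP) (fromℕℚ-≤ (isqrt-lower X)))

  unit*P : unit n * P ≡ D
  unit*P = trans (cong (unit n *_) P≡D*m)
    (trans (solve 3 (λ u D m → u :* (D :* m) := (u :* m) :* D) refl (unit n) D m)
    (trans (cong (_* D) (unit-* n)) (*-identityˡ D)))

  k+d : fromℕℚ (k ℕ.+ suc d) ≡ (s + unit n) * P
  k+d = trans (fromℕℚ-+ k (suc d)) (trans (cong₂ _+_ (sym s*P) (sym unit*P))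
    (sym (*-distribʳ-+ P s (unit n))))

  1+k≤k+d : suc k ℕ.≤ k ℕ.+ suc d
  1+k≤k+d = subst (suc k ℕ.≤_) (sym (ℕP.+-suc k d)) (s≤s (ℕP.m≤m+n k d))

  upper : q < (s + unit n) * (s + unit n)
  upper = <-scale (P * P) 0<P*P (subst₂ _<_
    (sym q*PP)
    (trans (fromℕℚ-* (k ℕ.+ suc d) (k ℕ.+ suc d)) (trans (cong₂ _*_ k+d k+d)
      (solve 2 (λ t P → (t :* P) :* (t :* P) := (t :* t) :* (P :* P)) refl (s + unit n) P)))
    (fromℕℚ-< (ℕP.<-≤-trans (isqrt-upper X) (ℕP.*-mono-≤ 1+k≤k+d 1+k≤k+d))))

  0≤s : 0ℚ ≤ s
  0≤s = ≤-scale P (0<fromℕℚ-suc (n ℕ.+ d ℕ.* suc n))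
    (subst₂ _≤_ (sym (*-zeroˡ P)) (sym s*P) (0≤fromℕℚ k))

0≤sqrtℚ : ∀ n q → 0ℚ ≤ sqrtℚ n q
0≤sqrtℚ n (mkℚ (+ a)    d c) = Scaled.0≤s a d n (mkℚ (+ a) d c) (mkℚ-*-cancel a d c)
0≤sqrtℚ n (mkℚ -[1+ _ ] _ _) = ≤-refl

sqrtℚ-lower : ∀ n q → sqrtℚ n q ≡ 0ℚ ⊎ sqrtℚ n q * sqrtℚ n q ≤ q
sqrtℚ-lower n (mkℚ (+ a)    d c) = inj₂ (Scaled.lower a d n (mkℚ (+ a) d c) (mkℚ-*-cancel a d c))
sqrtℚ-lower n (mkℚ -[1+ _ ] _ _) = inj₁ refl

sqrtℚ-upper : ∀ n q → q < (sqrtℚ n q + unit n) * (sqrtℚ n q + unit n)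
sqrtℚ-upper n (mkℚ (+ a)    d c) = Scaled.upper a d n (mkℚ (+ a) d c) (mkℚ-*-cancel a d c)
sqrtℚ-upper n q@(mkℚ -[1+ _ ] _ _) = <-trans (negative⁻¹ q)
  (0<-* (+-mono-≤-< (≤-refl {0ℚ}) (0<unit n)) (+-mono-≤-< (≤-refl {0ℚ}) (0<unit n)))

sqrtℚ-close : ∀ m n a b ε → 0ℚ < ε → unit n ≤ ½ * ε →
  a < b + ½ * ε * (½ * ε) → sqrtℚ m a < sqrtℚ n b + ε
sqrtℚ-close m n a b ε 0<ε u≤ h = ≰⇒> no-way
  where
  s = sqrtℚ m a
  t = sqrtℚ n b
  0≤t : 0ℚ ≤ t
  0≤t = 0≤sqrtℚ n b
  0<t+ε : 0ℚ < t + ε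
  0<t+ε = +-mono-≤-< 0≤t 0<ε
  a<s*s : t + ε ≤ s → a < s * s
  a<s*s t+ε≤s = <-≤-trans
    (<-trans h (+-monoˡ-< (½ * ε * (½ * ε)) (sqrtℚ-upper n b)))
    (≤-trans (+-monoˡ-≤ (½ * ε * (½ * ε))
               (sq-mono-≤ (0≤-+ 0≤t (<⇒≤ (0<unit n))) (+-monoʳ-≤ t u≤)))
    (≤-trans (nonNeg⇒≤ (ε * t + ½ * (ε * ε))
               (0≤-+ (0≤-* (<⇒≤ 0<ε) 0≤t) (<⇒≤ (0<½* (0<-* 0<ε 0<ε))))
               (solve 2 (λ t ε → (t :+ con ½ :* ε) :* (t :+ con ½ :* ε) :+ con ½ :* ε :* (con ½ :* ε)
                    :+ (ε :* t :+ con ½ :* (ε :* ε)) := (t :+ ε) :* (t :+ ε)) refl t ε))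
             (sq-mono-≤ (<⇒≤ 0<t+ε) t+ε≤s)))
  no-way : ¬ (t + ε ≤ s)
  no-way t+ε≤s with sqrtℚ-lower m a
  ... | inj₁ s≡0 = <-irrefl refl (<-≤-trans 0<t+ε (≤-trans t+ε≤s (≤-reflexive s≡0)))
  ... | inj₂ s²≤a = <-irrefl refl (<-≤-trans (a<s*s t+ε≤s) s²≤a)

-- The square root of max(x, 0): the rational approximations of a negative
-- number are sent to 0.
√_ : ℝ → ℝ
√ x = mkℝ (λ n → sqrtℚ n (seq x n)) (oneSided go)
  where
  go : ∀ ε → 0ℚ < ε → ∃[ M ] ∀ m n → M ℕ.≤ m → M ℕ.≤ n →
         sqrtℚ m (seq x m) < sqrtℚ n (seq x n) + ε
  go ε 0<ε with archimedean (0<½* 0<ε)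
              | cauchy x (½ * ε * (½ * ε)) (0<-* (0<½* 0<ε) (0<½* 0<ε))
  ... | M , p | N , q = M ℕ.⊔ N , λ m n ≤m ≤n →
    sqrtℚ-close m n (seq x m) (seq x n) ε 0<ε (<⇒≤ (p n (ℕP.m⊔n≤o⇒m≤o M N ≤n)))
      (∣-∣<⇒< (seq x m) (seq x n) (q m n (ℕP.m⊔n≤o⇒n≤o M N ≤m) (ℕP.m⊔n≤o⇒n≤o M N ≤n)))

¼ : ℚ
¼ = ½ * ½

sqrtℚ-pos : ∀ n q c → 0ℚ < c → c < q → unit n ≤ ¼ * (c ⊓ 1ℚ) → ¼ * (c ⊓ 1ℚ) < sqrtℚ n q
sqrtℚ-pos n q c 0<c c<q u≤ = ≰⇒> λ s≤ → <-irrefl refl (<-trans c<q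
  (<-≤-trans (sqrtℚ-upper n q)
  (≤-trans (sq-mono-≤ (0≤-+ (0≤sqrtℚ n q) (<⇒≤ (0<unit n))) (+-mono-≤ s≤ u≤))
  (≤-trans (nonNeg⇒≤ (¼ * (w * (1ℚ - w)) + (½ * w + ¼ * w))
       (0≤-+ (0≤-* 0≤¼ (0≤-* 0≤w (≤⇒nonNeg (p⊓q≤q c 1ℚ))))
             (0≤-+ (0≤-* (<⇒≤ 0<½) 0≤w) (0≤-* 0≤¼ 0≤w)))
       (solve 1 (λ w → (con ¼ :* w :+ con ¼ :* w) :* (con ¼ :* w :+ con ¼ :* w)
                 :+ (con ¼ :* (w :* (con 1ℚ :- w)) :+ (con ½ :* w :+ con ¼ :* w)) := w) refl w))
     (p⊓q≤p c 1ℚ)))))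
  where
  w : ℚ
  w = c ⊓ 1ℚ
  0≤¼ : 0ℚ ≤ ¼
  0≤¼ = nonNegative⁻¹ ¼
  0≤w : 0ℚ ≤ w
  0≤w = ⊓-glb (<⇒≤ 0<c) (nonNegative⁻¹ 1ℚ)

0<⊓ : ∀ {p q} → 0ℚ < p → 0ℚ < q → 0ℚ < p ⊓ q
0<⊓ {p} {q} 0<p 0<q with ⊓-sel p q
... | inj₁ e = subst (0ℚ <_) (sym e) 0<p
... | inj₂ e = subst (0ℚ <_) (sym e) 0<q

√-pos : ∀ x → 0ᴿ <ᴿ x → 0ᴿ <ᴿ √ x
√-pos x (c , 0<c , M , p) with archimedean (0<-* (positive⁻¹ ¼) (0<⊓ 0<c (positive⁻¹ 1ℚ)))
... | N , u = ¼ * (c ⊓ 1ℚ) , 0<-* (positive⁻¹ ¼) (0<⊓ 0<c (positive⁻¹ 1ℚ)) , M ℕ.⊔ N , λ n ≤n →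
  subst (_< sqrtℚ n (seq x n)) (sym (+-identityˡ (¼ * (c ⊓ 1ℚ))))
    (sqrtℚ-pos n (seq x n) c 0<c
      (subst (_< seq x n) (+-identityˡ c) (p n (ℕP.m⊔n≤o⇒m≤o M N ≤n)))
      (<⇒≤ (u n (ℕP.m⊔n≤o⇒n≤o M N ≤n))))

------------------------------------------------------------------------
-- Logarithms of natural numbers

-- Σ_{i < K} 1/(M + i + 1)
harmonic : ℕ → ℕ → ℚ
harmonic M zero    = 0ℚ
harmonic M (suc K) = harmonic M K + + 1 / suc (M ℕ.+ K)

unit-half : ∀ k → unit k ≡ unit (suc (2 ℕ.* k)) + unit (suc (2 ℕ.* k))
unit-half k = *-cancelʳ-≡ (F + F) (0<-+ (0<fromℕℚ-suc k) (0<fromℕℚ-suc k))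
  (trans (*-distribˡ-+ (unit k) F F) (trans (cong₂ _+_ (unit-* k) (unit-* k))
    (sym (trans (*-distribʳ-+ (F + F) u u) (cong₂ _+_ u*2F u*2F)))))
  where
  F u : ℚ
  F = fromℕℚ (suc k)
  u = unit (suc (2 ℕ.* k))
  u*2F : u * (F + F) ≡ 1ℚ
  u*2F = trans (cong (u *_) (trans (sym (fromℕℚ-+ (suc k) (suc k)))
           (cong fromℕℚ (trans (cong (suc k ℕ.+_) (sym (ℕP.+-identityʳ (suc k)))) (ℕP.*-suc 2 k)))))
         (unit-* (suc (2 ℕ.* k)))

harmonic-double : ∀ M K → harmonic (2 ℕ.* M) (2 ℕ.* suc K) ≡
  harmonic (2 ℕ.* M) (2 ℕ.* K) + unit (2 ℕ.* (M ℕ.+ K)) + unit (suc (2 ℕ.* (M ℕ.+ K)))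
harmonic-double M K = trans (cong (harmonic (2 ℕ.* M)) (ℕP.*-suc 2 K))
  (cong₂ (λ i j → harmonic (2 ℕ.* M) (2 ℕ.* K) + unit i + unit j)
    (sym (ℕP.*-distribˡ-+ 2 M K))
    (trans (ℕP.+-suc (2 ℕ.* M) (2 ℕ.* K)) (cong suc (sym (ℕP.*-distribˡ-+ 2 M K)))))

harmonic-incr : ∀ M K → harmonic M K ≤ harmonic (2 ℕ.* M) (2 ℕ.* K)
harmonic-incr M zero    = ≤-refl
harmonic-incr M (suc K) = ≤-trans
  (+-mono-≤ (harmonic-incr M K)
    (≤-trans (≤-reflexive (unit-half k)) (+-monoˡ-≤ (unit (suc (2 ℕ.* k))) (unit-anti (ℕP.n≤1+n (2 ℕ.* k))))))
  (≤-reflexive (trans (sym (+-assoc (harmonic (2 ℕ.* M) (2 ℕ.* K)) (unit (2 ℕ.* k)) (unit (suc (2 ℕ.* k)))))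
    (sym (harmonic-double M K))))
  where
  k : ℕ
  k = M ℕ.+ K

harmonic-decr : ∀ m K →
  harmonic (2 ℕ.* suc m) (2 ℕ.* K) + unit (suc (2 ℕ.* (m ℕ.+ K))) ≤ harmonic (suc m) K + unit (suc (2 ℕ.* m))
harmonic-decr m zero    = ≤-reflexive (cong (λ z → 0ℚ + unit (suc (2 ℕ.* z))) (ℕP.+-identityʳ m))
harmonic-decr m (suc K) = begin
  harmonic (2 ℕ.* suc m) (2 ℕ.* suc K) + unit (suc (2 ℕ.* (m ℕ.+ suc K)))
    ≡⟨ cong₂ _+_ (harmonic-double (suc m) K) (cong (λ z → unit (suc (2 ℕ.* z))) (ℕP.+-suc m K)) ⟩
  H' + unit (2 ℕ.* suc j) + u + u
    ≤⟨ +-monoˡ-≤ u (+-monoˡ-≤ u (+-monoʳ-≤ H' (unit-anti (subst (suc (2 ℕ.* j) ℕ.≤_) (sym (ℕP.*-suc 2 j)) (ℕP.n≤1+n _))))) ⟩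
  H' + v + u + u
    ≡⟨ +-assoc (H' + v) u u ⟩
  H' + v + (u + u)
    ≤⟨ +-monoˡ-≤ (u + u) (harmonic-decr m K) ⟩
  H + w + (u + u)
    ≡⟨ solve 3 (λ H w x → H :+ w :+ x := H :+ x :+ w) refl H w (u + u) ⟩
  H + (u + u) + w
    ≡⟨ cong (λ z → H + z + w) (sym (unit-half (suc j))) ⟩
  H + unit (suc j) + w ∎
  where
  open ≤-Reasoning
  j : ℕ
  j = m ℕ.+ K
  H' H u v w : ℚ
  H' = harmonic (2 ℕ.* suc m) (2 ℕ.* K)
  H = harmonic (suc m) K
  u = unit (suc (2 ℕ.* suc j))
  v = unit (suc (2 ℕ.* j))
  w = unit (suc (2 ℕ.* m))

logSeq : ℕ → ℕ → ℚ
logSeq N n = harmonic (2 ℕ.^ n) ((N ℕ.∸ 1) ℕ.* 2 ℕ.^ n)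

1/2^ : ℕ → ℚ
1/2^ n = unit (ℕ.pred (2 ℕ.^ n))

suc-pred-2^ : ∀ n → suc (ℕ.pred (2 ℕ.^ n)) ≡ 2 ℕ.^ n
suc-pred-2^ n = ℕP.suc-pred (2 ℕ.^ n) {{ℕP.m^n≢0 2 n}}

*-2^-suc : ∀ k n → k ℕ.* (2 ℕ.^ suc n) ≡ 2 ℕ.* (k ℕ.* 2 ℕ.^ n)
*-2^-suc k n = trans (sym (ℕP.*-assoc k 2 (2 ℕ.^ n)))
  (trans (cong (ℕ._* 2 ℕ.^ n) (ℕP.*-comm k 2)) (ℕP.*-assoc 2 k (2 ℕ.^ n)))

logSeq-suc : ∀ N n → logSeq N (suc n) ≡ harmonic (2 ℕ.* 2 ℕ.^ n) (2 ℕ.* ((N ℕ.∸ 1) ℕ.* 2 ℕ.^ n))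
logSeq-suc N n = cong (harmonic (2 ℕ.^ suc n)) (*-2^-suc (N ℕ.∸ 1) n)

logSeq-incr : ∀ N n → logSeq N n ≤ logSeq N (suc n)
logSeq-incr N n = ≤-trans (harmonic-incr (2 ℕ.^ n) ((N ℕ.∸ 1) ℕ.* 2 ℕ.^ n))
  (≤-reflexive (sym (logSeq-suc N n)))

harmonic-step : ∀ M K m → suc m ≡ M →
  harmonic (2 ℕ.* M) (2 ℕ.* K) + unit (ℕ.pred (2 ℕ.* M)) ≤ harmonic M K + unit (ℕ.pred M)
harmonic-step .(suc m) K m refl = begin
  H' + unit (m ℕ.+ suc (m ℕ.+ 0))
    ≡⟨ cong (λ z → H' + unit z) (ℕP.+-suc m (m ℕ.+ 0)) ⟩
  H' + w
    ≤⟨ nonNeg⇒≤ v (<⇒≤ (0<unit (suc (2 ℕ.* (m ℕ.+ K))))) (solve 3 (λ H w v → H :+ w :+ v := H :+ v :+ w) refl H' w v) ⟩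
  H' + v + w
    ≤⟨ +-monoˡ-≤ w (harmonic-decr m K) ⟩
  harmonic (suc m) K + w + w
    ≡⟨ +-assoc (harmonic (suc m) K) w w ⟩
  harmonic (suc m) K + (w + w)
    ≡⟨ cong (λ z → harmonic (suc m) K + z) (sym (unit-half m)) ⟩
  harmonic (suc m) K + unit m ∎
  where
  open ≤-Reasoning
  H' v w : ℚ
  H' = harmonic (2 ℕ.* suc m) (2 ℕ.* K)
  v = unit (suc (2 ℕ.* (m ℕ.+ K)))
  w = unit (suc (2 ℕ.* m))

logSeq-decr : ∀ N n → logSeq N (suc n) + 1/2^ (suc n) ≤ logSeq N n + 1/2^ n
logSeq-decr N n = ≤-trans (≤-reflexive (cong (_+ 1/2^ (suc n)) (logSeq-suc N n)))
  (harmonic-step (2 ℕ.^ n) ((N ℕ.∸ 1) ℕ.* 2 ℕ.^ n) (ℕ.pred (2 ℕ.^ n)) (suc-pred-2^ n))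

iterate-≤ : (f : ℕ → ℚ) → (∀ n → f n ≤ f (suc n)) → ∀ m k → f m ≤ f (k ℕ.+ m)
iterate-≤ f h m zero    = ≤-refl
iterate-≤ f h m (suc k) = ≤-trans (iterate-≤ f h m k) (h (k ℕ.+ m))

iterate-≥ : (f : ℕ → ℚ) → (∀ n → f (suc n) ≤ f n) → ∀ m k → f (k ℕ.+ m) ≤ f m
iterate-≥ f h m zero    = ≤-refl
iterate-≥ f h m (suc k) = ≤-trans (h (k ℕ.+ m)) (iterate-≥ f h m k)

monotone : (f : ℕ → ℚ) → (∀ n → f n ≤ f (suc n)) → ∀ {m n} → m ℕ.≤ n → f m ≤ f n
monotone f h {m} {n} m≤n = subst (λ z → f m ≤ f z) (ℕP.m∸n+n≡m m≤n) (iterate-≤ f h m (n ℕ.∸ m))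

antitone : (f : ℕ → ℚ) → (∀ n → f (suc n) ≤ f n) → ∀ {m n} → m ℕ.≤ n → f n ≤ f m
antitone f h {m} {n} m≤n = subst (λ z → f z ≤ f m) (ℕP.m∸n+n≡m m≤n) (iterate-≥ f h m (n ℕ.∸ m))

n<2^n : ∀ n → n ℕ.< 2 ℕ.^ n
n<2^n zero    = s≤s z≤n
n<2^n (suc n) = ℕP.≤-trans (ℕP.+-mono-≤ (ℕP.m^n>0 2 n) (n<2^n n))
  (ℕP.≤-reflexive (cong (2 ℕ.^ n ℕ.+_) (sym (ℕP.+-identityʳ (2 ℕ.^ n)))))

1/2^≤unit : ∀ n → 1/2^ n ≤ unit n
1/2^≤unit n = unit-anti (ℕP.<⇒≤pred (n<2^n n))

-- log N = ∫ dt/t over [1, N], as the limit of the right-endpoint Riemann sums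
-- of mesh h = 2⁻ⁿ:  Σ h/(1 + (i+1)h) = Σ 1/(2ⁿ + i + 1),  0 ≤ i < (N - 1)2ⁿ.
-- These increase with n, and adding 2⁻ⁿ makes them decrease.
log : ℕ → ℝ
log N = mkℝ (logSeq N) (oneSided go)
  where
  go : ∀ ε → 0ℚ < ε → ∃[ M ] ∀ m n → M ℕ.≤ m → M ℕ.≤ n → logSeq N m < logSeq N n + ε
  go ε 0<ε with archimedean 0<ε
  ... | M , u = M , λ m n M≤m M≤n →
    <-≤-trans (pos⇒< (1/2^ m) (0<unit (ℕ.pred (2 ℕ.^ m))) refl)
    (≤-trans (antitone (λ n → logSeq N n + 1/2^ n) (logSeq-decr N) M≤m)
    (+-mono-≤ (monotone (logSeq N) (logSeq-incr N) M≤n)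
      (<⇒≤ (≤-<-trans (1/2^≤unit M) (u M ℕP.≤-refl)))))

0≤harmonic : ∀ M K → 0ℚ ≤ harmonic M K
0≤harmonic M zero    = ≤-refl
0≤harmonic M (suc K) = 0≤-+ (0≤harmonic M K) (<⇒≤ (0<unit (M ℕ.+ K)))

log-pos : ∀ {N} → 2 ℕ.≤ N → 0ᴿ <ᴿ log N
log-pos {suc (suc k)} (s≤s (s≤s z≤n)) = ½ * c , 0<½* 0<c , 0 , λ n _ →
  <-≤-trans (pos⇒< (½ * c) (0<½* 0<c) (solve 1 (λ c → con 0ℚ :+ con ½ :* c :+ con ½ :* c := c) refl c))
    (monotone (logSeq (suc (suc k))) (logSeq-incr (suc (suc k))) (z≤n {n}))
  where
  c : ℚ
  c = logSeq (suc (suc k)) 0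
  0<c : 0ℚ < c
  0<c = +-mono-≤-< (0≤harmonic 1 (k ℕ.* 1)) (0<unit (1 ℕ.+ k ℕ.* 1))

------------------------------------------------------------------------
-- Points of the plane and distinct distances

ℝ² : Set
ℝ² = ℝ × ℝ

infix 4 _≈²_

_≈²_ : ℝ² → ℝ² → Set
(x₁ , x₂) ≈² (y₁ , y₂) = x₁ ≈ᴿ y₁ × x₂ ≈ᴿ y₂

dist : ℝ² → ℝ² → ℝ
dist (x₁ , x₂) (y₁ , y₂) =
  √ ((x₁ -ᴿ y₁) *ᴿ (x₁ -ᴿ y₁) +ᴿ (x₂ -ᴿ y₂) *ᴿ (x₂ -ᴿ y₂))

-- An N-element subset of the plane, given by an enumeration without repetition.
PointSet : ℕ → Set
PointSet N = Σ[ p ∈ (Fin N → ℝ²) ] Injective _≡_ _≈²_ p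

-- Distinct unordered pairs of distinct points of Q determine distinct distances.
DistinctDistances : ∀ {N} → PointSet N → Subset N → Set
DistinctDistances (p , _) Q = ∀ i j k l →
  i ∈ Q → j ∈ Q → k ∈ Q → l ∈ Q → i ≢ j → k ≢ l →
  dist (p i) (p j) ≈ᴿ dist (p k) (p l) →
  (i ≡ k × j ≡ l) ⊎ (i ≡ l × j ≡ k)

IsMaximum IsMinimum : (ℕ → Set) → ℕ → Set
IsMaximum S k = S k × (∀ m → S m → m ℕ.≤ k)
IsMinimum S k = S k × (∀ m → S m → k ℕ.≤ m)

-- Δ(P) = k and δ(N) = d.  These are relations because equality of reals is
-- undecidable, so that Δ is not computable; see δ-exists and δ-unique.
IsΔ : ∀ {N} → PointSet N → ℕ → Set
IsΔ {N} P = IsMaximum λ k → Σ[ Q ∈ Subset N ] DistinctDistances P Q × Subset.∣ Q ∣ ≡ k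

Isδ : ℕ → ℕ → Set
Isδ N = IsMinimum λ k → Σ[ P ∈ PointSet N ] IsΔ P k

max-exists : ∀ {S : ℕ → Set} b → (∀ m → S m → m ℕ.≤ b) → ∀ k → S k → ¬ ¬ ∃ (IsMaximum S)
max-exists {S} b S≤b k Sk none = ℕP.<-irrefl refl
  (ℕP.<-≤-trans (s≤s (ℕP.m≤n+m b k)) (subst (ℕ._≤ b) (ℕP.+-suc k b) (below (suc b) k Sk)))
  where
  below : ∀ j m → S m → m ℕ.+ j ℕ.≤ b
  below zero    m Sm = subst (ℕ._≤ b) (sym (ℕP.+-identityʳ m)) (S≤b m Sm)
  below (suc j) m Sm = subst (ℕ._≤ b) (sym (ℕP.+-suc m j))
    (ℕP.≤∧≢⇒< (below j m Sm) λ m+j≡b → none (m , Sm , λ m′ Sm′ →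
      ℕP.+-cancelʳ-≤ j m′ m (subst (m′ ℕ.+ j ℕ.≤_) (sym m+j≡b) (below j m′ Sm′))))

min-exists : ∀ {S : ℕ → Set} k → S k → ¬ ¬ ∃ (IsMinimum S)
min-exists {S} k Sk none = above (suc k) k Sk ℕP.≤-refl
  where
  above : ∀ j m → S m → ¬ (m ℕ.< j)
  above (suc j) m Sm (s≤s m≤j) =
    none (m , Sm , λ m′ Sm′ → ℕP.≮⇒≥ λ m′<m → above j m′ Sm′ (ℕP.<-≤-trans m′<m m≤j))

fromℕ-injective : ∀ {m n} → fromℕ m ≈ᴿ fromℕ n → m ≡ n
fromℕ-injective {m} {n} m≈n with m≈n 1ℚ (positive⁻¹ 1ℚ)
... | M , h = ℕP.≤-antisym (le m n (∣-∣<⇒< (fromℕℚ m) (fromℕℚ n) ∣m-n∣<1))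
    (le n m (∣-∣<⇒< (fromℕℚ n) (fromℕℚ m) (subst (_< 1ℚ) (∣p-q∣≡∣q-p∣ (fromℕℚ m) (fromℕℚ n)) ∣m-n∣<1)))
  where
  ∣m-n∣<1 : ∣ fromℕℚ m - fromℕℚ n ∣ < 1ℚ
  ∣m-n∣<1 = h M ℕP.≤-refl
  le : ∀ a b → fromℕℚ a < fromℕℚ b + 1ℚ → a ℕ.≤ b
  le a b a<b+1 = ℕP.≮⇒≥ λ b<a → <-irrefl refl (<-≤-trans a<b+1
    (subst (_≤ fromℕℚ a) (trans (cong fromℕℚ (ℕP.+-comm 1 b)) (fromℕℚ-+ b 1)) (fromℕℚ-≤ b<a)))

collinear : ∀ N → PointSet N
collinear N = (λ i → fromℕ (toℕ i) , 0ᴿ) , λ e → toℕ-injective (fromℕ-injective (proj₁ e))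

Δ-exists : ∀ {N} (P : PointSet N) → ¬ ¬ ∃ (IsΔ P)
Δ-exists {N} P = max-exists N
  (λ { m (Q , _ , refl) → SubsetP.∣p∣≤n Q }) 0
  (Subset.⊥ , (λ _ _ _ _ i∈⊥ → ⊥-elim (SubsetP.∉⊥ i∈⊥)) , SubsetP.∣⊥∣≡0 N)

δ-exists : ∀ N → ¬ ¬ ∃ (Isδ N)
δ-exists N none = Δ-exists (collinear N) λ { (k , Δ≡k) → min-exists k (collinear N , Δ≡k) none }

δ-unique : ∀ {N d e} → Isδ N d → Isδ N e → d ≡ e
δ-unique (Sd , d≤) (Se , e≤) = ℕP.≤-antisym (d≤ _ Se) (e≤ _ Sd)

module Submission where

-- Take N points of the √N × √N grid. If the distances within a set of k of them are distinct, then k(k − 1)/2 is at most the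
-- number of sums of two squares u² + v² ≤ x, where x ≍ N. Removing gcd(u, v)² and possibly a factor 2 leaves a good number,
-- one all of whose divisors are 1 modulo 4, so it suffices to bound the number D of pairs (s, t) with t good and s² t ≤ x.
--   * The sum S of 1/t over the good t ≤ x has S² ≤ Σ r(n)/n over n ≤ x², where r = 1 ∗ χ₄: good numbers are closed under
--     products, r counts the divisors of a good number, and r ≥ 0 everywhere. As the partial sums of Σ χ₄(d)/d are at most 1,
--     S² ≤ Σ 1/n ≪ log x.
--   * For an additive ℓ comparable to the logarithm, write ℓ(t) as a sum over the prime powers dividing t. Divisors of good
--     numbers are good, so Chebyshev's bound gives Σ ℓ(t) ≪ x S over the good t ≤ x.
--   * If c is the number of s with s² t ≤ x, then log x ≪ ℓ(t) + c and c² ≤ x/t. Summing over the pairs (s, t) gives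
--     D log x ≪ x S.
-- Hence D ≪ x/√(log x) and k ≪ √D.

open import Defs

-- Only an upper bound of the order of Landau's asymptotics for sums of two squares is wanted, so
-- neither primes in progressions nor a lower bound for L(1, χ₄) enters. Squaring S leads to a
-- divisor-type sum, which would have size (log x)² if r were the number of divisors; the
-- cancellation in Σ χ₄(d)/d saves one logarithm. This is why r is used although it agrees with the
-- divisor count only on good numbers, and why its sign elsewhere matters. As c ≤ c², the bound D ≤
-- x S is immediate but too weak by log x. The weight ℓ(t) gains this factor when t is large. When t
-- is small, ℓ(t) is small too, but then many s belong to t and c makes up for it. All estimates are
-- inequalities between rationals. Square roots are avoided by bounding D² and k⁴ in place of D and
-- k; real numbers enter at the end, through a single index of their Cauchy sequences.

module _ where

  import Data.Nat as ℕ
  import Data.Nat.Properties as ℕP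
  import Data.Nat.Tactic.RingSolver as ℕR
  import Data.Fin.Properties as FinP
  import Data.List.Relation.Unary.Unique.Propositional.Properties as Unique
  open import Data.Empty using (⊥; ⊥-elim)
  open import Data.Fin using (Fin; zero; suc; toℕ)
  open import Data.Fin.Properties using (toℕ-injective; suc-injective; toℕ<n)
  open import Data.Fin.Subset as Subset using (Subset; inside; outside)
  open import Data.List.Base using (List; []; _∷_; _++_; map; cartesianProduct)
  open import Data.List.Membership.Propositional using (_∈_)
  open import Data.List.Membership.Propositional.Properties using (∈-map⁻; ∈-cartesianProduct⁻)
  open import Data.List.Properties using (map-++)
  open import Data.List.Relation.Unary.All as All using (All; []; _∷_)
  open import Data.List.Relation.Unary.All.Properties using (++⁺)
  open import Data.List.Relation.Unary.AllPairs using ([]; _∷_)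
  open import Data.List.Relation.Unary.Any using (here; there)
  open import Data.List.Relation.Unary.Unique.Propositional using (Unique)
  open ℕ using (ℕ; zero; suc; z≤n; s≤s; _!)
  open import Data.Nat.Combinatorics using (k![n∸k]!∣n!)
  open import Data.Nat.Coprimality using (Coprime; coprime-divisor; coprime-/gcd; coprime-Bézout)
  open import Data.Nat.Divisibility
  open import Data.Nat.DivMod
    using (m≡m%n+[m/n]*n; m%n<n; m/n*n≤m; m/n≤m; m≥n⇒m/n>0; m<n⇒m/n≡0; m<n*o⇒m/o<n; m*n/n≡m; m/n*n≡m; /-monoˡ-≤)
  open import Data.Nat.GCD using (gcd; gcd[m,n]∣m; gcd[m,n]∣n; gcd[m,n]≡0⇒m≡0; gcd[m,n]≡0⇒n≡0; module Bézout)
  open import Data.Nat.Induction using (<-rec)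
  open import Data.Nat.ListAction using (sum; product)
  open import Data.Nat.ListAction.Properties using (sum-++; product-++)
  open import Data.Nat.Primality using (Prime; prime?; prime⇒irreducible; prime⇒nonZero; prime⇒nonTrivial; euclidsLemma)
  open import Data.Nat.Primality.Factorisation using (factorise)
  open import Data.Product using (∃; ∃₂; ∃-syntax; _×_; _,_; proj₁; proj₂)
  open import Data.Rational using (ℚ; 0ℚ; 1ℚ; _+_; _*_; _-_; -_; _<_; _≤_; _≟_; nonNegative; positive)
  open import Data.Rational.Properties
  open import Data.Rational.Solver using (module +-*-Solver)
  open +-*-Solver using (solve; _:=_; _:+_; _:*_; _:-_; :-_; con)
  open import Data.Sum using (_⊎_; inj₁; inj₂; [_,_]′)
  open import Data.Vec.Base using ([]; _∷_; here; there)
  open import Relation.Binary.Definitions using (tri<; tri≈; tri>)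
  open import Relation.Binary.PropositionalEquality using (_≡_; _≢_; refl; sym; trans; cong; cong₂; subst; subst₂)
  open import Relation.Nullary using (¬_; Dec; yes; no)
  open import Relation.Nullary.Decidable using (_→-dec_)

  -- Rational inequalities and indicators

  *-monoˡ : ∀ {p q} r → 0ℚ ≤ r → p ≤ q → r * p ≤ r * q
  *-monoˡ r 0≤r = *-monoˡ-≤-nonNeg r {{nonNegative 0≤r}}

  *-monoʳ : ∀ {p q} r → 0ℚ ≤ r → p ≤ q → p * r ≤ q * r
  *-monoʳ r 0≤r = *-monoʳ-≤-nonNeg r {{nonNegative 0≤r}}

  *-mono : ∀ {p q r s} → 0ℚ ≤ p → 0ℚ ≤ s → p ≤ q → r ≤ s → p * r ≤ q * s
  *-mono {p} {s = s} 0≤p 0≤s p≤q r≤s = ≤-trans (*-monoˡ p 0≤p r≤s) (*-monoʳ s 0≤s p≤q)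

  0≤1 : 0ℚ ≤ 1ℚ
  0≤1 = <⇒≤ (positive⁻¹ 1ℚ)

  fromℕℚ-suc : ∀ n → fromℕℚ (suc n) ≡ 1ℚ + fromℕℚ n
  fromℕℚ-suc n = fromℕℚ-+ 1 n

  ind : ∀ {P : Set} → Dec P → ℚ
  ind (yes _) = 1ℚ
  ind (no  _) = 0ℚ

  module _ {P : Set} where

    0≤ind : (d : Dec P) → 0ℚ ≤ ind d
    0≤ind (yes _) = 0≤1
    0≤ind (no  _) = ≤-refl

    ind≤1 : (d : Dec P) → ind d ≤ 1ℚ
    ind≤1 (yes _) = ≤-refl
    ind≤1 (no  _) = 0≤1

    ind-yes : (d : Dec P) → P → ind d ≡ 1ℚ
    ind-yes (yes _) p = refl
    ind-yes (no ¬p) p = ⊥-elim (¬p p)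

    ind-no : (d : Dec P) → ¬ P → ind d ≡ 0ℚ
    ind-no (yes p) ¬p = ⊥-elim (¬p p)
    ind-no (no  _) ¬p = refl

    ind-*-mono : (d : Dec P) {a b : ℚ} → (P → a ≤ b) → ind d * a ≤ ind d * b
    ind-*-mono (yes p) h = *-monoˡ 1ℚ 0≤1 (h p)
    ind-*-mono (no  _) {a} {b} h = ≤-reflexive (trans (*-zeroˡ a) (sym (*-zeroˡ b)))

    ind-*-cong : (d : Dec P) {a b : ℚ} → (P → a ≡ b) → ind d * a ≡ ind d * b
    ind-*-cong (yes p) h = cong (1ℚ *_) (h p)
    ind-*-cong (no  _) {a} {b} h = trans (*-zeroˡ a) (sym (*-zeroˡ b))

    ind-*-zero : (d : Dec P) {a : ℚ} → ¬ P → ind d * a ≡ 0ℚ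
    ind-*-zero d {a} ¬p = trans (cong (_* a) (ind-no d ¬p)) (*-zeroˡ a)

    ind-*-one : (d : Dec P) {a : ℚ} → P → ind d * a ≡ a
    ind-*-one d {a} p = trans (cong (_* a) (ind-yes d p)) (*-identityˡ a)

  ind-mono : ∀ {P Q : Set} (d : Dec P) (e : Dec Q) → (P → Q) → ind d ≤ ind e
  ind-mono (yes p) e f = ≤-reflexive (sym (ind-yes e (f p)))
  ind-mono (no  _) e f = 0≤ind e

  ind-cong : ∀ {P Q : Set} (d : Dec P) (e : Dec Q) → (P → Q) → (Q → P) → ind d ≡ ind e
  ind-cong d e f g = ≤-antisym (ind-mono d e f) (ind-mono e d g)

  -- Finite sums

  ∑ : ∀ {A : Set} → List A → (A → ℚ) → ℚ
  ∑ []       f = 0ℚ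
  ∑ (x ∷ xs) f = f x + ∑ xs f

  syntax ∑ xs (λ x → e) = ∑[ x ∈ xs ] e

  module _ {A : Set} where

    ∑-mono : ∀ (xs : List A) {f g : A → ℚ} → (∀ {x} → x ∈ xs → f x ≤ g x) → ∑ xs f ≤ ∑ xs g
    ∑-mono []       h = ≤-refl
    ∑-mono (x ∷ xs) h = +-mono-≤ (h (here refl)) (∑-mono xs λ x∈ → h (there x∈))

    ∑-cong∈ : ∀ (xs : List A) {f g : A → ℚ} → (∀ {x} → x ∈ xs → f x ≡ g x) → ∑ xs f ≡ ∑ xs g
    ∑-cong∈ []       h = refl
    ∑-cong∈ (x ∷ xs) h = cong₂ _+_ (h (here refl)) (∑-cong∈ xs λ x∈ → h (there x∈))

    ∑-cong : ∀ (xs : List A) {f g : A → ℚ} → (∀ x → f x ≡ g x) → ∑ xs f ≡ ∑ xs g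
    ∑-cong xs h = ∑-cong∈ xs λ {x} _ → h x

    ∑-0 : ∀ (xs : List A) {f : A → ℚ} → (∀ {x} → x ∈ xs → f x ≡ 0ℚ) → ∑ xs f ≡ 0ℚ
    ∑-0 []       h = refl
    ∑-0 (x ∷ xs) h = trans (cong₂ _+_ (h (here refl)) (∑-0 xs λ x∈ → h (there x∈))) (+-identityˡ 0ℚ)

    0≤∑ : ∀ (xs : List A) {f : A → ℚ} → (∀ {x} → x ∈ xs → 0ℚ ≤ f x) → 0ℚ ≤ ∑ xs f
    0≤∑ []       h = ≤-refl
    0≤∑ (x ∷ xs) h = 0≤-+ (h (here refl)) (0≤∑ xs λ x∈ → h (there x∈))

    ∑-+ : ∀ (xs : List A) (f g : A → ℚ) → ∑ xs f + ∑ xs g ≡ ∑[ x ∈ xs ] (f x + g x)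
    ∑-+ []       f g = +-identityˡ 0ℚ
    ∑-+ (x ∷ xs) f g = trans
      (solve 4 (λ a b c d → (a :+ b) :+ (c :+ d) := (a :+ c) :+ (b :+ d)) refl (f x) (∑ xs f) (g x) (∑ xs g))
      (cong (f x + g x +_) (∑-+ xs f g))

    ∑-*ˡ : ∀ c (xs : List A) (f : A → ℚ) → c * ∑ xs f ≡ ∑[ x ∈ xs ] (c * f x)
    ∑-*ˡ c []       f = *-zeroʳ c
    ∑-*ˡ c (x ∷ xs) f = trans (*-distribˡ-+ c (f x) (∑ xs f)) (cong (c * f x +_) (∑-*ˡ c xs f))

    ∑-*ʳ : ∀ c (xs : List A) (f : A → ℚ) → ∑ xs f * c ≡ ∑[ x ∈ xs ] (f x * c)
    ∑-*ʳ c xs f = trans (*-comm (∑ xs f) c) (trans (∑-*ˡ c xs f) (∑-cong xs λ x → *-comm c (f x)))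

    ∑-++ : ∀ (xs ys : List A) (f : A → ℚ) → ∑ (xs ++ ys) f ≡ ∑ xs f + ∑ ys f
    ∑-++ []       ys f = sym (+-identityˡ (∑ ys f))
    ∑-++ (x ∷ xs) ys f = trans (cong (f x +_) (∑-++ xs ys f)) (sym (+-assoc (f x) (∑ xs f) (∑ ys f)))

    ∑-single : ∀ {xs : List A} (f : A → ℚ) {a} → Unique xs → a ∈ xs →
      (∀ {x} → x ∈ xs → x ≢ a → f x ≡ 0ℚ) → ∑ xs f ≡ f a
    ∑-single {x ∷ xs} f {a} (x∉ ∷ _) (here refl) h =
      trans (cong (f x +_) (∑-0 xs λ y∈ → h (there y∈) λ y≡x → All.lookup x∉ y∈ (sym y≡x))) (+-identityʳ (f x))
    ∑-single {x ∷ xs} f {a} (x∉ ∷ u) (there a∈) h =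
      trans (cong₂ _+_ (h (here refl) (All.lookup x∉ a∈)) (∑-single f u a∈ λ y∈ → h (there y∈))) (+-identityˡ (f a))

    ∑-atMostOne : ∀ {xs : List A} (f : A → ℚ) → Unique xs →
      (∀ {x} → x ∈ xs → f x ≡ 0ℚ ⊎ f x ≡ 1ℚ) →
      (∀ {x y} → x ∈ xs → y ∈ xs → f x ≡ 1ℚ → f y ≡ 1ℚ → x ≡ y) → ∑ xs f ≤ 1ℚ
    ∑-atMostOne {[]}     f []       h k = 0≤1
    ∑-atMostOne {x ∷ xs} f (x∉ ∷ u) h k with h (here refl)
    ... | inj₁ fx≡0 = subst (λ z → z + ∑ xs f ≤ 1ℚ) (sym fx≡0)
      (subst (_≤ 1ℚ) (sym (+-identityˡ (∑ xs f)))
        (∑-atMostOne f u (λ y∈ → h (there y∈)) (λ y∈ z∈ → k (there y∈) (there z∈))))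
    ... | inj₂ fx≡1 = ≤-reflexive (trans (cong₂ _+_ fx≡1 (∑-0 xs rest)) (+-identityʳ 1ℚ))
      where
      rest : ∀ {y} → y ∈ xs → f y ≡ 0ℚ
      rest y∈ with h (there y∈)
      ... | inj₁ fy≡0 = fy≡0
      ... | inj₂ fy≡1 = ⊥-elim (All.lookup x∉ y∈ (k (here refl) (there y∈) fx≡1 fy≡1))

  ∑-map : ∀ {A B : Set} (g : A → B) (xs : List A) (f : B → ℚ) → ∑ (map g xs) f ≡ ∑[ x ∈ xs ] f (g x)
  ∑-map g []       f = refl
  ∑-map g (x ∷ xs) f = cong (f (g x) +_) (∑-map g xs f)

  module _ {A B : Set} where

    ∑-swap : ∀ (xs : List A) (ys : List B) (f : A → B → ℚ) →
      ∑[ x ∈ xs ] ∑[ y ∈ ys ] f x y ≡ ∑[ y ∈ ys ] ∑[ x ∈ xs ] f x y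
    ∑-swap []       ys f = sym (∑-0 ys λ _ → refl)
    ∑-swap (x ∷ xs) ys f = trans (cong (∑ ys (f x) +_) (∑-swap xs ys f)) (∑-+ ys (f x) _)

    ∑-cartesian : ∀ (xs : List A) (ys : List B) (f : A × B → ℚ) →
      ∑ (cartesianProduct xs ys) f ≡ ∑[ x ∈ xs ] ∑[ y ∈ ys ] f (x , y)
    ∑-cartesian []       ys f = refl
    ∑-cartesian (x ∷ xs) ys f = trans (∑-++ (map (x ,_) ys) (cartesianProduct xs ys) f)
      (cong₂ _+_ (∑-map (x ,_) ys f) (∑-cartesian xs ys f))

    ∑-*-∑ : ∀ (xs : List A) (ys : List B) (f : A → ℚ) (g : B → ℚ) →
      ∑ xs f * ∑ ys g ≡ ∑[ x ∈ xs ] ∑[ y ∈ ys ] (f x * g y)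
    ∑-*-∑ xs ys f g = trans (∑-*ʳ (∑ ys g) xs f) (∑-cong xs λ x → ∑-*ˡ (f x) ys g)

  1⋯_ : ℕ → List ℕ
  1⋯ zero  = []
  1⋯ suc n = suc n ∷ 1⋯ n

  infix 9 1⋯_

  ∈-range⁺ : ∀ {m n} → 1 ℕ.≤ m → m ℕ.≤ n → m ∈ 1⋯ n
  ∈-range⁺ {n = zero}  (s≤s _) ()
  ∈-range⁺ {m} {suc n} 1≤m m≤n with m ℕ.≟ suc n
  ... | yes refl = here refl
  ... | no  m≢   = there (∈-range⁺ 1≤m (ℕP.≤-pred (ℕP.≤∧≢⇒< m≤n m≢)))

  ∈-range⁻ : ∀ {m n} → m ∈ 1⋯ n → 1 ℕ.≤ m × m ℕ.≤ n
  ∈-range⁻ {n = suc n} (here refl) = s≤s z≤n , ℕP.≤-refl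
  ∈-range⁻ {n = suc n} (there m∈) with ∈-range⁻ m∈
  ... | 1≤m , m≤n = 1≤m , ℕP.m≤n⇒m≤1+n m≤n

  range-unique : ∀ n → Unique (1⋯ n)
  range-unique zero    = []
  range-unique (suc n) =
    All.tabulate (λ m∈ → ℕP.>⇒≢ (s≤s (proj₂ (∈-range⁻ m∈)))) ∷ range-unique n

  ∑-pick : ∀ y {c} → 1 ℕ.≤ c → (f : ℕ → ℚ) →
    ∑[ n ∈ 1⋯ y ] (ind (c ℕ.≟ n) * f n) ≡ ind (c ℕ.≤? y) * f c
  ∑-pick y {c} 1≤c f with c ℕ.≤? y
  ... | yes c≤y = trans (∑-single (λ n → ind (c ℕ.≟ n) * f n) (range-unique y) (∈-range⁺ 1≤c c≤y)
                          λ {x} _ x≢c → ind-*-zero (c ℕ.≟ x) λ c≡x → x≢c (sym c≡x))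
                   (cong (_* f c) (ind-yes (c ℕ.≟ c) refl))
  ... | no  c≰y = trans (∑-0 (1⋯ y) λ {x} x∈ → ind-*-zero (c ℕ.≟ x) λ { refl → c≰y (proj₂ (∈-range⁻ x∈)) })
                   (sym (*-zeroˡ (f c)))

  ∑-range-extend : ∀ {x y} f → x ℕ.≤ y → (∀ n → 0ℚ ≤ f n) → ∑ (1⋯ x) f ≤ ∑ (1⋯ y) f
  ∑-range-extend {x} f x≤y 0≤f = subst (λ y → ∑ (1⋯ x) f ≤ ∑ (1⋯ y) f) (ℕP.m∸n+n≡m x≤y) (go (_ ℕ.∸ x))
    where
    go : ∀ k → ∑ (1⋯ x) f ≤ ∑ (1⋯ (k ℕ.+ x)) f
    go zero    = ≤-refl
    go (suc k) = ≤-trans (go k) (nonNeg⇒≤ (f (suc (k ℕ.+ x))) (0≤f _) (+-comm _ (f (suc (k ℕ.+ x)))))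

  ∑-range-cut : ∀ y k f → k ℕ.≤ y → ∑[ n ∈ 1⋯ y ] (ind (n ℕ.≤? k) * f n) ≡ ∑ (1⋯ k) f
  ∑-range-cut zero    zero f z≤n = refl
  ∑-range-cut (suc y) k f k≤y with k ℕ.≟ suc y
  ... | yes refl = ∑-cong∈ (1⋯ suc y) λ {n} n∈ → ind-*-one (n ℕ.≤? suc y) (proj₂ (∈-range⁻ n∈))
  ... | no k≢ = trans (cong₂ _+_ (ind-*-zero (suc y ℕ.≤? k) (ℕP.<⇒≱ k<)) (∑-range-cut y k f (ℕP.≤-pred k<)))
    (+-identityˡ (∑ (1⋯ k) f))
    where
    k< : k ℕ.< suc y
    k< = ℕP.≤∧≢⇒< k≤y k≢

  ∑-range-1 : ∀ k → ∑[ n ∈ 1⋯ k ] 1ℚ ≡ fromℕℚ k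
  ∑-range-1 zero    = refl
  ∑-range-1 (suc k) = trans (cong (1ℚ +_) (∑-range-1 k)) (sym (fromℕℚ-suc k))

  ∑-range-≤ : ∀ y k → k ℕ.≤ y → ∑[ n ∈ 1⋯ y ] ind (n ℕ.≤? k) ≡ fromℕℚ k
  ∑-range-≤ y k k≤y = trans (∑-cong (1⋯ y) λ n → sym (*-identityʳ (ind (n ℕ.≤? k))))
    (trans (∑-range-cut y k (λ _ → 1ℚ) k≤y) (∑-range-1 k))

  ∑-range-1+ : ∀ y f → ∑ (1⋯ suc y) f ≡ f 1 + ∑[ n ∈ 1⋯ y ] f (suc n)
  ∑-range-1+ zero    f = refl
  ∑-range-1+ (suc y) f = trans (cong (f (suc (suc y)) +_) (∑-range-1+ y f))
    (solve 3 (λ a b c → a :+ (b :+ c) := b :+ (a :+ c)) refl (f (suc (suc y))) (f 1) (∑ (1⋯ y) (λ n → f (suc n))))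

  -- Reciprocals, with the junk value rc 0 = 0

  rc : ℕ → ℚ
  rc zero    = 0ℚ
  rc (suc n) = unit n

  0≤rc : ∀ n → 0ℚ ≤ rc n
  0≤rc zero    = ≤-refl
  0≤rc (suc n) = <⇒≤ (0<unit n)

  rc-* : ∀ m n → rc (m ℕ.* n) ≡ rc m * rc n
  rc-* zero    n       = sym (*-zeroˡ (rc n))
  rc-* (suc m) zero    = trans (cong rc (ℕP.*-zeroʳ m)) (sym (*-zeroʳ (unit m)))
  rc-* (suc m) (suc n) = *-cancelʳ-≡ (fromℕℚ (suc m ℕ.* suc n)) (0<fromℕℚ-suc (n ℕ.+ m ℕ.* suc n))
    (trans (unit-* (n ℕ.+ m ℕ.* suc n)) (sym
      (trans (cong (unit m * unit n *_) (fromℕℚ-* (suc m) (suc n)))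
      (trans (solve 4 (λ u v a b → u :* v :* (a :* b) := (u :* a) :* (v :* b)) refl (unit m) (unit n) (fromℕℚ (suc m)) (fromℕℚ (suc n)))
      (trans (cong₂ _*_ (unit-* m) (unit-* n)) (*-identityˡ 1ℚ))))))

  ≤⇒≤*rc : ∀ {q t x} → 1 ℕ.≤ t → q ℕ.* t ℕ.≤ x → fromℕℚ q ≤ fromℕℚ x * rc t
  ≤⇒≤*rc {q} {suc t} {x} _ h = subst (_≤ fromℕℚ x * unit t)
    (trans (cong (_* unit t) (fromℕℚ-* q (suc t)))
    (trans (solve 3 (λ q t u → q :* t :* u := q :* (u :* t)) refl (fromℕℚ q) (fromℕℚ (suc t)) (unit t))
    (trans (cong (fromℕℚ q *_) (unit-* t)) (*-identityʳ (fromℕℚ q)))))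
    (*-monoʳ (unit t) (0≤rc (suc t)) (fromℕℚ-≤ h))

  -- The character modulo 4

  χ : ℕ → ℚ
  χ 0 = 0ℚ
  χ 1 = 1ℚ
  χ 2 = 0ℚ
  χ 3 = - 1ℚ
  χ (suc (suc (suc (suc n)))) = χ n

  χ-periodic : ∀ n k → χ (n ℕ.* 4 ℕ.+ k) ≡ χ k
  χ-periodic zero    k = refl
  χ-periodic (suc n) k = χ-periodic n k

  χ-double : ∀ n → χ (2 ℕ.* n) ≡ 0ℚ
  χ-double 0 = refl
  χ-double 1 = refl
  χ-double 2 = refl
  χ-double 3 = refl
  χ-double (suc (suc (suc (suc n)))) = trans (cong χ (ℕP.*-distribˡ-+ 2 4 n)) (χ-double n)

  χ-triple : ∀ n → χ (3 ℕ.* n) ≡ - χ n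
  χ-triple 0 = refl
  χ-triple 1 = refl
  χ-triple 2 = refl
  χ-triple 3 = refl
  χ-triple (suc (suc (suc (suc n)))) = trans (cong χ (ℕP.*-distribˡ-+ 3 4 n)) (χ-triple n)

  χ-* : ∀ m n → χ (m ℕ.* n) ≡ χ m * χ n
  χ-* 0 n = sym (*-zeroˡ (χ n))
  χ-* 1 n = trans (cong χ (ℕP.+-identityʳ n)) (sym (*-identityˡ (χ n)))
  χ-* 2 n = trans (χ-double n) (sym (*-zeroˡ (χ n)))
  χ-* 3 n = trans (χ-triple n) (solve 1 (λ a → :- a := :- con 1ℚ :* a) refl (χ n))
  χ-* (suc (suc (suc (suc m)))) n =
    trans (cong χ (trans (ℕP.*-distribʳ-+ n 4 m) (cong (ℕ._+ m ℕ.* n) (ℕP.*-comm 4 n))))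
    (trans (χ-periodic n (m ℕ.* n)) (χ-* m n))

  χ-values : ∀ n → χ n ≡ 1ℚ ⊎ χ n ≡ 0ℚ ⊎ χ n ≡ - 1ℚ
  χ-values 0 = inj₂ (inj₁ refl)
  χ-values 1 = inj₁ refl
  χ-values 2 = inj₂ (inj₁ refl)
  χ-values 3 = inj₂ (inj₂ refl)
  χ-values (suc (suc (suc (suc n)))) = χ-values n

  χ-sum : ℕ → ℚ
  χ-sum z = ∑[ d ∈ 1⋯ z ] (χ d * rc d)

  χ-step : ∀ r j → χ (r ℕ.+ j ℕ.* 4) ≡ χ r
  χ-step r j = trans (cong χ (ℕP.+-comm r (j ℕ.* 4))) (χ-periodic j r)

  χ-sum-1+ : ∀ j → χ-sum (1 ℕ.+ j ℕ.* 4) ≡ χ-sum (j ℕ.* 4) + unit (j ℕ.* 4)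
  χ-sum-1+ j = trans (cong (λ z → z * unit (j ℕ.* 4) + χ-sum (j ℕ.* 4)) (χ-step 1 j))
    (solve 2 (λ u v → con 1ℚ :* u :+ v := v :+ u) refl (unit (j ℕ.* 4)) (χ-sum (j ℕ.* 4)))

  χ-sum-2+ : ∀ j → χ-sum (2 ℕ.+ j ℕ.* 4) ≡ χ-sum (1 ℕ.+ j ℕ.* 4)
  χ-sum-2+ j = trans (cong (λ z → z * unit (1 ℕ.+ j ℕ.* 4) + χ-sum (1 ℕ.+ j ℕ.* 4)) (χ-step 2 j))
    (solve 2 (λ u v → con 0ℚ :* u :+ v := v) refl (unit (1 ℕ.+ j ℕ.* 4)) (χ-sum (1 ℕ.+ j ℕ.* 4)))

  χ-sum-3+ : ∀ j → χ-sum (3 ℕ.+ j ℕ.* 4) ≡ χ-sum (2 ℕ.+ j ℕ.* 4) - unit (2 ℕ.+ j ℕ.* 4)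
  χ-sum-3+ j = trans (cong (λ z → z * unit (2 ℕ.+ j ℕ.* 4) + χ-sum (2 ℕ.+ j ℕ.* 4)) (χ-step 3 j))
    (solve 2 (λ u v → :- con 1ℚ :* u :+ v := v :- u) refl (unit (2 ℕ.+ j ℕ.* 4)) (χ-sum (2 ℕ.+ j ℕ.* 4)))

  χ-sum-4+ : ∀ j → χ-sum (4 ℕ.+ j ℕ.* 4) ≡ χ-sum (3 ℕ.+ j ℕ.* 4)
  χ-sum-4+ j = trans (cong (λ z → z * unit (3 ℕ.+ j ℕ.* 4) + χ-sum (3 ℕ.+ j ℕ.* 4)) (χ-step 4 j))
    (solve 2 (λ u v → con 0ℚ :* u :+ v := v) refl (unit (3 ℕ.+ j ℕ.* 4)) (χ-sum (3 ℕ.+ j ℕ.* 4)))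

  χ-sum-3+unit : ∀ j → χ-sum (3 ℕ.+ j ℕ.* 4) + unit (2 ℕ.+ j ℕ.* 4) ≡ χ-sum (1 ℕ.+ j ℕ.* 4)
  χ-sum-3+unit j = trans (cong (_+ unit (2 ℕ.+ j ℕ.* 4)) (trans (χ-sum-3+ j) (cong (_- unit (2 ℕ.+ j ℕ.* 4)) (χ-sum-2+ j))))
    (solve 2 (λ a u → a :- u :+ u := a) refl (χ-sum (1 ℕ.+ j ℕ.* 4)) (unit (2 ℕ.+ j ℕ.* 4)))

  -- From `1 + 4j` to `5 + 4j` the sum changes by `- 1/(4j+3) + 1/(4j+5)`, which is negative, and it
  -- starts at 1.
  χ-sum-1+≤1 : ∀ j → χ-sum (1 ℕ.+ j ℕ.* 4) ≤ 1ℚ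
  χ-sum-1+≤1 zero    = ≤-refl
  χ-sum-1+≤1 (suc j) = ≤-trans (≤-reflexive (trans (χ-sum-1+ (suc j)) (cong (_+ unit (suc j ℕ.* 4)) (χ-sum-4+ j))))
    (≤-trans (+-monoʳ-≤ (χ-sum (3 ℕ.+ j ℕ.* 4)) (unit-anti (ℕP.+-monoˡ-≤ (j ℕ.* 4) {2} {4} (s≤s (s≤s z≤n)))))
    (≤-trans (≤-reflexive (χ-sum-3+unit j)) (χ-sum-1+≤1 j)))

  χ-sum-3+≤1 : ∀ j → χ-sum (3 ℕ.+ j ℕ.* 4) ≤ 1ℚ
  χ-sum-3+≤1 j = ≤-trans (nonNeg⇒≤ (unit (2 ℕ.+ j ℕ.* 4)) (<⇒≤ (0<unit (2 ℕ.+ j ℕ.* 4))) (χ-sum-3+unit j)) (χ-sum-1+≤1 j)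

  χ-sum≤1 : ∀ z → χ-sum z ≤ 1ℚ
  χ-sum≤1 z = subst (λ z → χ-sum z ≤ 1ℚ) (sym (m≡m%n+[m/n]*n z 4)) (go (z ℕ.% 4) (z ℕ./ 4) (m%n<n z 4))
    where
    go : ∀ r j → r ℕ.< 4 → χ-sum (r ℕ.+ j ℕ.* 4) ≤ 1ℚ
    go 0 zero    _ = 0≤1
    go 0 (suc j) _ = ≤-trans (≤-reflexive (χ-sum-4+ j)) (χ-sum-3+≤1 j)
    go 1 j       _ = χ-sum-1+≤1 j
    go 2 j       _ = ≤-trans (≤-reflexive (χ-sum-2+ j)) (χ-sum-1+≤1 j)
    go 3 j       _ = χ-sum-3+≤1 j
    go (suc (suc (suc (suc _)))) j (s≤s (s≤s (s≤s (s≤s ()))))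

  -- Divisibility

  ≤/⇔ : ∀ {m n d} .{{_ : ℕ.NonZero d}} → (m ℕ.≤ n ℕ./ d → m ℕ.* d ℕ.≤ n) × (m ℕ.* d ℕ.≤ n → m ℕ.≤ n ℕ./ d)
  ≤/⇔ {m} {n} {d} = (λ h → ℕP.≤-trans (ℕP.*-monoˡ-≤ d h) (m/n*n≤m n d)) ,
    λ h → subst (ℕ._≤ n ℕ./ d) (m*n/n≡m m d) (/-monoˡ-≤ d h)

  1≤⇒nonZero : ∀ {n} → 1 ℕ.≤ n → ℕ.NonZero n
  1≤⇒nonZero = ℕ.>-nonZero

  ∣⇒1≤ : ∀ {d n} → 1 ℕ.≤ n → d ∣ n → 1 ℕ.≤ d
  ∣⇒1≤ {zero}  1≤n d∣n = ⊥-elim (ℕP.<⇒≢ 1≤n (sym (0∣⇒≡0 d∣n)))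
  ∣⇒1≤ {suc d} 1≤n d∣n = s≤s z≤n

  ∣⇒≤′ : ∀ {d n} → 1 ℕ.≤ n → d ∣ n → d ℕ.≤ n
  ∣⇒≤′ 1≤n = ∣⇒≤ {{1≤⇒nonZero 1≤n}}

  -- A cofactor is unique if it exists, and at most `n`. Together with `∑-pick` this lets sums over
  -- divisors be exchanged with other sums.
  ∑-cofactor : ∀ {a n y} → 1 ℕ.≤ n → n ℕ.≤ y → ∑[ b ∈ 1⋯ y ] ind (a ℕ.* b ℕ.≟ n) ≡ ind (a ∣? n)
  ∑-cofactor {a} {n} {y} 1≤n n≤y with a ∣? n
  ... | yes (divides q n≡q*a) = trans
      (∑-single (λ b → ind (a ℕ.* b ℕ.≟ n)) (range-unique y)
        (∈-range⁺ 1≤q (ℕP.≤-trans (∣⇒≤′ 1≤n (divides a (trans n≡q*a (ℕP.*-comm q a)))) n≤y))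
        λ {b} _ b≢q → ind-no (a ℕ.* b ℕ.≟ n) λ ab≡n → b≢q (ℕP.*-cancelˡ-≡ b q a {{1≤⇒nonZero 1≤a}}
          (trans ab≡n (trans n≡q*a (ℕP.*-comm q a)))))
      (ind-yes (a ℕ.* q ℕ.≟ n) (trans (ℕP.*-comm a q) (sym n≡q*a)))
    where
    1≤a = ∣⇒1≤ 1≤n (divides q n≡q*a)
    1≤q = ∣⇒1≤ 1≤n (divides a (trans n≡q*a (ℕP.*-comm q a)))
  ... | no a∤n = ∑-0 (1⋯ y) λ {b} _ → ind-no (a ℕ.* b ℕ.≟ n) λ ab≡n →
    a∤n (divides b (trans (sym ab≡n) (ℕP.*-comm a b)))

  prime⇒2≤ : ∀ {p} → Prime p → 2 ℕ.≤ p
  prime⇒2≤ {p} pr = ℕ.nonTrivial⇒n>1 p {{prime⇒nonTrivial pr}}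

  prime∤⇒coprime : ∀ {p d} → Prime p → ¬ p ∣ d → Coprime d p
  prime∤⇒coprime pr p∤d (i∣d , i∣p) with prime⇒irreducible pr i∣p
  ... | inj₁ i≡1  = i≡1
  ... | inj₂ refl = ⊥-elim (p∤d i∣d)

  coprime-∣^* : ∀ {d p} k {m} → Coprime d p → d ∣ p ℕ.^ k ℕ.* m → d ∣ m
  coprime-∣^* zero {m} c h = subst (_ ∣_) (ℕP.*-identityˡ m) h
  coprime-∣^* {d} {p} (suc k) {m} c h =
    coprime-∣^* k c (coprime-divisor c (subst (d ∣_) (ℕP.*-assoc p (p ℕ.^ k) m) h))

  primeDivisor : ∀ n → 2 ℕ.≤ n → ∃[ p ] Prime p × p ∣ n
  primeDivisor n@(suc _) 2≤n with factorise n
  ... | record { factors = [] ; isFactorisation = e } = ⊥-elim (ℕP.<⇒≢ 2≤n (sym e))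
  ... | record { factors = p ∷ ps ; isFactorisation = e ; factorsPrime = pr ∷ _ } =
    p , pr , subst (p ∣_) (sym e) (m∣m*n _)

  splitPower : ∀ {p} → 2 ℕ.≤ p → ∀ n → 1 ℕ.≤ n → ∃₂ λ k m → n ≡ p ℕ.^ k ℕ.* m × ¬ p ∣ m
  splitPower {p} 2≤p = <-rec _ go
    where
    go : ∀ n → (∀ {m} → m ℕ.< n → 1 ℕ.≤ m → ∃₂ λ k m₀ → m ≡ p ℕ.^ k ℕ.* m₀ × ¬ p ∣ m₀) →
      1 ℕ.≤ n → ∃₂ λ k m → n ≡ p ℕ.^ k ℕ.* m × ¬ p ∣ m
    go n rec 1≤n with p ∣? n
    ... | no p∤n = 0 , n , sym (ℕP.*-identityˡ n) , p∤n
    ... | yes p∣n@(divides q n≡q*p) with rec q<n 1≤q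
      where
      1≤q : 1 ℕ.≤ q
      1≤q = ∣⇒1≤ 1≤n (divides p (trans n≡q*p (ℕP.*-comm q p)))
      q<n : q ℕ.< n
      q<n = subst₂ ℕ._<_ (ℕP.*-identityʳ q) (sym n≡q*p)
        (ℕP.*-monoʳ-< q {{1≤⇒nonZero 1≤q}} 2≤p)
    ... | k , m , q≡ , p∤m = suc k , m , trans n≡q*p (trans (cong (ℕ._* p) q≡)
        (trans (ℕP.*-comm _ p) (sym (ℕP.*-assoc p (p ℕ.^ k) m)))) , p∤m

  -- The convolution 1 * χ

  -- The function r. Divisors run up to a common bound `y`, not up to `n`, so that the sums over `d`
  -- and `n` can be exchanged; for `1 ≤ n ≤ y` every divisor is covered.
  χ∗1 : ℕ → ℕ → ℚ
  χ∗1 y n = ∑[ d ∈ 1⋯ y ] (χ d * ind (d ∣? n))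

  module _ {p : ℕ} (pr : Prime p) where

    private
      instance
        p≢0 : ℕ.NonZero p
        p≢0 = prime⇒nonZero pr

      1≤p : 1 ℕ.≤ p
      1≤p = ℕ.>-nonZero⁻¹ p

    -- A divisor of p^(k+1) m is either prime to p, hence a divisor of m, or p times a divisor of p^k m.
    ind-∣-p^* : ∀ k {m y d} → ¬ p ∣ m → 1 ℕ.≤ d → d ℕ.≤ y →
      ind (d ∣? p ℕ.* (p ℕ.^ k ℕ.* m)) ≡
      ind (d ∣? m) + ∑[ c ∈ 1⋯ y ] (ind (p ℕ.* c ℕ.≟ d) * ind (c ∣? p ℕ.^ k ℕ.* m))
    ind-∣-p^* k {m} {y} {d} p∤m 1≤d d≤y with p ∣? d
    ... | yes (divides q d≡q*p) = sym (trans
        (cong₂ _+_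
          (ind-no (d ∣? m) λ d∣m → p∤m (∣-trans (divides q d≡q*p) d∣m))
          (∑-single _ (range-unique y) (∈-range⁺ 1≤q (ℕP.≤-trans (∣⇒≤′ 1≤d (divides p d≡pq)) d≤y))
            λ {c} _ c≢q → ind-*-zero (p ℕ.* c ℕ.≟ d) λ pc≡d →
              c≢q (ℕP.*-cancelˡ-≡ c q p (trans pc≡d d≡pq))))
        (trans (+-identityˡ _) (trans (ind-*-one (p ℕ.* q ℕ.≟ d) (sym d≡pq))
          (ind-cong (q ∣? M) (d ∣? p ℕ.* M)
            (λ q∣M → subst (_∣ p ℕ.* M) (sym d≡pq) (*-monoʳ-∣ p q∣M))
            (λ d∣pM → *-cancelˡ-∣ p (subst (_∣ p ℕ.* M) d≡pq d∣pM))))))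
      where
      M = p ℕ.^ k ℕ.* m
      d≡pq : d ≡ p ℕ.* q
      d≡pq = trans d≡q*p (ℕP.*-comm q p)
      1≤q : 1 ℕ.≤ q
      1≤q = ∣⇒1≤ 1≤d (divides p d≡pq)
    ... | no p∤d = sym (trans
        (cong (ind (d ∣? m) +_) (∑-0 (1⋯ y) λ {c} _ → ind-*-zero (p ℕ.* c ℕ.≟ d) λ pc≡d →
          p∤d (subst (p ∣_) pc≡d (m∣m*n c))))
        (trans (+-identityʳ _) (ind-cong (d ∣? m) (d ∣? p ℕ.* M)
          (λ d∣m → ∣n⇒∣m*n p (∣n⇒∣m*n (p ℕ.^ k) d∣m))
          (λ d∣pM → coprime-∣^* k d⊥p (coprime-divisor d⊥p d∣pM)))))
      where
      M = p ℕ.^ k ℕ.* m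
      d⊥p = prime∤⇒coprime pr p∤d

    -- The divisors of `m` contribute `χ∗1 y m`. The others are `p c` with `c` dividing `p^k m`, and
    -- `χ (p c)` is `χ p` times `χ c`.
    χ∗1-step : ∀ k {m y} → ¬ p ∣ m → 1 ℕ.≤ m → p ℕ.* (p ℕ.^ k ℕ.* m) ℕ.≤ y →
      χ∗1 y (p ℕ.* (p ℕ.^ k ℕ.* m)) ≡ χ∗1 y m + χ p * χ∗1 y (p ℕ.^ k ℕ.* m)
    χ∗1-step k {m} {y} p∤m 1≤m pM≤y = trans
      (∑-cong∈ (1⋯ y) λ {d} d∈ → trans
        (cong (χ d *_) (ind-∣-p^* k p∤m (proj₁ (∈-range⁻ d∈)) (proj₂ (∈-range⁻ d∈))))
        (*-distribˡ-+ (χ d) _ _))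
      (trans (sym (∑-+ (1⋯ y) _ _)) (cong (χ∗1 y m +_)
      (trans (∑-cong (1⋯ y) λ d → trans (∑-*ˡ (χ d) (1⋯ y) _) (∑-cong (1⋯ y) λ c →
          solve 3 (λ a b c → a :* (b :* c) := c :* (b :* a)) refl (χ d) (ind (p ℕ.* c ℕ.≟ d)) (ind (c ∣? M))))
      (trans (∑-swap (1⋯ y) (1⋯ y) _)
      (trans (∑-cong∈ (1⋯ y) λ {c} c∈ → inner (proj₁ (∈-range⁻ c∈)))
      (sym (∑-*ˡ (χ p) (1⋯ y) _)))))))
      where
      M = p ℕ.^ k ℕ.* m
      1≤M : 1 ℕ.≤ M
      1≤M = ℕP.*-mono-≤ (ℕP.m^n>0 p k) 1≤m
      inner : ∀ {c} → 1 ℕ.≤ c →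
        ∑[ d ∈ 1⋯ y ] (ind (c ∣? M) * (ind (p ℕ.* c ℕ.≟ d) * χ d)) ≡ χ p * (χ c * ind (c ∣? M))
      inner {c} 1≤c = trans (sym (∑-*ˡ (ind (c ∣? M)) (1⋯ y) _))
        (trans (cong (ind (c ∣? M) *_) (∑-pick y (ℕP.*-mono-≤ 1≤p 1≤c) χ))
        (trans (ind-*-cong (c ∣? M) λ c∣M → trans (ind-*-one (p ℕ.* c ℕ.≤? y)
            (ℕP.≤-trans (ℕP.*-monoʳ-≤ p (∣⇒≤′ 1≤M c∣M)) pM≤y)) (χ-* p c))
        (solve 3 (λ a b c → a :* (b :* c) := b :* (c :* a)) refl (ind (c ∣? M)) (χ p) (χ c))))

    -- The factor `c` is `1 + χ p + ... + (χ p)^k`. The second inequality is nonnegativity of the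
    -- next such factor: for `χ p = - 1` the factors alternate between 1 and 0, so the induction has
    -- to carry two consecutive ones.
    χ∗1-power : ∀ k {m y} → ¬ p ∣ m → 1 ℕ.≤ m → p ℕ.^ k ℕ.* m ℕ.≤ y →
      ∃[ c ] 0ℚ ≤ c × 0ℚ ≤ 1ℚ + χ p * c × χ∗1 y (p ℕ.^ k ℕ.* m) ≡ c * χ∗1 y m
    χ∗1-power zero {m} {y} p∤m 1≤m h = 1ℚ , 0≤1 , 0≤1+χp (χ-values p) ,
      trans (cong (χ∗1 y) (ℕP.*-identityˡ m)) (sym (*-identityˡ (χ∗1 y m)))
      where
      0≤1+χp : χ p ≡ 1ℚ ⊎ χ p ≡ 0ℚ ⊎ χ p ≡ - 1ℚ → 0ℚ ≤ 1ℚ + χ p * 1ℚ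
      0≤1+χp (inj₁ e)        rewrite e = 0≤-+ 0≤1 0≤1
      0≤1+χp (inj₂ (inj₁ e)) rewrite e = 0≤1
      0≤1+χp (inj₂ (inj₂ e)) rewrite e = ≤-refl
    χ∗1-power (suc k) {m} {y} p∤m 1≤m h
      with χ∗1-power k {m} {y} p∤m 1≤m (ℕP.≤-trans (ℕP.m≤n*m (p ℕ.^ k ℕ.* m) p) h′)
      where
      h′ : p ℕ.* (p ℕ.^ k ℕ.* m) ℕ.≤ y
      h′ = subst (ℕ._≤ y) (ℕP.*-assoc p (p ℕ.^ k) m) h
    ... | c , 0≤c , 0≤c′ , eq = 1ℚ + χ p * c , 0≤c′ , next (χ-values p) ,
      trans (cong (χ∗1 y) (ℕP.*-assoc p (p ℕ.^ k) m))
      (trans (χ∗1-step k p∤m 1≤m (subst (ℕ._≤ y) (ℕP.*-assoc p (p ℕ.^ k) m) h))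
      (trans (cong (λ z → χ∗1 y m + χ p * z) eq)
        (solve 3 (λ r a c → r :+ a :* (c :* r) := (con 1ℚ :+ a :* c) :* r) refl (χ∗1 y m) (χ p) c)))
      where
      next : χ p ≡ 1ℚ ⊎ χ p ≡ 0ℚ ⊎ χ p ≡ - 1ℚ → 0ℚ ≤ 1ℚ + χ p * (1ℚ + χ p * c)
      next (inj₁ e) = subst (λ z → 0ℚ ≤ 1ℚ + z * (1ℚ + z * c)) (sym e)
        (subst (0ℚ ≤_) (solve 1 (λ c → con 1ℚ :+ con 1ℚ :+ c := con 1ℚ :+ con 1ℚ :* (con 1ℚ :+ con 1ℚ :* c)) refl c)
          (0≤-+ (0≤-+ 0≤1 0≤1) 0≤c))
      next (inj₂ (inj₁ e)) = subst (λ z → 0ℚ ≤ 1ℚ + z * (1ℚ + z * c)) (sym e)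
        (subst (0ℚ ≤_) (solve 1 (λ c → con 1ℚ := con 1ℚ :+ con 0ℚ :* (con 1ℚ :+ con 0ℚ :* c)) refl c) 0≤1)
      next (inj₂ (inj₂ e)) = subst (λ z → 0ℚ ≤ 1ℚ + z * (1ℚ + z * c)) (sym e)
        (subst (0ℚ ≤_) (solve 1 (λ c → c := con 1ℚ :+ :- con 1ℚ :* (con 1ℚ :+ :- con 1ℚ :* c)) refl c) 0≤c)

  0≤χ∗1 : ∀ y n → 1 ℕ.≤ n → n ℕ.≤ y → 0ℚ ≤ χ∗1 y n
  0≤χ∗1 y = <-rec _ go
    where
    go : ∀ n → (∀ {m} → m ℕ.< n → 1 ℕ.≤ m → m ℕ.≤ y → 0ℚ ≤ χ∗1 y m) → 1 ℕ.≤ n → n ℕ.≤ y → 0ℚ ≤ χ∗1 y n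
    go n rec 1≤n n≤y with 2 ℕ.≤? n
    ... | no 2≰n = 0≤∑ (1⋯ y) λ {d} _ → subst (0ℚ ≤_) (*-comm (ind (d ∣? n)) (χ d))
      (≤-trans (≤-reflexive (sym (*-zeroʳ (ind (d ∣? n))))) (ind-*-mono (d ∣? n) λ d∣n →
        ≤-trans 0≤1 (≤-reflexive (cong χ (sym (∣1⇒≡1 (subst (d ∣_) (ℕP.≤-antisym (ℕP.≤-pred (ℕP.≰⇒> 2≰n)) 1≤n) d∣n)))))))
    ... | yes 2≤n with primeDivisor n 2≤n
    ... | p , pr , p∣n with splitPower (prime⇒2≤ pr) n 1≤n
    ... | k , m , n≡ , p∤m with χ∗1-power pr k {m} {y} p∤m 1≤m (subst (ℕ._≤ y) n≡ n≤y)
      where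
      1≤m : 1 ℕ.≤ m
      1≤m = ∣⇒1≤ 1≤n (subst (m ∣_) (sym n≡) (n∣m*n (p ℕ.^ k)))
    ... | c , 0≤c , _ , eq = subst (0ℚ ≤_) (sym (trans (cong (χ∗1 y) n≡) eq))
      (0≤-* 0≤c (rec m<n (∣⇒1≤ 1≤n m∣n) (ℕP.≤-trans (ℕP.<⇒≤ m<n) n≤y)))
      where
      m∣n : m ∣ n
      m∣n = subst (m ∣_) (sym n≡) (n∣m*n (p ℕ.^ k))
      m<n : m ℕ.< n
      m<n = ℕP.≤∧≢⇒< (∣⇒≤′ 1≤n m∣n) λ { refl → p∤m p∣n }

  -- The pairs `(a, b)` are grouped by their product `n`; for fixed `n` and `a` the sum over `b` is
  -- the indicator of `a ∣ n`.
  ∑-χ∗1 : ∀ y (f : ℕ → ℚ) →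
    ∑[ a ∈ 1⋯ y ] ∑[ b ∈ 1⋯ y ] (ind (a ℕ.* b ℕ.≤? y) * f (a ℕ.* b) * χ a) ≡ ∑[ n ∈ 1⋯ y ] (f n * χ∗1 y n)
  ∑-χ∗1 y f = trans
    (∑-cong∈ (1⋯ y) λ {a} a∈ → trans
      (∑-cong∈ (1⋯ y) λ {b} b∈ → trans
        (cong (_* χ a) (sym (∑-pick y (ℕP.*-mono-≤ (proj₁ (∈-range⁻ a∈)) (proj₁ (∈-range⁻ b∈))) f)))
        (∑-*ʳ (χ a) (1⋯ y) _))
      (∑-swap (1⋯ y) (1⋯ y) _))
    (trans (∑-swap (1⋯ y) (1⋯ y) _)
    (∑-cong∈ (1⋯ y) λ {n} n∈ → trans
      (∑-cong (1⋯ y) λ a → trans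
        (∑-cong (1⋯ y) λ b → solve 3 (λ i f c → i :* f :* c := f :* c :* i) refl (ind (a ℕ.* b ℕ.≟ n)) (f n) (χ a))
        (trans (sym (∑-*ˡ (f n * χ a) (1⋯ y) _))
        (trans (cong (f n * χ a *_) (∑-cofactor {a} (proj₁ (∈-range⁻ n∈)) (proj₂ (∈-range⁻ n∈))))
          (*-assoc (f n) (χ a) (ind (a ∣? n))))))
      (sym (∑-*ˡ (f n) (1⋯ y) _))))

  -- For fixed `b` the sum over `a ≤ y / b` is `rc b` times a partial sum of Σ χ(a)/a, hence at most
  -- `rc b`. Summing over `a` first is what exploits the signs.
  ∑-rc-χ∗1≤ : ∀ y → ∑[ n ∈ 1⋯ y ] (rc n * χ∗1 y n) ≤ ∑ (1⋯ y) rc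
  ∑-rc-χ∗1≤ y = ≤-trans (≤-reflexive (trans (sym (∑-χ∗1 y rc)) (∑-swap (1⋯ y) (1⋯ y) _)))
    (∑-mono (1⋯ y) λ {b} b∈ → inner b (proj₁ (∈-range⁻ b∈)))
    where
    inner : ∀ b → 1 ℕ.≤ b → ∑[ a ∈ 1⋯ y ] (ind (a ℕ.* b ℕ.≤? y) * rc (a ℕ.* b) * χ a) ≤ rc b
    inner b@(suc _) _ = ≤-trans (≤-reflexive (trans
        (∑-cong (1⋯ y) λ a → trans
          (cong₂ (λ i r → i * r * χ a) (ind-cong (a ℕ.* b ℕ.≤? y) (a ℕ.≤? y ℕ./ b) (proj₂ (≤/⇔ {a} {y} {b})) (proj₁ (≤/⇔ {a} {y} {b}))) (rc-* a b))
          (solve 4 (λ i r s c → i :* (r :* s) :* c := s :* (i :* (c :* r))) refl (ind (a ℕ.≤? y ℕ./ b)) (rc a) (rc b) (χ a)))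
        (trans (sym (∑-*ˡ (rc b) (1⋯ y) _))
          (cong (rc b *_) (∑-range-cut y (y ℕ./ b) (λ a → χ a * rc a) (m/n≤m y b))))))
      (≤-trans (*-monoˡ (rc b) (0≤rc b) (χ-sum≤1 (y ℕ./ b))) (≤-reflexive (*-identityʳ (rc b))))

  -- Numbers all of whose divisors are 1 modulo 4

  Good : ℕ → Set
  Good n = All (λ d → d ∣ n → χ d ≡ 1ℚ) (1⋯ n)

  good? : ∀ n → Dec (Good n)
  good? n = All.all? (λ d → (d ∣? n) →-dec (χ d ≟ 1ℚ)) (1⋯ n)

  good⁻ : ∀ {n d} → 1 ℕ.≤ n → Good n → d ∣ n → χ d ≡ 1ℚ
  good⁻ 1≤n g d∣n = All.lookup g (∈-range⁺ (∣⇒1≤ 1≤n d∣n) (∣⇒≤′ 1≤n d∣n)) d∣n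

  good⁺ : ∀ {n} → (∀ {d} → d ∣ n → χ d ≡ 1ℚ) → Good n
  good⁺ h = All.tabulate λ _ → h

  good-∣ : ∀ {m n} → 1 ℕ.≤ n → m ∣ n → Good n → Good m
  good-∣ 1≤n m∣n g = good⁺ λ d∣m → good⁻ 1≤n g (∣-trans d∣m m∣n)

  -- With `g` the gcd of `d` and `m`, write `d` as `d / g` times `g`: here `g` divides `m`, and
  -- `d / g`, being prime to `m / g`, divides `n`. Multiplicativity of `χ` does the rest.
  good-* : ∀ {m n} → 1 ℕ.≤ m → 1 ℕ.≤ n → Good m → Good n → Good (m ℕ.* n)
  good-* {m} {n} 1≤m 1≤n gm gn = good⁺ λ {d} d∣mn → go d d∣mn
    where
    go : ∀ d → d ∣ m ℕ.* n → χ d ≡ 1ℚ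
    go d d∣mn = trans (cong χ d≡) (trans (χ-* d′ g) (trans
        (cong₂ _*_ (good⁻ 1≤n gn (coprime-divisor d′⊥m′ d′∣m′n)) (good⁻ 1≤m gm (gcd[m,n]∣n d m))) (*-identityˡ 1ℚ)))
      where
      g = gcd d m
      instance
        g≢0 : ℕ.NonZero g
        g≢0 = 1≤⇒nonZero (∣⇒1≤ 1≤m (gcd[m,n]∣n d m))
      d′ = d ℕ./ g
      m′ = m ℕ./ g
      d≡ : d ≡ d′ ℕ.* g
      d≡ = sym (m/n*n≡m (gcd[m,n]∣m d m))
      d′⊥m′ : Coprime d′ m′
      d′⊥m′ = coprime-/gcd d m
      d′∣m′n : d′ ∣ m′ ℕ.* n
      d′∣m′n = *-cancelˡ-∣ g (subst₂ _∣_ (trans d≡ (ℕP.*-comm d′ g))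
        (trans (cong (ℕ._* n) (trans (sym (m/n*n≡m (gcd[m,n]∣n d m))) (ℕP.*-comm m′ g))) (ℕP.*-assoc g m′ n)) d∣mn)

  α : ℕ → ℚ
  α n = ind (good? n)

  0≤α : ∀ n → 0ℚ ≤ α n
  0≤α n = 0≤ind (good? n)

  goodSum : ℕ → ℚ
  goodSum x = ∑[ m ∈ 1⋯ x ] (α m * rc m)

  0≤goodSum : ∀ x → 0ℚ ≤ goodSum x
  0≤goodSum x = 0≤∑ (1⋯ x) λ {m} _ → 0≤-* (0≤α m) (0≤rc m)

  α-*-≤ : ∀ {a b} → 1 ℕ.≤ a → 1 ℕ.≤ b → α a * α b ≤ α (a ℕ.* b)
  α-*-≤ {a} {b} 1≤a 1≤b with good? a | good? b
  ... | yes ga | yes gb = ≤-reflexive (trans (*-identityˡ 1ℚ) (sym (ind-yes (good? (a ℕ.* b)) (good-* 1≤a 1≤b ga gb))))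
  ... | yes _  | no _   = ≤-trans (≤-reflexive (*-zeroʳ 1ℚ)) (0≤α (a ℕ.* b))
  ... | no _   | yes _  = ≤-trans (≤-reflexive (*-zeroˡ 1ℚ)) (0≤α (a ℕ.* b))
  ... | no _   | no _   = ≤-trans (≤-reflexive (*-zeroˡ 0ℚ)) (0≤α (a ℕ.* b))

  -- On good n the convolution χ ∗ 1 counts all divisors, and elsewhere it is nonnegative.
  n≤n*n : ∀ n → n ℕ.≤ n ℕ.* n
  n≤n*n zero    = z≤n
  n≤n*n (suc n) = ℕP.m≤m*n (suc n) (suc n)

  goodSum² : ∀ x → goodSum x * goodSum x ≤ ∑ (1⋯ (x ℕ.* x)) rc
  goodSum² x = ≤-trans (≤-reflexive (∑-*-∑ (1⋯ x) (1⋯ x) _ _)) (≤-trans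
    (∑-mono (1⋯ x) λ {a} a∈ → ∑-mono (1⋯ x) λ {b} b∈ → pointwise (∈-range⁻ a∈) (∈-range⁻ b∈)) (≤-trans
    -- Both ranges grow from `x` to `y = x²`, so that `a b ≤ y` is the only constraint left, as the
    -- grouping by products requires.
    (∑-mono (1⋯ x) λ {a} _ → ∑-range-extend (F a) x≤y (0≤F a)) (≤-trans
    (∑-range-extend (λ a → ∑ (1⋯ y) (F a)) x≤y (λ a → 0≤∑ (1⋯ y) λ {b} _ → 0≤F a b)) (≤-trans
    (≤-reflexive (trans (∑-cong∈ (1⋯ y) λ {a} a∈ → ∑-cong∈ (1⋯ y) λ {b} b∈ →
        F≡ (proj₁ (∈-range⁻ a∈)) (proj₁ (∈-range⁻ b∈)))
      (∑-χ∗1 y (λ n → α n * rc n)))) (≤-trans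
    -- The condition that `n` is good is dropped here; this uses `0 ≤ χ∗1 y n` at the bad `n` too.
    (∑-mono (1⋯ y) λ {n} n∈ → *-monoʳ (χ∗1 y n) (0≤χ∗1 y n (proj₁ (∈-range⁻ n∈)) (proj₂ (∈-range⁻ n∈)))
      (≤-trans (*-monoʳ (rc n) (0≤rc n) (ind≤1 (good? n))) (≤-reflexive (*-identityˡ (rc n)))))
    (∑-rc-χ∗1≤ y))))))
    where
    y = x ℕ.* x
    x≤y : x ℕ.≤ y
    x≤y = n≤n*n x
    F : ℕ → ℕ → ℚ
    F a b = ind (a ℕ.* b ℕ.≤? y) * (α (a ℕ.* b) * rc (a ℕ.* b))
    0≤F : ∀ a b → 0ℚ ≤ F a b
    0≤F a b = 0≤-* (0≤ind (a ℕ.* b ℕ.≤? y)) (0≤-* (0≤α (a ℕ.* b)) (0≤rc (a ℕ.* b)))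
    pointwise : ∀ {a b} → 1 ℕ.≤ a × a ℕ.≤ x → 1 ℕ.≤ b × b ℕ.≤ x → α a * rc a * (α b * rc b) ≤ F a b
    pointwise {a} {b} (1≤a , a≤x) (1≤b , b≤x) = ≤-trans
      (≤-reflexive (trans
        (solve 4 (λ a r b s → a :* r :* (b :* s) := a :* b :* (r :* s)) refl (α a) (rc a) (α b) (rc b))
        (cong (α a * α b *_) (sym (rc-* a b)))))
      (≤-trans (*-monoʳ (rc (a ℕ.* b)) (0≤rc (a ℕ.* b)) (α-*-≤ 1≤a 1≤b))
        (≤-reflexive (sym (ind-*-one (a ℕ.* b ℕ.≤? y) (ℕP.*-mono-≤ a≤x b≤x)))))
    -- Unless `α (a b)` is 0, the divisor `a` of the good number `a b` has `χ a = 1`, so the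
    -- character can be inserted.
    F≡ : ∀ {a b} → 1 ℕ.≤ a → 1 ℕ.≤ b → F a b ≡ ind (a ℕ.* b ℕ.≤? y) * (α (a ℕ.* b) * rc (a ℕ.* b)) * χ a
    F≡ {a} {b} 1≤a 1≤b = trans
      (cong (i *_) (ind-*-cong (good? (a ℕ.* b)) λ g → sym
        (trans (cong (rc (a ℕ.* b) *_) (good⁻ {d = a} (ℕP.*-mono-≤ 1≤a 1≤b) g (m∣m*n b))) (*-identityʳ (rc (a ℕ.* b))))))
      (solve 4 (λ i a r c → i :* (a :* (r :* c)) := i :* (a :* r) :* c) refl i (α (a ℕ.* b)) (rc (a ℕ.* b)) (χ a))
      where
      i = ind (a ℕ.* b ℕ.≤? y)

  -- Binary logarithms

  lg : ℕ → ℕ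
  lg zero = 0
  lg (suc n) with 2 ℕ.^ suc (lg n) ℕ.≤? suc n
  ... | yes _ = suc (lg n)
  ... | no  _ = lg n

  lg-lower : ∀ n → 1 ℕ.≤ n → 2 ℕ.^ lg n ℕ.≤ n
  lg-lower (suc n) _ with 2 ℕ.^ suc (lg n) ℕ.≤? suc n
  ... | yes h = h
  lg-lower (suc zero)    _ | no _ = s≤s z≤n
  lg-lower (suc (suc n)) _ | no _ = ℕP.m≤n⇒m≤1+n (lg-lower (suc n) (s≤s z≤n))

  lg-upper : ∀ n → n ℕ.< 2 ℕ.^ suc (lg n)
  lg-upper zero = s≤s z≤n
  lg-upper (suc n) with 2 ℕ.^ suc (lg n) ℕ.≤? suc n
  ... | no  h = ℕP.≰⇒> h
  ... | yes _ = ℕP.≤-<-trans (lg-upper n) (ℕP.^-monoʳ-< 2 (s≤s (s≤s z≤n)) (ℕP.n<1+n (suc (lg n))))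

  1≤lg : ∀ {n} → 2 ℕ.≤ n → 1 ℕ.≤ lg n
  1≤lg {n} 2≤n with lg n | lg-upper n
  ... | zero  | n<2 = ⊥-elim (ℕP.<⇒≱ n<2 2≤n)
  ... | suc _ | _   = s≤s z≤n

  -- Here `lg n` is at least 1, so `lg n + 1 ≤ 2 lg n`. This rounding is the source of the factor 2
  -- between `ℓ` and the logarithm.
  ≤4^lg : ∀ {n} → 2 ℕ.≤ n → n ℕ.≤ 4 ℕ.^ lg n
  ≤4^lg {n} 2≤n = ℕP.≤-trans (ℕP.<⇒≤ (lg-upper n)) (ℕP.≤-trans
    (ℕP.^-monoʳ-≤ 2 (ℕP.≤-trans (ℕP.+-monoˡ-≤ (lg n) (1≤lg 2≤n)) (ℕP.≤-reflexive (cong (lg n ℕ.+_) (sym (ℕP.+-identityʳ (lg n)))))))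
    (ℕP.≤-reflexive (sym (ℕP.^-*-assoc 2 2 (lg n)))))

  Lg : List ℕ → ℕ
  Lg ps = sum (map lg ps)

  2^Lg≤product : ∀ {ps} → All Prime ps → 2 ℕ.^ Lg ps ℕ.≤ product ps
  2^Lg≤product []                 = ℕP.≤-refl
  2^Lg≤product {p ∷ ps} (pr ∷ prs) = ℕP.≤-trans (ℕP.≤-reflexive (ℕP.^-distribˡ-+-* 2 (lg p) (Lg ps)))
    (ℕP.*-mono-≤ (lg-lower p (ℕP.<⇒≤ (prime⇒2≤ pr))) (2^Lg≤product prs))

  product≤4^Lg : ∀ {ps} → All Prime ps → product ps ℕ.≤ 4 ℕ.^ Lg ps
  product≤4^Lg []                 = ℕP.≤-refl
  product≤4^Lg {p ∷ ps} (pr ∷ prs) = ℕP.≤-trans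
    (ℕP.*-mono-≤ (≤4^lg (prime⇒2≤ pr)) (product≤4^Lg prs))
    (ℕP.≤-reflexive (sym (ℕP.^-distribˡ-+-* 4 (lg p) (Lg ps))))

  1≤product : ∀ {ps} → All Prime ps → 1 ℕ.≤ product ps
  1≤product []         = s≤s z≤n
  1≤product (pr ∷ prs) = ℕP.*-mono-≤ (ℕP.<⇒≤ (prime⇒2≤ pr)) (1≤product prs)

  primeFactors : ∀ {n} → 1 ℕ.≤ n → ∃[ ps ] n ≡ product ps × All Prime ps
  primeFactors {n@(suc _)} _ with factorise n
  ... | record { factors = ps ; isFactorisation = e ; factorsPrime = prs } = ps , e , prs

  2^-cancel-≤ : ∀ {a b} → 2 ℕ.^ a ℕ.≤ 2 ℕ.^ b → a ℕ.≤ b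
  2^-cancel-≤ h = ℕP.≮⇒≥ λ b<a → ℕP.<⇒≱ (ℕP.^-monoʳ-< 2 (s≤s (s≤s z≤n)) b<a) h

  prime∣prime⇒≡ : ∀ {p q} → Prime p → Prime q → p ∣ q → p ≡ q
  prime∣prime⇒≡ pp pq p∣q with prime⇒irreducible pq p∣q
  ... | inj₁ refl = ⊥-elim (ℕP.<⇒≱ (prime⇒2≤ pp) ℕP.≤-refl)
  ... | inj₂ p≡q  = p≡q

  prime∣^⇒≡ : ∀ {p q} k → Prime p → Prime q → p ∣ q ℕ.^ k → p ≡ q
  prime∣^⇒≡ zero pp pq p∣1 = ⊥-elim (ℕP.<⇒≢ (prime⇒2≤ pp) (sym (∣1⇒≡1 p∣1)))
  prime∣^⇒≡ {q = q} (suc k) pp pq h with euclidsLemma q (q ℕ.^ k) pp h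
  ... | inj₁ p∣q  = prime∣prime⇒≡ pp pq p∣q
  ... | inj₂ p∣qk = prime∣^⇒≡ k pp pq p∣qk

  n<p^n : ∀ {p} n → 2 ℕ.≤ p → n ℕ.< p ℕ.^ n
  n<p^n n 2≤p = ℕP.<-≤-trans (n<2^n n) (ℕP.^-monoˡ-≤ n 2≤p)

  -- The additive function with the value lg p at a prime p, summed over the prime powers p^k with p, k ≤ y that divide its
  -- argument; it replaces the logarithm, from which it differs by a factor of at most 2.

  weight : ℕ → ℚ
  weight q = ind (prime? q) * fromℕℚ (lg q)

  0≤weight : ∀ q → 0ℚ ≤ weight q
  0≤weight q = 0≤-* (0≤ind (prime? q)) (0≤fromℕℚ (lg q))

  weight-*-zero : ∀ q {a : ℚ} → (Prime q → a ≡ 0ℚ) → weight q * a ≡ 0ℚ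
  weight-*-zero q {a} h = trans (*-assoc (ind (prime? q)) (fromℕℚ (lg q)) a)
    (trans (ind-*-cong (prime? q) λ pr → trans (cong (fromℕℚ (lg q) *_) (h pr)) (*-zeroʳ (fromℕℚ (lg q))))
      (*-zeroʳ (ind (prime? q))))

  -- Truncation at `y` makes `ℓ` a sum over one fixed finite list, which can be exchanged with other
  -- sums; additivity is then claimed for products up to `y`. Bases that are not prime stay in the
  -- list with weight 0.
  module PrimePowers (y : ℕ) where

    index : List (ℕ × ℕ)
    index = cartesianProduct (1⋯ y) (1⋯ y)

    wt : ℕ × ℕ → ℚ
    wt (q , k) = weight q

    pp : ℕ × ℕ → ℕ
    pp (q , k) = q ℕ.^ k

    0≤wt : ∀ i → 0ℚ ≤ wt i
    0≤wt (q , k) = 0≤weight q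

    1≤pp : ∀ {i} → i ∈ index → 1 ℕ.≤ pp i
    1≤pp {q , k} i∈ = ℕP.m^n>0 q {{1≤⇒nonZero (proj₁ (∈-range⁻ (proj₁ (∈-cartesianProduct⁻ (1⋯ y) (1⋯ y) i∈))))}} k

    ℓ : ℕ → ℚ
    ℓ n = ∑[ i ∈ index ] (wt i * ind (pp i ∣? n))

    multiplicity : ℕ → ℕ → ℚ
    multiplicity q n = ∑[ k ∈ 1⋯ y ] ind (q ℕ.^ k ∣? n)

    ℓ≡ : ∀ n → ℓ n ≡ ∑[ q ∈ 1⋯ y ] (weight q * multiplicity q n)
    ℓ≡ n = trans (∑-cartesian (1⋯ y) (1⋯ y) _) (∑-cong (1⋯ y) λ q → sym (∑-*ˡ (weight q) (1⋯ y) _))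

    multiplicity-≢ : ∀ {p q} m → Prime p → Prime q → p ≢ q → multiplicity q (p ℕ.* m) ≡ multiplicity q m
    multiplicity-≢ {p} {q} m pp pq p≢q = ∑-cong (1⋯ y) λ k → ind-cong (q ℕ.^ k ∣? p ℕ.* m) (q ℕ.^ k ∣? m)
      (coprime-divisor (prime∤⇒coprime pp λ p∣qk → p≢q (prime∣^⇒≡ k pp pq p∣qk)))
      (∣n⇒∣m*n p)

    weight-multiplicity : ∀ {p q} m → Prime p →
      multiplicity p (p ℕ.* m) ≡ 1ℚ + multiplicity p m →
      weight q * multiplicity q (p ℕ.* m) ≡ weight q * multiplicity q m + ind (p ℕ.≟ q) * fromℕℚ (lg q)
    weight-multiplicity {p} {q} m pr e with p ℕ.≟ q
    ... | yes refl = trans (cong (weight p *_) e) (trans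
        (cong (λ i → i * fromℕℚ (lg p) * (1ℚ + multiplicity p m)) (ind-yes (prime? p) pr))
        (trans (solve 2 (λ l a → con 1ℚ :* l :* (con 1ℚ :+ a) := con 1ℚ :* l :* a :+ con 1ℚ :* l) refl (fromℕℚ (lg p)) (multiplicity p m))
          (cong (λ i → i * fromℕℚ (lg p) * multiplicity p m + 1ℚ * fromℕℚ (lg p)) (sym (ind-yes (prime? p) pr)))))
    ... | no p≢q = trans
        (trans (*-assoc (ind (prime? q)) (fromℕℚ (lg q)) _) (trans
          (ind-*-cong (prime? q) λ pq → cong (fromℕℚ (lg q) *_) (multiplicity-≢ m pr pq p≢q))
          (sym (*-assoc (ind (prime? q)) (fromℕℚ (lg q)) _))))
        (sym (trans (cong (weight q * multiplicity q m +_) (*-zeroˡ (fromℕℚ (lg q)))) (+-identityʳ _)))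

  -- Shifting `k` by one turns `p^(k+1) ∣ p m` into `p^k ∣ m`. The truncation loses nothing: the
  -- last term for `m` vanishes because `p^y > y ≥ m`.
  multiplicity-≡ : ∀ y {p m} → Prime p → 1 ℕ.≤ m → m ℕ.≤ y → let open PrimePowers y in
    multiplicity p (p ℕ.* m) ≡ 1ℚ + multiplicity p m
  multiplicity-≡ zero    pr 1≤m m≤y = ⊥-elim (ℕP.<⇒≱ 1≤m m≤y)
  multiplicity-≡ (suc y) {p} {m} pr 1≤m m≤y = trans (∑-range-1+ y λ k → ind (p ℕ.^ k ∣? p ℕ.* m))
    (cong₂ _+_ (ind-yes (p ℕ.^ 1 ∣? p ℕ.* m) (*-monoʳ-∣ p (1∣ m)))
      (trans (∑-cong (1⋯ y) λ k → ind-cong (p ℕ.^ suc k ∣? p ℕ.* m) (p ℕ.^ k ∣? m)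
          (*-cancelˡ-∣ p {{prime⇒nonZero pr}}) (*-monoʳ-∣ p))
        (sym (trans (cong (_+ ∑[ k ∈ 1⋯ y ] ind (p ℕ.^ k ∣? m))
          (ind-no (p ℕ.^ suc y ∣? m) λ d → ℕP.<⇒≱ (n<p^n (suc y) (prime⇒2≤ pr)) (ℕP.≤-trans (∣⇒≤′ 1≤m d) m≤y)))
          (+-identityˡ _)))))

  module _ {y : ℕ} where
    open PrimePowers y

    ℓ-prime-* : ∀ {p m} → Prime p → 1 ℕ.≤ m → p ℕ.* m ℕ.≤ y → ℓ (p ℕ.* m) ≡ fromℕℚ (lg p) + ℓ m
    ℓ-prime-* {p} {m} pr 1≤m pm≤y = trans (ℓ≡ (p ℕ.* m)) (trans
      (∑-cong (1⋯ y) λ q → weight-multiplicity {p} {q} m pr (multiplicity-≡ y pr 1≤m (ℕP.≤-trans (ℕP.m≤n*m m p {{prime⇒nonZero pr}}) pm≤y)))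
      (trans (sym (∑-+ (1⋯ y) (λ q → weight q * multiplicity q m) (λ q → ind (p ℕ.≟ q) * fromℕℚ (lg q))))
      (trans (+-comm (∑[ q ∈ 1⋯ y ] (weight q * multiplicity q m)) _) (cong₂ _+_
        (trans (∑-pick y (ℕP.<⇒≤ (prime⇒2≤ pr)) (λ q → fromℕℚ (lg q)))
          (ind-*-one (p ℕ.≤? y) (ℕP.≤-trans (ℕP.m≤m*n p m {{1≤⇒nonZero 1≤m}}) pm≤y)))
        (sym (ℓ≡ m))))))

    index-*-zero : ∀ {i} (a : ℚ) → i ∈ index → (2 ℕ.≤ pp i → a ≡ 0ℚ) → wt i * a ≡ 0ℚ
    index-*-zero {q , k} a i∈ h = weight-*-zero q λ pr → h (2≤^ k pr (proj₁ (∈-range⁻ (proj₂ (∈-cartesianProduct⁻ (1⋯ y) (1⋯ y) i∈)))))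
      where
      2≤^ : ∀ k → Prime q → 1 ℕ.≤ k → 2 ℕ.≤ q ℕ.^ k
      2≤^ (suc k) pr _ = ℕP.≤-trans (prime⇒2≤ pr) (ℕP.m≤m*n q (q ℕ.^ k) {{1≤⇒nonZero (ℕP.m^n>0 q {{prime⇒nonZero pr}} k)}})

    ℓ-1 : ℓ 1 ≡ 0ℚ
    ℓ-1 = ∑-0 index λ {i} i∈ → index-*-zero (ind (pp i ∣? 1)) i∈ λ 2≤ →
      ind-no (pp i ∣? 1) λ d → ℕP.<⇒≢ 2≤ (sym (∣1⇒≡1 d))

    ℓ-product : ∀ {ps} → All Prime ps → product ps ℕ.≤ y → ℓ (product ps) ≡ fromℕℚ (Lg ps)
    ℓ-product []                  _ = ℓ-1
    ℓ-product {p ∷ ps} (pr ∷ prs) h = trans (ℓ-prime-* pr (1≤product prs) h)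
      (trans (cong (fromℕℚ (lg p) +_) (ℓ-product prs (ℕP.≤-trans (ℕP.m≤n*m (product ps) p {{prime⇒nonZero pr}}) h)))
        (sym (fromℕℚ-+ (lg p) (Lg ps))))

    ℓ-* : ∀ {m n} → 1 ℕ.≤ m → 1 ℕ.≤ n → m ℕ.* n ℕ.≤ y → ℓ (m ℕ.* n) ≡ ℓ m + ℓ n
    ℓ-* {m} {n} 1≤m 1≤n mn≤y with primeFactors 1≤m | primeFactors 1≤n
    ... | ps , refl , prs | qs , refl , qrs = trans (cong ℓ (sym (product-++ ps qs)))
      (trans (ℓ-product (++⁺ prs qrs) (subst (ℕ._≤ y) (sym (product-++ ps qs)) mn≤y))
      (trans (cong fromℕℚ (trans (cong sum (map-++ lg ps qs)) (sum-++ (map lg ps) (map lg qs))))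
      (trans (fromℕℚ-+ (Lg ps) (Lg qs)) (cong₂ _+_
        (sym (ℓ-product prs (ℕP.≤-trans (ℕP.m≤m*n m n {{1≤⇒nonZero 1≤n}}) mn≤y)))
        (sym (ℓ-product qrs (ℕP.≤-trans (ℕP.m≤n*m n m {{1≤⇒nonZero 1≤m}}) mn≤y)))))))

    -- The inequalities `2 ^ lg p ≤ p ≤ 4 ^ lg p` are multiplied over the prime factors. The lower
    -- bound for `n` serves Chebyshev's argument, the upper one `log≤`.
    ℓ-bounds : ∀ {n} → 1 ℕ.≤ n → n ℕ.≤ y → ∃[ a ] ℓ n ≡ fromℕℚ a × 2 ℕ.^ a ℕ.≤ n × n ℕ.≤ 4 ℕ.^ a
    ℓ-bounds 1≤n n≤y with primeFactors 1≤n
    ... | ps , refl , prs = Lg ps , ℓ-product prs n≤y , 2^Lg≤product prs , product≤4^Lg prs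

  -- Chebyshev's bound

  1≤! : ∀ n → 1 ℕ.≤ n !
  1≤! zero    = s≤s z≤n
  1≤! (suc n) = ℕP.*-mono-≤ (s≤s (z≤n {n})) (1≤! n)

  !-mono : ∀ {m n} → m ℕ.≤ n → m ! ℕ.≤ n !
  !-mono {m} {n} m≤n = ∣⇒≤′ (1≤! n) (m≤n⇒m!∣n! m≤n)

  -- The induction step is `(2n+2)(2n+1) ≤ (2n+2)² = 4 (n+1)²`.
  double!≤ : ∀ n → (n ℕ.+ n) ! ℕ.≤ 4 ℕ.^ n ℕ.* (n ! ℕ.* n !)
  double!≤ zero    = ℕP.≤-refl
  double!≤ (suc n) = begin
    (suc n ℕ.+ suc n) !
      ≡⟨ cong (λ k → suc k !) (ℕP.+-suc n n) ⟩
    suc (suc (n ℕ.+ n)) ℕ.* (suc (n ℕ.+ n) ℕ.* (n ℕ.+ n) !)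
      ≤⟨ ℕP.*-monoʳ-≤ (suc (suc (n ℕ.+ n))) (ℕP.*-mono-≤ (ℕP.n≤1+n (suc (n ℕ.+ n))) (double!≤ n)) ⟩
    suc (suc (n ℕ.+ n)) ℕ.* (suc (suc (n ℕ.+ n)) ℕ.* (4 ℕ.^ n ℕ.* (n ! ℕ.* n !)))
      ≡⟨ rearrange n (4 ℕ.^ n) (n !) ⟩
    4 ℕ.* 4 ℕ.^ n ℕ.* (suc n ℕ.* n ! ℕ.* (suc n ℕ.* n !)) ∎
    where
    open ℕP.≤-Reasoning
    rearrange : ∀ n b f → suc (suc (n ℕ.+ n)) ℕ.* (suc (suc (n ℕ.+ n)) ℕ.* (b ℕ.* (f ℕ.* f)))
      ≡ 4 ℕ.* b ℕ.* (suc n ℕ.* f ℕ.* (suc n ℕ.* f))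
    rearrange = ℕR.solve-∀

  -- The factor `b` is the central binomial coefficient, in a form to which additivity of `ℓ`
  -- applies.
  double!-factor : ∀ n → ∃[ b ] (n ℕ.+ n) ! ≡ b ℕ.* (n ! ℕ.* n !) × 1 ℕ.≤ b × b ℕ.≤ 4 ℕ.^ n
  double!-factor n with subst (λ k → n ! ℕ.* k ! ∣ (n ℕ.+ n) !) (ℕP.m+n∸n≡m n n) (k![n∸k]!∣n! (ℕP.m≤m+n n n))
  ... | divides b eq = b , eq , ∣⇒1≤ (1≤! (n ℕ.+ n)) (divides (n ! ℕ.* n !) (trans eq (ℕP.*-comm b _))) ,
    ℕP.*-cancelʳ-≤ b (4 ℕ.^ n) (n ! ℕ.* n !) {{1≤⇒nonZero (ℕP.*-mono-≤ (1≤! n) (1≤! n))}}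
      (subst (ℕ._≤ 4 ℕ.^ n ℕ.* (n ! ℕ.* n !)) eq (double!≤ n))

  multiples : ∀ n {d} .{{_ : ℕ.NonZero d}} → ∑[ t ∈ 1⋯ n ] ind (d ∣? t) ≡ fromℕℚ (n ℕ./ d)
  multiples n {d} = trans (∑-cong∈ (1⋯ n) λ {t} t∈ → sym (∑-cofactor {d} (proj₁ (∈-range⁻ t∈)) (proj₂ (∈-range⁻ t∈))))
    (trans (∑-swap (1⋯ n) (1⋯ n) _)
    (trans (∑-cong∈ (1⋯ n) λ {m} m∈ → trans
        (∑-cong (1⋯ n) λ t → sym (*-identityʳ (ind (d ℕ.* m ℕ.≟ t))))
        (trans (∑-pick n (ℕP.*-mono-≤ (ℕ.>-nonZero⁻¹ d) (proj₁ (∈-range⁻ m∈))) (λ _ → 1ℚ))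
        (trans (*-identityʳ (ind (d ℕ.* m ℕ.≤? n)))
          (ind-cong (d ℕ.* m ℕ.≤? n) (m ℕ.≤? n ℕ./ d)
            (λ h → proj₂ (≤/⇔ {m} {n} {d}) (subst (ℕ._≤ n) (ℕP.*-comm d m) h))
            (λ h → subst (ℕ._≤ n) (ℕP.*-comm m d) (proj₁ (≤/⇔ {m} {n} {d}) h))))))
      (∑-range-≤ n (n ℕ./ d) (m/n≤m n d))))

  -- The difference of `(n + n) / d` and twice `n / d` is never negative, and it is at least 1 for
  -- `n < d ≤ 2n`. The form avoids subtraction.
  multiples-double : ∀ n {d} .{{_ : ℕ.NonZero d}} →
    ind (d ℕ.≤? n ℕ.+ n) + (fromℕℚ (n ℕ./ d) + fromℕℚ (n ℕ./ d)) ≤ ind (d ℕ.≤? n) + fromℕℚ ((n ℕ.+ n) ℕ./ d)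
  multiples-double n {d} with d ℕ.≤? n
  ... | yes d≤n = +-mono-≤ (ind≤1 (d ℕ.≤? n ℕ.+ n)) (≤-trans (≤-reflexive (sym (fromℕℚ-+ (n ℕ./ d) (n ℕ./ d))))
    (fromℕℚ-≤ (proj₂ (≤/⇔ {n ℕ./ d ℕ.+ n ℕ./ d} {n ℕ.+ n} {d})
      (ℕP.≤-trans (ℕP.≤-reflexive (ℕP.*-distribʳ-+ d (n ℕ./ d) (n ℕ./ d)))
        (ℕP.+-mono-≤ (m/n*n≤m n d) (m/n*n≤m n d))))))
  ... | no d≰n = ≤-trans
    (≤-reflexive (trans (cong (λ k → ind (d ℕ.≤? n ℕ.+ n) + (fromℕℚ k + fromℕℚ k)) (m<n⇒m/n≡0 (ℕP.≰⇒> d≰n)))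
      (+-identityʳ (ind (d ℕ.≤? n ℕ.+ n)))))
    (≤-trans (atMost (d ℕ.≤? n ℕ.+ n)) (≤-reflexive (sym (+-identityˡ (fromℕℚ ((n ℕ.+ n) ℕ./ d))))))
    where
    atMost : (e : Dec (d ℕ.≤ n ℕ.+ n)) → ind e ≤ fromℕℚ ((n ℕ.+ n) ℕ./ d)
    atMost (yes d≤2n) = fromℕℚ-≤ {1} (m≥n⇒m/n>0 d≤2n)
    atMost (no  _)    = 0≤fromℕℚ ((n ℕ.+ n) ℕ./ d)

  module _ {y : ℕ} where
    open PrimePowers y

    -- Chebyshev's function, with `lg p` in place of `log p`.
    ψ : ℕ → ℚ
    ψ z = ∑[ i ∈ index ] (wt i * ind (pp i ℕ.≤? z))

    ℓ-! : ∀ n → n ! ℕ.≤ y → ∑ (1⋯ n) ℓ ≡ ℓ (n !)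
    ℓ-! zero    _ = sym (ℓ-1 {y})
    ℓ-! (suc n) h = trans
      (cong (ℓ (suc n) +_) (ℓ-! n (ℕP.≤-trans (ℕP.m≤n*m (n !) (suc n)) h)))
      (sym (ℓ-* (s≤s (z≤n {n})) (1≤! n) h))

    ∑-ℓ : ∀ n → ∑ (1⋯ n) ℓ ≡ ∑[ i ∈ index ] (wt i * ∑[ t ∈ 1⋯ n ] ind (pp i ∣? t))
    ∑-ℓ n = trans (∑-swap (1⋯ n) index _) (∑-cong index λ i → sym (∑-*ˡ (wt i) (1⋯ n) _))

    -- This is `multiples-double`, weighted and summed over prime powers, since the sum of `ℓ` up to
    -- `n` counts multiples of prime powers (Legendre's formula for `n !`).
    ψ-double-∑ : ∀ n → ψ (n ℕ.+ n) + (∑ (1⋯ n) ℓ + ∑ (1⋯ n) ℓ) ≤ ψ n + ∑ (1⋯ (n ℕ.+ n)) ℓ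
    ψ-double-∑ n = ≤-trans (≤-reflexive (trans
        (cong (λ z → ψ (n ℕ.+ n) + (z + z)) (∑-ℓ n))
        (trans (cong (ψ (n ℕ.+ n) +_) (∑-+ index (λ i → wt i * c i) (λ i → wt i * c i)))
          (∑-+ index (λ i → wt i * ind (pp i ℕ.≤? n ℕ.+ n)) (λ i → wt i * c i + wt i * c i)))))
      (≤-trans (∑-mono index λ {i} i∈ → termwise i {{1≤⇒nonZero (1≤pp i∈)}})
      (≤-reflexive (sym (trans (cong (ψ n +_) (∑-ℓ (n ℕ.+ n)))
        (∑-+ index (λ i → wt i * ind (pp i ℕ.≤? n)) (λ i → wt i * c₂ i))))))
      where
      c c₂ : ℕ × ℕ → ℚ
      c  i = ∑[ t ∈ 1⋯ n ] ind (pp i ∣? t)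
      c₂ i = ∑[ t ∈ 1⋯ (n ℕ.+ n) ] ind (pp i ∣? t)
      termwise : ∀ i .{{_ : ℕ.NonZero (pp i)}} →
        wt i * ind (pp i ℕ.≤? n ℕ.+ n) + (wt i * c i + wt i * c i) ≤ wt i * ind (pp i ℕ.≤? n) + wt i * c₂ i
      termwise i = subst₂ _≤_
        (trans (cong (λ z → wt i * (ind (pp i ℕ.≤? n ℕ.+ n) + (z + z))) (sym (multiples n {pp i})))
          (solve 3 (λ w a c → w :* (a :+ (c :+ c)) := w :* a :+ (w :* c :+ w :* c)) refl (wt i) (ind (pp i ℕ.≤? n ℕ.+ n)) (c i)))
        (trans (cong (λ z → wt i * (ind (pp i ℕ.≤? n) + z)) (sym (multiples (n ℕ.+ n) {pp i})))
          (*-distribˡ-+ (wt i) (ind (pp i ℕ.≤? n)) (c₂ i)))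
        (*-monoˡ (wt i) (0≤wt i) (multiples-double n {pp i}))

    -- By `ψ-double-∑` the increment of `ψ` from `n` to `2n` is at most `ℓ b = a` for the central
    -- binomial coefficient `b`, and `2 ^ a ≤ b ≤ 4 ^ n` gives `a ≤ 2n`.
    ψ-double : ∀ n → (n ℕ.+ n) ! ℕ.≤ y → ψ (n ℕ.+ n) ≤ ψ n + fromℕℚ (n ℕ.+ n)
    ψ-double n h with double!-factor n
    ... | b , eq , 1≤b , b≤ with ℓ-bounds {y} {b} 1≤b b≤y
      where
      b≤y : b ℕ.≤ y
      b≤y = ℕP.≤-trans (ℕP.m≤m*n b (n ! ℕ.* n !) {{1≤⇒nonZero (ℕP.*-mono-≤ (1≤! n) (1≤! n))}})
        (subst (ℕ._≤ y) eq h)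
    ... | a , ℓb≡a , 2^a≤b , _ = cancel (≤-trans (ψ-double-∑ n) (≤-reflexive (cong (ψ n +_) T₂)))
      where
      T = ∑ (1⋯ n) ℓ
      n!≤ : n ! ℕ.≤ y
      n!≤ = ℕP.≤-trans (!-mono (ℕP.m≤m+n n n)) h
      T₂ : ∑ (1⋯ (n ℕ.+ n)) ℓ ≡ fromℕℚ a + (T + T)
      T₂ = trans (ℓ-! (n ℕ.+ n) h) (trans (cong ℓ eq)
        (trans (ℓ-* 1≤b (ℕP.*-mono-≤ (1≤! n) (1≤! n)) (subst (ℕ._≤ y) eq h))
        (cong₂ _+_ ℓb≡a (trans (ℓ-* (1≤! n) (1≤! n)
            (ℕP.≤-trans (ℕP.m≤n*m (n ! ℕ.* n !) b {{1≤⇒nonZero 1≤b}}) (subst (ℕ._≤ y) eq h)))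
          (sym (cong₂ _+_ (ℓ-! n n!≤) (ℓ-! n n!≤)))))))
      a≤2n : a ℕ.≤ n ℕ.+ n
      a≤2n = 2^-cancel-≤ (ℕP.≤-trans 2^a≤b (ℕP.≤-trans b≤ (ℕP.≤-reflexive
        (trans (ℕP.^-*-assoc 2 2 n) (cong (λ k → 2 ℕ.^ (n ℕ.+ k)) (ℕP.+-identityʳ n))))))
      cancel : ψ (n ℕ.+ n) + (T + T) ≤ ψ n + (fromℕℚ a + (T + T)) → ψ (n ℕ.+ n) ≤ ψ n + fromℕℚ (n ℕ.+ n)
      cancel e = ≤-trans (subst₂ _≤_
          (solve 2 (λ p t → p :+ t :- t := p) refl (ψ (n ℕ.+ n)) (T + T))
          (solve 3 (λ p a t → p :+ (a :+ t) :- t := p :+ a) refl (ψ n) (fromℕℚ a) (T + T))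
          (+-monoˡ-≤ (- (T + T)) e))
        (+-monoʳ-≤ (ψ n) (fromℕℚ-≤ a≤2n))

    ψ≤1 : ∀ {z} → z ℕ.≤ 1 → ψ z ≡ 0ℚ
    ψ≤1 {z} z≤1 = ∑-0 index λ {i} i∈ → index-*-zero {y} {i} (ind (pp i ℕ.≤? z)) i∈ λ 2≤ →
      ind-no (pp i ℕ.≤? z) λ h → ℕP.<⇒≱ 2≤ (ℕP.≤-trans h z≤1)

    -- Passing from `2 ^ j` to its double adds at most `2 · 2 ^ j`, which is the bound already
    -- reached at `2 ^ j`.
    ψ-2^ : ∀ j → (2 ℕ.^ j) ! ℕ.≤ y → ψ (2 ℕ.^ j) ≤ fromℕℚ (2 ℕ.* 2 ℕ.^ j)
    ψ-2^ zero    _ = ≤-trans (≤-reflexive (ψ≤1 ℕP.≤-refl)) (0≤fromℕℚ 2)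
    ψ-2^ (suc j) h = ≤-trans (≤-reflexive (cong ψ 2^≡))
      (≤-trans (ψ-double (2 ℕ.^ j) (subst (λ k → k ! ℕ.≤ y) 2^≡ h))
      (≤-trans (+-monoˡ-≤ _ (ψ-2^ j (ℕP.≤-trans (!-mono (ℕP.m≤m+n (2 ℕ.^ j) _)) h)))
        (≤-reflexive (trans (sym (fromℕℚ-+ (2 ℕ.* 2 ℕ.^ j) _))
          (cong fromℕℚ (double (2 ℕ.^ j)))))))
      where
      2^≡ : 2 ℕ.^ suc j ≡ 2 ℕ.^ j ℕ.+ 2 ℕ.^ j
      2^≡ = cong (2 ℕ.^ j ℕ.+_) (ℕP.+-identityʳ (2 ℕ.^ j))
      double : ∀ a → 2 ℕ.* a ℕ.+ (a ℕ.+ a) ≡ 2 ℕ.* (2 ℕ.* a)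
      double = ℕR.solve-∀

    ψ-mono : ∀ {z z′} → z ℕ.≤ z′ → ψ z ≤ ψ z′
    ψ-mono {z} {z′} z≤z′ = ∑-mono index λ {i} _ → *-monoˡ (wt i) (0≤wt i)
      (ind-mono (pp i ℕ.≤? z) (pp i ℕ.≤? z′) λ h → ℕP.≤-trans h z≤z′)

    ψ≤4* : ∀ z → (2 ℕ.* z) ! ℕ.≤ y → ψ z ≤ fromℕℚ (4 ℕ.* z)
    ψ≤4* zero    _ = ≤-reflexive (ψ≤1 z≤n)
    ψ≤4* z@(suc _) h = ≤-trans (ψ-mono (ℕP.<⇒≤ (lg-upper z)))
      (≤-trans (ψ-2^ (suc (lg z)) (ℕP.≤-trans (!-mono 2^≤) h))
        (fromℕℚ-≤ (ℕP.≤-trans (ℕP.*-monoʳ-≤ 2 2^≤) (ℕP.≤-reflexive (sym (ℕP.*-assoc 2 2 z))))))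
      where
      2^≤ : 2 ℕ.^ suc (lg z) ℕ.≤ 2 ℕ.* z
      2^≤ = ℕP.*-monoʳ-≤ 2 (lg-lower z (s≤s z≤n))

    chebyshev : ∀ {x k} → (2 ℕ.* x) ! ℕ.≤ y → 1 ℕ.≤ k →
      ∑[ i ∈ index ] (wt i * ind (pp i ℕ.* k ℕ.≤? x)) ≤ fromℕℚ (4 ℕ.* x) * rc k
    chebyshev {x} {k@(suc _)} h _ = ≤-trans
      (≤-reflexive (∑-cong index λ i → cong (wt i *_) (ind-cong (pp i ℕ.* k ℕ.≤? x) (pp i ℕ.≤? x ℕ./ k)
        (proj₂ (≤/⇔ {pp i} {x} {k})) (proj₁ (≤/⇔ {pp i} {x} {k})))))
      (≤-trans (ψ≤4* (x ℕ./ k) (ℕP.≤-trans (!-mono (ℕP.*-monoʳ-≤ 2 (m/n≤m x k))) h))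
        (≤⇒≤*rc {4 ℕ.* (x ℕ./ k)} {k} {4 ℕ.* x} (s≤s z≤n) (ℕP.≤-trans (ℕP.≤-reflexive (ℕP.*-assoc 4 (x ℕ./ k) k))
          (ℕP.*-monoʳ-≤ 4 (m/n*n≤m x k)))))

  -- Harmonic sums

  H : ℕ → ℚ
  H n = ∑ (1⋯ n) rc

  rc-anti : ∀ {m n} → 1 ℕ.≤ m → m ℕ.≤ n → rc n ≤ rc m
  rc-anti {suc m} {suc n} _ (s≤s m≤n) = unit-anti m≤n

  rc-*-cancel : ∀ {n} → 1 ℕ.≤ n → rc n * fromℕℚ n ≡ 1ℚ
  rc-*-cancel {suc n} _ = unit-* n

  H-+ : ∀ {n} k → 1 ℕ.≤ n → H (k ℕ.+ n) ≤ fromℕℚ k * rc n + H n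
  H-+ {n} zero    1≤n = ≤-reflexive (sym (trans (cong (_+ H n) (*-zeroˡ (rc n))) (+-identityˡ (H n))))
  H-+ {n} (suc k) 1≤n = ≤-trans (+-mono-≤ (rc-anti 1≤n (ℕP.m≤n+m n (suc k))) (H-+ k 1≤n))
    (≤-reflexive (trans (solve 3 (λ r k h → r :+ (k :* r :+ h) := (con 1ℚ :+ k) :* r :+ h) refl (rc n) (fromℕℚ k) (H n))
      (cong (λ z → z * rc n + H n) (sym (fromℕℚ-suc k)))))

  H-double : ∀ {n} → 1 ℕ.≤ n → H (n ℕ.+ n) ≤ 1ℚ + H n
  H-double {n} 1≤n = ≤-trans (H-+ n 1≤n) (≤-reflexive (cong (_+ H n) (trans (*-comm (fromℕℚ n) (rc n)) (rc-*-cancel 1≤n))))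

  H-2^ : ∀ k {n} → 1 ℕ.≤ n → H (2 ℕ.^ k ℕ.* n) ≤ fromℕℚ k + H n
  H-2^ zero    {n} 1≤n = ≤-reflexive (trans (cong H (ℕP.*-identityˡ n)) (sym (+-identityˡ (H n))))
  H-2^ (suc k) {n} 1≤n = ≤-trans (≤-reflexive (cong H (double (2 ℕ.^ k) n)))
    (≤-trans (H-double (ℕP.*-mono-≤ (ℕP.m^n>0 2 k) 1≤n))
    (≤-trans (+-monoʳ-≤ 1ℚ (H-2^ k 1≤n)) (≤-reflexive (trans (sym (+-assoc 1ℚ (fromℕℚ k) (H n)))
      (cong (_+ H n) (sym (fromℕℚ-suc k)))))))
    where
    double : ∀ a n → 2 ℕ.* a ℕ.* n ≡ a ℕ.* n ℕ.+ a ℕ.* n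
    double = ℕR.solve-∀

  -- Telescoping with `1/(n+2)² ≤ 1/(n+1) - 1/(n+2)`. The induction in `go` runs on the stronger
  -- claim in which the last reciprocal is added to the sum.
  ∑-rc²≤2 : ∀ n → ∑[ s ∈ 1⋯ n ] rc (s ℕ.* s) ≤ fromℕℚ 2
  ∑-rc²≤2 zero    = 0≤fromℕℚ 2
  ∑-rc²≤2 (suc n) = ≤-trans (nonNeg⇒≤ (rc (suc n)) (0≤rc (suc n)) refl) (go n)
    where
    go : ∀ n → ∑[ s ∈ 1⋯ suc n ] rc (s ℕ.* s) + rc (suc n) ≤ fromℕℚ 2
    go zero    = ≤-refl
    go (suc n) = ≤-trans (≤-reflexive (solve 3 (λ a s r → a :+ s :+ r := s :+ (a :+ r)) refl (rc (suc (suc n) ℕ.* suc (suc n))) Σ (unit (suc n))))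
      (≤-trans (+-monoʳ-≤ Σ step) (go n))
      where
      Σ = ∑[ s ∈ 1⋯ suc n ] rc (s ℕ.* s)
      u = unit n
      v = unit (suc n)
      F = fromℕℚ (suc n)
      u≡ : v + u * v ≡ u
      u≡ = trans (cong (_+ u * v) (sym (trans (cong (_* v) (unit-* n)) (*-identityˡ v))))
        (trans (solve 3 (λ u v f → u :* f :* v :+ u :* v := u :* (v :* (con 1ℚ :+ f))) refl u v F)
        (trans (cong (λ z → u * (v * z)) (sym (fromℕℚ-suc (suc n))))
        (trans (cong (u *_) (unit-* (suc n))) (*-identityʳ u))))
      step : rc (suc (suc n) ℕ.* suc (suc n)) + v ≤ u
      step = subst₂ _≤_ (trans (cong (v +_) (sym (rc-* (suc (suc n)) (suc (suc n))))) (+-comm v _)) u≡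
        (+-monoʳ-≤ v (*-monoʳ v (0≤rc (suc (suc n))) (unit-anti (ℕP.n≤1+n n))))

  -- Counting the pairs (s, t) with t good and s² t ≤ x

  n≤n! : ∀ n → n ℕ.≤ n !
  n≤n! zero    = z≤n
  n≤n! (suc n) = ℕP.m≤m*n (suc n) (n !) {{1≤⇒nonZero (1≤! n)}}

  isqrt-≤ : ∀ n → isqrt n ℕ.≤ n
  isqrt-≤ n = ℕP.≤-trans (n≤n*n (isqrt n)) (isqrt-lower n)

  isqrt-max : ∀ {s n} → s ℕ.* s ℕ.≤ n → s ℕ.≤ isqrt n
  isqrt-max {s} {n} s²≤n = ℕP.≮⇒≥ λ r<s →
    ℕP.<⇒≱ (isqrt-upper n) (ℕP.≤-trans (ℕP.*-mono-≤ r<s r<s) s²≤n)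

  square≤4^ : ∀ c → suc c ℕ.* suc c ℕ.≤ 4 ℕ.^ c
  square≤4^ c = ℕP.≤-trans (ℕP.*-mono-≤ (n<2^n c) (n<2^n c)) (ℕP.≤-reflexive (trans (sym (ℕP.^-distribˡ-+-* 2 c c))
    (trans (cong (λ k → 2 ℕ.^ (c ℕ.+ k)) (sym (ℕP.+-identityʳ c))) (sym (ℕP.^-*-assoc 2 2 c)))))

  module Counting (x : ℕ) where

    -- Large enough for Chebyshev's argument up to `x`, which evaluates `ℓ` at factorials up to this
    -- one.
    y : ℕ
    y = (2 ℕ.* x) !

    open PrimePowers y

    x≤y : x ℕ.≤ y
    x≤y = ℕP.≤-trans (ℕP.m≤m+n x (x ℕ.+ 0)) (n≤n! (2 ℕ.* x))

    X S : ℚ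
    X = fromℕℚ x
    S = goodSum x

    -- Substituting `t = a m`, the cofactor `m` is good because divisors of good numbers are. In use
    -- `a` is a prime power and `c` a square.
    goodMultiples : ∀ {a c} → 1 ℕ.≤ a →
      ∑[ t ∈ 1⋯ x ] (α t * ind (c ℕ.* t ℕ.≤? x) * ind (a ∣? t)) ≤ ∑[ m ∈ 1⋯ x ] (α m * ind (a ℕ.* (c ℕ.* m) ℕ.≤? x))
    goodMultiples {a} {c} 1≤a = ≤-trans (≤-reflexive (trans
        (∑-cong∈ (1⋯ x) λ {t} t∈ → trans
          (cong (f t *_) (sym (∑-cofactor {a} (proj₁ (∈-range⁻ t∈)) (proj₂ (∈-range⁻ t∈)))))
          (trans (∑-*ˡ (f t) (1⋯ x) _) (∑-cong (1⋯ x) λ m → *-comm (f t) (ind (a ℕ.* m ℕ.≟ t)))))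
        (∑-swap (1⋯ x) (1⋯ x) _)))
      (∑-mono (1⋯ x) λ {m} m∈ → ≤-trans (≤-reflexive (∑-pick x (ℕP.*-mono-≤ 1≤a (proj₁ (∈-range⁻ m∈))) f))
        (pointwise m (proj₁ (∈-range⁻ m∈))))
      where
      f : ℕ → ℚ
      f t = α t * ind (c ℕ.* t ℕ.≤? x)
      pointwise : ∀ m → 1 ℕ.≤ m → ind (a ℕ.* m ℕ.≤? x) * f (a ℕ.* m) ≤ α m * ind (a ℕ.* (c ℕ.* m) ℕ.≤? x)
      pointwise m 1≤m = ≤-trans (*-monoʳ (f (a ℕ.* m)) (0≤-* (0≤α (a ℕ.* m)) (0≤ind (c ℕ.* (a ℕ.* m) ℕ.≤? x))) (ind≤1 (a ℕ.* m ℕ.≤? x)))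
        (≤-trans (≤-reflexive (*-identityˡ (f (a ℕ.* m))))
        (*-mono (0≤α (a ℕ.* m)) (0≤ind (a ℕ.* (c ℕ.* m) ℕ.≤? x))
          (ind-mono (good? (a ℕ.* m)) (good? m) (good-∣ (ℕP.*-mono-≤ 1≤a 1≤m) (n∣m*n a)))
          (ind-mono (c ℕ.* (a ℕ.* m) ℕ.≤? x) (a ℕ.* (c ℕ.* m) ℕ.≤? x) (subst (ℕ._≤ x) (comm a c m)))))
        where
        comm : ∀ a c m → c ℕ.* (a ℕ.* m) ≡ a ℕ.* (c ℕ.* m)
        comm = ℕR.solve-∀

    -- Expand `ℓ t` over the prime powers `q` dividing `t = q m` and exchange the sums. For each
    -- good `m` there remain the `q ≤ x / (c m)`, of total weight at most `4 x / (c m)`. The factor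
    -- `rc c` makes the later sum over `c = s²` converge.
    ∑-good-ℓ : ∀ {c} → 1 ℕ.≤ c →
      ∑[ t ∈ 1⋯ x ] (α t * ind (c ℕ.* t ℕ.≤? x) * ℓ t) ≤ fromℕℚ 4 * X * S * rc c
    ∑-good-ℓ {c} 1≤c = ≤-trans (≤-reflexive (trans
        (∑-cong (1⋯ x) λ t → trans (∑-*ˡ (f t) index _) (∑-cong index λ i →
          solve 3 (λ f w d → f :* (w :* d) := w :* (f :* d)) refl (f t) (wt i) (ind (pp i ∣? t))))
        (trans (∑-swap (1⋯ x) index _) (∑-cong index λ i → sym (∑-*ˡ (wt i) (1⋯ x) _)))))
      (≤-trans (∑-mono index λ {i} i∈ → *-monoˡ (wt i) (0≤wt i) (goodMultiples {pp i} {c} (1≤pp i∈)))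
      (≤-trans (≤-reflexive (trans
        (∑-cong index λ i → trans (∑-*ˡ (wt i) (1⋯ x) _) (∑-cong (1⋯ x) λ m →
          solve 3 (λ w a d → w :* (a :* d) := a :* (w :* d)) refl (wt i) (α m) (ind (pp i ℕ.* (c ℕ.* m) ℕ.≤? x))))
        (trans (∑-swap index (1⋯ x) _) (∑-cong (1⋯ x) λ m → sym (∑-*ˡ (α m) index _)))))
      (≤-trans (∑-mono (1⋯ x) λ {m} m∈ → *-monoˡ (α m) (0≤α m)
          (chebyshev {y} {x} {c ℕ.* m} ℕP.≤-refl (ℕP.*-mono-≤ 1≤c (proj₁ (∈-range⁻ m∈)))))
      (≤-reflexive (trans
        (∑-cong (1⋯ x) λ m → trans (cong₂ (λ a b → α m * (a * b)) (fromℕℚ-* 4 x) (rc-* c m))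
          (solve 4 (λ a b r s → a :* (b :* (r :* s)) := b :* r :* (a :* s)) refl (α m) (fromℕℚ 4 * X) (rc c) (rc m)))
        (trans (sym (∑-*ˡ (fromℕℚ 4 * X * rc c) (1⋯ x) _))
          (solve 3 (λ a r s → a :* r :* s := a :* s :* r) refl (fromℕℚ 4 * X) (rc c) S)))))))
      where
      f : ℕ → ℚ
      f t = α t * ind (c ℕ.* t ℕ.≤? x)

    root : ∀ t .{{_ : ℕ.NonZero t}} → ℕ
    root t = isqrt (x ℕ./ t)

    ∑-squares : ∀ t .{{_ : ℕ.NonZero t}} → ∑[ s ∈ 1⋯ x ] ind (s ℕ.* s ℕ.* t ℕ.≤? x) ≡ fromℕℚ (root t)
    ∑-squares t = trans
      (∑-cong (1⋯ x) λ s → ind-cong (s ℕ.* s ℕ.* t ℕ.≤? x) (s ℕ.≤? root t)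
        (λ h → isqrt-max (proj₂ (≤/⇔ {s ℕ.* s} {x} {t}) h))
        (λ h → proj₁ (≤/⇔ {s ℕ.* s} {x} {t}) (ℕP.≤-trans (ℕP.*-mono-≤ h h) (isqrt-lower (x ℕ./ t)))))
      (∑-range-≤ x (root t) (ℕP.≤-trans (isqrt-≤ (x ℕ./ t)) (m/n≤m x t)))

    -- With `c = root t` and `ℓ t = a`, the reason is `x ≤ t (x / t + 1) ≤ t (c + 1)² ≤ 4 ^ a · 4 ^
    -- c`. Bounding `c + 1` by `2 ^ c` is wasteful but leaves a term that can be summed.
    log≤ : ∀ {K} t .{{_ : ℕ.NonZero t}} → 2 ℕ.^ K ℕ.≤ x → 1 ℕ.≤ t → t ℕ.≤ x →
      fromℕℚ K ≤ fromℕℚ 2 * ℓ t + fromℕℚ 2 * fromℕℚ (root t)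
    log≤ {K} t 2^K≤x 1≤t t≤x with ℓ-bounds {y} {t} 1≤t (ℕP.≤-trans t≤x x≤y)
    ... | a , ℓ≡a , _ , t≤4^a = ≤-trans (fromℕℚ-≤ K≤) (≤-reflexive (trans (fromℕℚ-+ (2 ℕ.* a) (2 ℕ.* c))
        (cong₂ _+_ (trans (fromℕℚ-* 2 a) (cong (fromℕℚ 2 *_) (sym ℓ≡a))) (fromℕℚ-* 2 c))))
      where
      c = root t
      x≤ : x ℕ.≤ 4 ℕ.^ a ℕ.* 4 ℕ.^ c
      x≤ = ℕP.≤-trans (ℕP.<⇒≤ (ℕP.≤-trans (ℕP.≤-reflexive (cong suc (m≡m%n+[m/n]*n x t)))
          (ℕP.+-monoˡ-≤ (x ℕ./ t ℕ.* t) (m%n<n x t))))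
        (ℕP.≤-trans (ℕP.≤-reflexive (ℕP.*-comm (suc (x ℕ./ t)) t))
        (ℕP.*-mono-≤ t≤4^a (ℕP.≤-trans (isqrt-upper (x ℕ./ t)) (square≤4^ c))))
      K≤ : K ℕ.≤ 2 ℕ.* a ℕ.+ 2 ℕ.* c
      K≤ = 2^-cancel-≤ (ℕP.≤-trans 2^K≤x (ℕP.≤-trans x≤ (ℕP.≤-reflexive (trans
        (cong₂ ℕ._*_ (ℕP.^-*-assoc 2 2 a) (ℕP.^-*-assoc 2 2 c)) (sym (ℕP.^-distribˡ-+-* 2 (2 ℕ.* a) (2 ℕ.* c)))))))

    goodSquares : ℚ
    goodSquares = ∑[ t ∈ 1⋯ x ] ∑[ s ∈ 1⋯ x ] (α t * ind (s ℕ.* s ℕ.* t ℕ.≤? x))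

    log-*-goodSquares≤ : ∀ {K} → 2 ℕ.^ K ℕ.≤ x → fromℕℚ K * goodSquares ≤ fromℕℚ 18 * X * S
    log-*-goodSquares≤ {K} 2^K≤x = ≤-trans (≤-reflexive (∑-*ˡ (fromℕℚ K) (1⋯ x) _))
      (≤-trans (∑-mono (1⋯ x) λ {t} t∈ → termwise t (∈-range⁻ t∈))
      (≤-trans (≤-reflexive (sym (∑-+ (1⋯ x) (λ t → fromℕℚ 2 * L t) (λ t → fromℕℚ 2 * X * (α t * rc t)))))
      (≤-trans (+-mono-≤
        (≤-trans (≤-reflexive (trans (sym (∑-*ˡ (fromℕℚ 2) (1⋯ x) L)) (cong (fromℕℚ 2 *_) (∑-swap (1⋯ x) (1⋯ x) _))))
          (*-monoˡ (fromℕℚ 2) (0≤fromℕℚ 2) (≤-trans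
            (∑-mono (1⋯ x) λ {s} s∈ → ∑-good-ℓ (ℕP.*-mono-≤ (proj₁ (∈-range⁻ s∈)) (proj₁ (∈-range⁻ s∈))))
            (≤-trans (≤-reflexive (sym (∑-*ˡ (fromℕℚ 4 * X * S) (1⋯ x) _)))
              (*-monoˡ (fromℕℚ 4 * X * S) (0≤-* (0≤-* (0≤fromℕℚ 4) (0≤fromℕℚ x)) (0≤goodSum x)) (∑-rc²≤2 x))))))
        (≤-reflexive (sym (∑-*ˡ (fromℕℚ 2 * X) (1⋯ x) _))))
      -- 18 = 2 · 4 · 2 + 2. The first product joins the factor 2 of `log≤`, Chebyshev's 4 and the
      -- bound 2 for the sum of `1/s²`; the last 2 comes from `c² ≤ x / t`.
      (≤-reflexive (solve 2 (λ X S → con (fromℕℚ 2) :* (con (fromℕℚ 4) :* X :* S :* con (fromℕℚ 2)) :+ con (fromℕℚ 2) :* X :* S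
        := con (fromℕℚ 18) :* X :* S) refl X S)))))
      where
      L : ℕ → ℚ
      L t = ∑[ s ∈ 1⋯ x ] (α t * ind (s ℕ.* s ℕ.* t ℕ.≤? x) * ℓ t)
      termwise : ∀ t → 1 ℕ.≤ t × t ℕ.≤ x →
        fromℕℚ K * ∑[ s ∈ 1⋯ x ] (α t * ind (s ℕ.* s ℕ.* t ℕ.≤? x)) ≤ fromℕℚ 2 * L t + fromℕℚ 2 * X * (α t * rc t)
      termwise t@(suc _) (1≤t , t≤x) = ≤-trans
        (≤-reflexive (trans (cong (fromℕℚ K *_) Σ≡) (*-comm (fromℕℚ K) (α t * c))))
        (≤-trans (*-monoˡ (α t * c) 0≤αc (log≤ {K} t 2^K≤x 1≤t t≤x))
        (≤-trans (≤-reflexive (solve 4 (λ a c l w → a :* c :* (w :* l :+ w :* c) := w :* (a :* c :* l) :+ w :* (a :* (c :* c))) refl (α t) c (ℓ t) (fromℕℚ 2)))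
        (+-mono-≤ (≤-reflexive (cong (fromℕℚ 2 *_) (trans (cong (_* ℓ t) (sym Σ≡)) (∑-*ʳ (ℓ t) (1⋯ x) _))))
          (≤-trans (*-monoˡ (fromℕℚ 2) (0≤fromℕℚ 2) (*-monoˡ (α t) (0≤α t) c²≤))
            (≤-reflexive (solve 4 (λ w X a r → w :* (a :* (X :* r)) := w :* X :* (a :* r)) refl (fromℕℚ 2) X (α t) (rc t)))))))
        where
        c = fromℕℚ (root t)
        0≤αc : 0ℚ ≤ α t * c
        0≤αc = 0≤-* (0≤α t) (0≤fromℕℚ (root t))
        Σ≡ : ∑[ s ∈ 1⋯ x ] (α t * ind (s ℕ.* s ℕ.* t ℕ.≤? x)) ≡ α t * c
        Σ≡ = trans (sym (∑-*ˡ (α t) (1⋯ x) _)) (cong (α t *_) (∑-squares t))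
        c²≤ : c * c ≤ X * rc t
        c²≤ = ≤-trans (≤-reflexive (sym (fromℕℚ-* (root t) (root t))))
          (≤⇒≤*rc {root t ℕ.* root t} {t} {x} 1≤t (proj₁ (≤/⇔ {root t ℕ.* root t} {x} {t}) (isqrt-lower (x ℕ./ t))))

    0≤goodSquares : 0ℚ ≤ goodSquares
    0≤goodSquares = 0≤∑ (1⋯ x) λ {t} _ → 0≤∑ (1⋯ x) λ {s} _ → 0≤-* (0≤α t) (0≤ind (s ℕ.* s ℕ.* t ℕ.≤? x))

  -- For `x = 2 ^ K` the sum `H (x²)` is at most `2K + 1 ≤ 3K`, which bounds `S²`. Squaring
  -- `K D ≤ 18 x S` and cancelling one `K` gives the constant 972 = 18² · 3.
  goodSquares-bound : ∀ {K} → 1 ℕ.≤ K → let x = 2 ℕ.^ K in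
    fromℕℚ K * (Counting.goodSquares x * Counting.goodSquares x) ≤ fromℕℚ 972 * (fromℕℚ x * fromℕℚ x)
  goodSquares-bound {K@(suc K-1)} 1≤K = ≤-scale κ (0<fromℕℚ-suc K-1) (≤-trans
    (≤-reflexive (solve 2 (λ k d → k :* (d :* d) :* k := k :* d :* (k :* d)) refl κ D))
    (≤-trans (sq-mono-≤ (0≤-* (0≤fromℕℚ K) (Counting.0≤goodSquares x)) (Counting.log-*-goodSquares≤ x {K} ℕP.≤-refl))
    (≤-trans (≤-reflexive (solve 2 (λ x s → con (fromℕℚ 18) :* x :* s :* (con (fromℕℚ 18) :* x :* s) := con (fromℕℚ 324) :* (x :* x) :* (s :* s)) refl X S))
    (≤-trans (*-monoˡ (fromℕℚ 324 * (X * X)) (0≤-* (0≤fromℕℚ 324) (0≤-* (0≤fromℕℚ x) (0≤fromℕℚ x))) S²≤)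
    (≤-reflexive (solve 2 (λ x k → con (fromℕℚ 324) :* (x :* x) :* (con (fromℕℚ 3) :* k) := con (fromℕℚ 972) :* (x :* x) :* k) refl X κ))))))
    where
    x = 2 ℕ.^ K
    κ = fromℕℚ K
    D = Counting.goodSquares x
    X = fromℕℚ x
    S = goodSum x
    S²≤ : S * S ≤ fromℕℚ 3 * κ
    S²≤ = ≤-trans (goodSum² x) (≤-trans
      (≤-reflexive (cong H (trans (sym (ℕP.^-distribˡ-+-* 2 K K)) (sym (ℕP.*-identityʳ (2 ℕ.^ (K ℕ.+ K)))))))
      (≤-trans (H-2^ (K ℕ.+ K) {1} (s≤s z≤n)) (≤-trans
      (≤-reflexive (sym (fromℕℚ-+ (K ℕ.+ K) 1)))
      (≤-trans (fromℕℚ-≤ (ℕP.≤-trans (ℕP.+-monoʳ-≤ (K ℕ.+ K) 1≤K) (ℕP.≤-reflexive (triple K))))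
        (≤-reflexive (fromℕℚ-* 3 K))))))
      where
      triple : ∀ k → k ℕ.+ k ℕ.+ k ≡ 3 ℕ.* k
      triple = ℕR.solve-∀

  -- Sums of two squares

  parity : ∀ n → ∃[ k ] (n ≡ 2 ℕ.* k ⊎ n ≡ 1 ℕ.+ 2 ℕ.* k)
  parity zero = 0 , inj₁ refl
  parity (suc n) with parity n
  ... | k , inj₁ refl = k , inj₂ refl
  ... | k , inj₂ refl = suc k , inj₁ (sym (ℕP.*-suc 2 k))

  χ-odd : ∀ k → χ (1 ℕ.+ 2 ℕ.* k) ≢ 0ℚ
  χ-odd 0 ()
  χ-odd 1 ()
  χ-odd (suc (suc k)) e = χ-odd k (trans (cong (λ z → χ (suc z)) (sym (ℕP.*-distribˡ-+ 2 2 k))) e)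

  χ-4*²+1 : ∀ k → χ (2 ℕ.* k ℕ.* (2 ℕ.* k) ℕ.+ 1) ≡ 1ℚ
  χ-4*²+1 k = trans (cong χ (rearrange k)) (χ-periodic (k ℕ.* k) 1)
    where
    rearrange : ∀ k → 2 ℕ.* k ℕ.* (2 ℕ.* k) ℕ.+ 1 ≡ k ℕ.* k ℕ.* 4 ℕ.+ 1
    rearrange = ℕR.solve-∀

  χ-odd-∣ : ∀ {d n} → d ∣ n → χ n ≢ 0ℚ → χ d ≢ 0ℚ
  χ-odd-∣ {d} (divides q refl) χn≢0 χd≡0 = χn≢0 (trans (χ-* q d) (trans (cong (χ q *_) χd≡0) (*-zeroʳ (χ q))))

  ∣-reflect : ∀ {m w r} → w ℕ.+ r ≡ m → m ∣ r ℕ.* r ℕ.+ 1 → m ∣ w ℕ.* w ℕ.+ 1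
  ∣-reflect {m} {w} {r} refl h = ∣m+n∣m⇒∣n
    (subst (m ∣_) (rearrange w r) (∣m∣n⇒∣m+n h (n∣m*n w)))
    (n∣m*n r)
    where
    rearrange : ∀ w r → r ℕ.* r ℕ.+ 1 ℕ.+ w ℕ.* (w ℕ.+ r) ≡ r ℕ.* (w ℕ.+ r) ℕ.+ (w ℕ.* w ℕ.+ 1)
    rearrange = ℕR.solve-∀

  ∣-reduce : ∀ {m} z .{{_ : ℕ.NonZero m}} → m ∣ z ℕ.* z ℕ.+ 1 → m ∣ (z ℕ.% m) ℕ.* (z ℕ.% m) ℕ.+ 1
  ∣-reduce {m} z h = ∣m+n∣m⇒∣n
    (subst (m ∣_) (trans (cong (λ k → k ℕ.* k ℕ.+ 1) (m≡m%n+[m/n]*n z m)) (rearrange (z ℕ.% m) (z ℕ./ m) m)) h)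
    (n∣m*n (2 ℕ.* (z ℕ.% m) ℕ.* (z ℕ./ m) ℕ.+ (z ℕ./ m) ℕ.* (z ℕ./ m) ℕ.* m))
    where
    rearrange : ∀ r q m → (r ℕ.+ q ℕ.* m) ℕ.* (r ℕ.+ q ℕ.* m) ℕ.+ 1 ≡
      (2 ℕ.* r ℕ.* q ℕ.+ q ℕ.* q ℕ.* m) ℕ.* m ℕ.+ (r ℕ.* r ℕ.+ 1)
    rearrange = ℕR.solve-∀

  -- As `m` is odd, one of `r` and `m - r` is even, where `r` is the residue of `z`. For an even
  -- root `w` the number `w² + 1` is 1 modulo 4, which determines the class of the cofactor in the
  -- descent.
  evenRoot : ∀ {m} z → χ m ≡ - 1ℚ → m ∣ z ℕ.* z ℕ.+ 1 → ∃[ k ] 2 ℕ.* k ℕ.< m × m ∣ 2 ℕ.* k ℕ.* (2 ℕ.* k) ℕ.+ 1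
  evenRoot {zero} z () h
  evenRoot {m@(suc _)} z χm h with parity (z ℕ.% m) | parity m
  ... | k , inj₁ e | _ = k , subst (ℕ._< m) e (m%n<n z m) , subst (λ r → m ∣ r ℕ.* r ℕ.+ 1) e (∣-reduce z h)
  ... | k , inj₂ e | j , inj₁ m≡2j with trans (sym χm) (trans (cong χ m≡2j) (χ-double j))
  ...   | ()
  evenRoot {m@(suc _)} z χm h | k , inj₂ e | j , inj₂ m≡1+2j =
    j ℕ.∸ k , w<m , ∣-reflect {w = 2 ℕ.* (j ℕ.∸ k)} {r = 1 ℕ.+ 2 ℕ.* k} w+r≡m (subst (λ r → m ∣ r ℕ.* r ℕ.+ 1) e (∣-reduce z h))
    where
    k≤j : k ℕ.≤ j
    k≤j = ℕP.*-cancelˡ-≤ 2 (ℕP.≤-pred (subst₂ ℕ._≤_ e m≡1+2j (ℕP.<⇒≤ (m%n<n z m))))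
    w+r≡m : 2 ℕ.* (j ℕ.∸ k) ℕ.+ (1 ℕ.+ 2 ℕ.* k) ≡ m
    w+r≡m = trans (rearrange (j ℕ.∸ k) k) (trans (cong (λ i → 1 ℕ.+ 2 ℕ.* i) (ℕP.m∸n+n≡m k≤j)) (sym m≡1+2j))
      where
      rearrange : ∀ a k → 2 ℕ.* a ℕ.+ (1 ℕ.+ 2 ℕ.* k) ≡ 1 ℕ.+ 2 ℕ.* (a ℕ.+ k)
      rearrange = ℕR.solve-∀
    w<m : 2 ℕ.* (j ℕ.∸ k) ℕ.< m
    w<m = subst (2 ℕ.* (j ℕ.∸ k) ℕ.<_) w+r≡m (ℕP.m<m+n (2 ℕ.* (j ℕ.∸ k)) (s≤s z≤n))

  -- Descent: if m ≡ 3 (mod 4) divides w² + 1 with w < m even, then so does the cofactor, which is smaller and again 3 (mod 4).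
  χ≡-1⇒∤z²+1 : ∀ m → χ m ≡ - 1ℚ → ∀ z → ¬ m ∣ z ℕ.* z ℕ.+ 1
  χ≡-1⇒∤z²+1 = <-rec _ go
    where
    go : ∀ m → (∀ {m′} → m′ ℕ.< m → χ m′ ≡ - 1ℚ → ∀ z → ¬ m′ ∣ z ℕ.* z ℕ.+ 1) →
      χ m ≡ - 1ℚ → ∀ z → ¬ m ∣ z ℕ.* z ℕ.+ 1
    go 0 rec () z h
    go 1 rec () z h
    go m@(suc (suc _)) rec χm z h with evenRoot {m} z χm h
    ... | k , w<m , divides m′ eq = rec m′<m χm′ w (divides m (trans eq (ℕP.*-comm m′ m)))
      where
      w = 2 ℕ.* k
      m′<m : m′ ℕ.< m
      m′<m = ℕP.*-cancelʳ-< m m′ m (ℕP.≤-<-trans (ℕP.≤-reflexive (sym eq))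
        (ℕP.≤-<-trans (ℕP.+-monoˡ-≤ 1 (ℕP.*-monoʳ-≤ w (ℕP.<⇒≤ w<m)))
        (ℕP.<-≤-trans (ℕP.+-monoʳ-< (w ℕ.* m) {1} {m} (s≤s (s≤s z≤n)))
          (ℕP.≤-trans (ℕP.≤-reflexive (ℕP.+-comm (w ℕ.* m) m)) (ℕP.*-monoˡ-≤ m w<m)))))
      χm′ : χ m′ ≡ - 1ℚ
      χm′ = trans (solve 1 (λ a → a := :- (a :* :- con 1ℚ)) refl (χ m′))
        (cong -_ (trans (cong (χ m′ *_) (sym χm)) (trans (sym (χ-* m′ m)) (trans (cong χ (sym eq)) (χ-4*²+1 k)))))

  coprime-∣²+² : ∀ {d u v} → Coprime u v → d ∣ u ℕ.* u ℕ.+ v ℕ.* v → Coprime d v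
  coprime-∣²+² {d} {u} {v} u⊥v h {i} (i∣d , i∣v) =
    u⊥v (coprime-divisor i⊥u i∣u² , i∣v)
    where
    i∣u² : i ∣ u ℕ.* u
    i∣u² = ∣m+n∣m⇒∣n (subst (i ∣_) (ℕP.+-comm (u ℕ.* u) (v ℕ.* v)) (∣-trans i∣d h)) (∣m⇒∣m*n v i∣v)
    i⊥u : Coprime i u
    i⊥u (j∣i , j∣u) = u⊥v (j∣u , ∣-trans j∣i i∣v)

  -- Modulo `d` the number `v` is invertible, and `z` is `u` times an inverse of `v`, up to sign.
  -- Over the naturals Bézout's identity has two forms: `y` is the negative of an inverse in the
  -- first and an inverse in the second.
  ∣²+²⇒∣z²+1 : ∀ {d u v} → Coprime u v → d ∣ u ℕ.* u ℕ.+ v ℕ.* v → ∃[ z ] d ∣ z ℕ.* z ℕ.+ 1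
  ∣²+²⇒∣z²+1 {d} {u} {v} u⊥v h with coprime-Bézout (coprime-∣²+² u⊥v h)
  ... | Bézout.Identity.+- x y eq = u ℕ.* y , ∣m+n∣m⇒∣n
    (subst (d ∣_) (rearrange u v y) (∣m∣n⇒∣m+n (∣n⇒∣m*n (y ℕ.* y) h) (subst (d ∣_) (sym eq) (n∣m*n x))))
    (∣n⇒∣m*n (y ℕ.* v) (subst (d ∣_) (sym eq) (n∣m*n x)))
    where
    rearrange : ∀ u v y → y ℕ.* y ℕ.* (u ℕ.* u ℕ.+ v ℕ.* v) ℕ.+ (1 ℕ.+ y ℕ.* v) ≡
      y ℕ.* v ℕ.* (1 ℕ.+ y ℕ.* v) ℕ.+ (u ℕ.* y ℕ.* (u ℕ.* y) ℕ.+ 1)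
    rearrange = ℕR.solve-∀
  ... | Bézout.Identity.-+ x y eq = u ℕ.* y , ∣m+n∣m⇒∣n
    (subst (d ∣_) (trans (split u v y) (trans (cong (λ w → u ℕ.* y ℕ.* (u ℕ.* y) ℕ.+ w ℕ.* w) (sym eq)) (rearrange (u ℕ.* y) x d)))
      (∣n⇒∣m*n (y ℕ.* y) h))
    (n∣m*n (x ℕ.* (2 ℕ.+ x ℕ.* d)))
    where
    split : ∀ u v y → y ℕ.* y ℕ.* (u ℕ.* u ℕ.+ v ℕ.* v) ≡ u ℕ.* y ℕ.* (u ℕ.* y) ℕ.+ y ℕ.* v ℕ.* (y ℕ.* v)
    split = ℕR.solve-∀
    rearrange : ∀ z x d → z ℕ.* z ℕ.+ (1 ℕ.+ x ℕ.* d) ℕ.* (1 ℕ.+ x ℕ.* d) ≡ x ℕ.* (2 ℕ.+ x ℕ.* d) ℕ.* d ℕ.+ (z ℕ.* z ℕ.+ 1)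
    rearrange = ℕR.solve-∀

  oddDivisor-²+² : ∀ {d u v} → Coprime u v → d ∣ u ℕ.* u ℕ.+ v ℕ.* v → χ d ≢ 0ℚ → χ d ≡ 1ℚ
  oddDivisor-²+² {d} u⊥v h χd≢0 with χ-values d
  ... | inj₁ e        = e
  ... | inj₂ (inj₁ e) = ⊥-elim (χd≢0 e)
  ... | inj₂ (inj₂ e) with ∣²+²⇒∣z²+1 u⊥v h
  ...   | z , d∣ = ⊥-elim (χ≡-1⇒∤z²+1 d e z d∣)

  good-²+² : ∀ {t u v} → Coprime u v → t ∣ u ℕ.* u ℕ.+ v ℕ.* v → χ t ≢ 0ℚ → Good t
  good-²+² u⊥v h χt≢0 = good⁺ λ d∣t → oddDivisor-²+² u⊥v (∣-trans d∣t h) (χ-odd-∣ d∣t χt≢0)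

  -- If exactly one of `u`, `v` is even, the sum is odd and itself good. If both are odd, the sum is
  -- 2 modulo 4 and its half is odd, hence good.
  coprime-²+² : ∀ {u v} → Coprime u v → ∃[ t ] Good t × (u ℕ.* u ℕ.+ v ℕ.* v ≡ t ⊎ u ℕ.* u ℕ.+ v ℕ.* v ≡ 2 ℕ.* t)
  coprime-²+² {u} {v} u⊥v with parity u | parity v
  ... | a , inj₁ refl | b , inj₁ refl with u⊥v (m∣m*n {2} a , m∣m*n {2} b)
  ...   | ()
  coprime-²+² {u} {v} u⊥v | a , inj₁ refl | b , inj₂ refl = u ℕ.* u ℕ.+ v ℕ.* v ,
    good-²+² u⊥v ∣-refl (λ e → χ-odd (2 ℕ.* a ℕ.* a ℕ.+ 2 ℕ.* b ℕ.* b ℕ.+ 2 ℕ.* b) (trans (cong χ (sym (rearrange a b))) e)) , inj₁ refl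
    where
    rearrange : ∀ a b → 2 ℕ.* a ℕ.* (2 ℕ.* a) ℕ.+ (1 ℕ.+ 2 ℕ.* b) ℕ.* (1 ℕ.+ 2 ℕ.* b) ≡
      1 ℕ.+ 2 ℕ.* (2 ℕ.* a ℕ.* a ℕ.+ 2 ℕ.* b ℕ.* b ℕ.+ 2 ℕ.* b)
    rearrange = ℕR.solve-∀
  coprime-²+² {u} {v} u⊥v | a , inj₂ refl | b , inj₁ refl = u ℕ.* u ℕ.+ v ℕ.* v ,
    good-²+² u⊥v ∣-refl (λ e → χ-odd (2 ℕ.* a ℕ.* a ℕ.+ 2 ℕ.* a ℕ.+ 2 ℕ.* b ℕ.* b) (trans (cong χ (sym (rearrange a b))) e)) , inj₁ refl
    where
    rearrange : ∀ a b → (1 ℕ.+ 2 ℕ.* a) ℕ.* (1 ℕ.+ 2 ℕ.* a) ℕ.+ 2 ℕ.* b ℕ.* (2 ℕ.* b) ≡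
      1 ℕ.+ 2 ℕ.* (2 ℕ.* a ℕ.* a ℕ.+ 2 ℕ.* a ℕ.+ 2 ℕ.* b ℕ.* b)
    rearrange = ℕR.solve-∀
  coprime-²+² {u} {v} u⊥v | a , inj₂ refl | b , inj₂ refl = t ,
    good-²+² u⊥v (divides 2 (rearrange a b)) (χ-odd k) , inj₂ (rearrange a b)
    where
    k = a ℕ.* a ℕ.+ a ℕ.+ b ℕ.* b ℕ.+ b
    t = 1 ℕ.+ 2 ℕ.* k
    rearrange : ∀ a b → (1 ℕ.+ 2 ℕ.* a) ℕ.* (1 ℕ.+ 2 ℕ.* a) ℕ.+ (1 ℕ.+ 2 ℕ.* b) ℕ.* (1 ℕ.+ 2 ℕ.* b) ≡
      2 ℕ.* (1 ℕ.+ 2 ℕ.* (a ℕ.* a ℕ.+ a ℕ.+ b ℕ.* b ℕ.+ b))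
    rearrange = ℕR.solve-∀

  ²+²-factor : ∀ u v → 1 ℕ.≤ u ℕ.* u ℕ.+ v ℕ.* v → ∃₂ λ s t → Good t ×
    (u ℕ.* u ℕ.+ v ℕ.* v ≡ s ℕ.* s ℕ.* t ⊎ u ℕ.* u ℕ.+ v ℕ.* v ≡ s ℕ.* s ℕ.* (2 ℕ.* t))
  ²+²-factor u v 1≤ = g , proj₁ factored , proj₁ (proj₂ factored) , result (proj₂ (proj₂ factored))
    where
    g = gcd u v
    instance
      g≢0 : ℕ.NonZero g
      g≢0 = ℕ.≢-nonZero λ g≡0 → ℕP.<⇒≢ 1≤ (sym (cong₂ (λ a b → a ℕ.* a ℕ.+ b ℕ.* b)
        (gcd[m,n]≡0⇒m≡0 {u} g≡0) (gcd[m,n]≡0⇒n≡0 u g≡0)))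
    factored = coprime-²+² (coprime-/gcd u v)
    t = proj₁ factored
    n′ = (u ℕ./ g) ℕ.* (u ℕ./ g) ℕ.+ (v ℕ./ g) ℕ.* (v ℕ./ g)
    eq : u ℕ.* u ℕ.+ v ℕ.* v ≡ g ℕ.* g ℕ.* n′
    eq = trans (cong₂ (λ a b → a ℕ.* a ℕ.+ b ℕ.* b) (sym (m/n*n≡m (gcd[m,n]∣m u v))) (sym (m/n*n≡m (gcd[m,n]∣n u v))))
      (rearrange (u ℕ./ g) (v ℕ./ g) g)
      where
      rearrange : ∀ a b g → a ℕ.* g ℕ.* (a ℕ.* g) ℕ.+ b ℕ.* g ℕ.* (b ℕ.* g) ≡ g ℕ.* g ℕ.* (a ℕ.* a ℕ.+ b ℕ.* b)
      rearrange = ℕR.solve-∀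
    result : n′ ≡ t ⊎ n′ ≡ 2 ℕ.* t →
      u ℕ.* u ℕ.+ v ℕ.* v ≡ g ℕ.* g ℕ.* t ⊎ u ℕ.* u ℕ.+ v ℕ.* v ≡ g ℕ.* g ℕ.* (2 ℕ.* t)
    result (inj₁ e) = inj₁ (trans eq (cong (g ℕ.* g ℕ.*_) e))
    result (inj₂ e) = inj₂ (trans eq (cong (g ℕ.* g ℕ.*_) e))

  -- Counting distances

  ∑-≥-term : ∀ {A : Set} (xs : List A) {f : A → ℚ} → (∀ {x} → x ∈ xs → 0ℚ ≤ f x) → ∀ {a} → a ∈ xs → f a ≤ ∑ xs f
  ∑-≥-term (x ∷ xs) {f} h (here refl) = nonNeg⇒≤ (∑ xs f) (0≤∑ xs λ y∈ → h (there y∈)) refl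
  ∑-≥-term (x ∷ xs) {f} h (there a∈)  = ≤-trans (∑-≥-term xs (λ y∈ → h (there y∈)) a∈)
    (nonNeg⇒≤ (f x) (h (here refl)) (+-comm (∑ xs f) (f x)))

  elements : ∀ {n} → Subset n → List (Fin n)
  elements []            = []
  elements (inside  ∷ Q) = zero ∷ map suc (elements Q)
  elements (outside ∷ Q) = map suc (elements Q)

  elements-unique : ∀ {n} (Q : Subset n) → Unique (elements Q)
  elements-unique []            = []
  elements-unique (inside  ∷ Q) =
    All.tabulate (λ { x∈ refl → zero∉ (elements Q) x∈ }) ∷ Unique.map⁺ suc-injective (elements-unique Q)
    where
    zero∉ : ∀ {n} (xs : List (Fin n)) → ¬ zero ∈ map Fin.suc xs
    zero∉ (_ ∷ xs) (there 0∈) = zero∉ xs 0∈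
  elements-unique (outside ∷ Q) = Unique.map⁺ suc-injective (elements-unique Q)

  elements-⊆ : ∀ {n} (Q : Subset n) {i} → i ∈ elements Q → i Subset.∈ Q
  elements-⊆ (inside  ∷ Q) (here refl) = here
  elements-⊆ (inside  ∷ Q) (there i∈) with ∈-map⁻ suc i∈
  ... | j , j∈ , refl = there (elements-⊆ Q j∈)
  elements-⊆ (outside ∷ Q) i∈ with ∈-map⁻ suc i∈
  ... | j , j∈ , refl = there (elements-⊆ Q j∈)

  ∑-elements-1 : ∀ {n} (Q : Subset n) → ∑[ i ∈ elements Q ] 1ℚ ≡ fromℕℚ Subset.∣ Q ∣
  ∑-elements-1 []            = refl
  ∑-elements-1 (inside  ∷ Q) = trans (cong (1ℚ +_) (trans (∑-map suc (elements Q) (λ _ → 1ℚ)) (∑-elements-1 Q)))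
    (sym (fromℕℚ-suc Subset.∣ Q ∣))
  ∑-elements-1 (outside ∷ Q) = trans (∑-map suc (elements Q) (λ _ → 1ℚ)) (∑-elements-1 Q)

  good-1 : Good 1
  good-1 = good⁺ λ d∣1 → cong χ (∣1⇒≡1 d∣1)

  -- The pair `s = t = 1` is counted. This lower bound later absorbs the lower-order terms in the
  -- estimate of the size of `Q`.
  1≤goodSquares : ∀ {x} → 1 ℕ.≤ x → 1ℚ ≤ Counting.goodSquares x
  1≤goodSquares {x} 1≤x = ≤-trans
    (≤-reflexive (sym (trans (cong₂ _*_ (ind-yes (good? 1) good-1) (ind-yes (1 ℕ.≤? x) 1≤x)) (*-identityˡ 1ℚ))))
    (≤-trans (∑-≥-term (1⋯ x) {f = f 1} (λ {s} _ → 0≤f 1 s) 1∈)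
      (∑-≥-term (1⋯ x) {f = λ t → ∑ (1⋯ x) (f t)} (λ {t} _ → 0≤∑ (1⋯ x) λ {s} _ → 0≤f t s) 1∈))
    where
    1∈ : 1 ∈ 1⋯ x
    1∈ = ∈-range⁺ (s≤s z≤n) 1≤x
    f : ℕ → ℕ → ℚ
    f t s = α t * ind (s ℕ.* s ℕ.* t ℕ.≤? x)
    0≤f : ∀ t s → 0ℚ ≤ f t s
    0≤f t s = 0≤-* (0≤α t) (0≤ind (s ℕ.* s ℕ.* t ℕ.≤? x))

  -- The grid enters only through the labels `n`, its squared distances. Labels determine unordered
  -- pairs, so `up` selects one ordering of each pair; then no value is taken twice.
  module Edges {N : ℕ} (Q : List (Fin N)) (Q-unique : Unique Q) (x : ℕ) (n : Fin N × Fin N → ℕ)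
    (n-range : ∀ {i j} → i ≢ j → 1 ℕ.≤ n (i , j) × n (i , j) ℕ.≤ x)
    (n-factor : ∀ {i j} → i ≢ j → ∃₂ λ s t → Good t × (n (i , j) ≡ s ℕ.* s ℕ.* t ⊎ n (i , j) ≡ s ℕ.* s ℕ.* (2 ℕ.* t)))
    (n-injective : ∀ {i j k l} → i ∈ Q → j ∈ Q → k ∈ Q → l ∈ Q → i ≢ j → k ≢ l → n (i , j) ≡ n (k , l) →
      (i ≡ k × j ≡ l) ⊎ (i ≡ l × j ≡ k))
    where

    pairs : List (Fin N × Fin N)
    pairs = cartesianProduct Q Q

    up : Fin N × Fin N → ℚ
    up (i , j) = ind (toℕ i ℕ.<? toℕ j)

    0≤up : ∀ e → 0ℚ ≤ up e
    0≤up (i , j) = 0≤ind (toℕ i ℕ.<? toℕ j)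

    hits : ℕ → ℚ
    hits c = ∑[ e ∈ pairs ] (up e * ind (c ℕ.≟ n e))

    <⇒≢ᶠ : ∀ {i j : Fin N} → toℕ i ℕ.< toℕ j → i ≢ j
    <⇒≢ᶠ i<j refl = ℕP.<-irrefl refl i<j

    hits≤ : ∀ c → hits c ≤ ind (c ℕ.≤? x)
    hits≤ c with c ℕ.≤? x
    ... | yes _ = ∑-atMostOne (λ e → up e * ind (c ℕ.≟ n e)) (Unique.cartesianProduct⁺ Q-unique Q-unique)
      (λ {e} _ → values e) (λ {e} {e′} → unique e e′)
      where
      values : ∀ e → up e * ind (c ℕ.≟ n e) ≡ 0ℚ ⊎ up e * ind (c ℕ.≟ n e) ≡ 1ℚ
      values (i , j) with toℕ i ℕ.<? toℕ j | c ℕ.≟ n (i , j)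
      ... | yes _ | yes _ = inj₂ (*-identityˡ 1ℚ)
      ... | yes _ | no  _ = inj₁ (*-zeroʳ 1ℚ)
      ... | no  _ | yes _ = inj₁ (*-zeroˡ 1ℚ)
      ... | no  _ | no  _ = inj₁ (*-zeroˡ 0ℚ)
      0≢1 : 0ℚ ≢ 1ℚ
      0≢1 ()
      holds : ∀ i j → up (i , j) * ind (c ℕ.≟ n (i , j)) ≡ 1ℚ → toℕ i ℕ.< toℕ j × c ≡ n (i , j)
      holds i j e with toℕ i ℕ.<? toℕ j | c ℕ.≟ n (i , j)
      ... | yes i<j | yes c≡ = i<j , c≡
      ... | yes _ | no  _ = ⊥-elim (0≢1 (trans (sym (*-zeroʳ 1ℚ)) e))
      ... | no  _ | d = ⊥-elim (0≢1 (trans (sym (*-zeroˡ (ind d))) e))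
      unique : ∀ e e′ → e ∈ pairs → e′ ∈ pairs → up e * ind (c ℕ.≟ n e) ≡ 1ℚ → up e′ * ind (c ℕ.≟ n e′) ≡ 1ℚ → e ≡ e′
      unique (i , j) (k , l) e∈ e′∈ h h′ with holds i j h | holds k l h′ | ∈-cartesianProduct⁻ Q Q e∈ | ∈-cartesianProduct⁻ Q Q e′∈
      ... | i<j , c≡ | k<l , c≡′ | i∈ , j∈ | k∈ , l∈ with n-injective i∈ j∈ k∈ l∈ (<⇒≢ᶠ i<j) (<⇒≢ᶠ k<l) (trans (sym c≡) c≡′)
      ...   | inj₁ (refl , refl) = refl
      ...   | inj₂ (refl , refl) = ⊥-elim (ℕP.<-asym i<j k<l)
    ... | no c≰x = ≤-reflexive (∑-0 pairs λ { {i , j} _ → zero-term i j })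
      where
      zero-term : ∀ i j → up (i , j) * ind (c ℕ.≟ n (i , j)) ≡ 0ℚ
      zero-term i j with toℕ i ℕ.<? toℕ j
      ... | yes i<j = trans (*-identityˡ _) (ind-no (c ℕ.≟ n (i , j)) λ { refl → c≰x (proj₂ (n-range (<⇒≢ᶠ i<j))) })
      ... | no  _   = *-zeroˡ (ind (c ℕ.≟ n (i , j)))

    open Counting x using (goodSquares)

    representations : ℕ → ℚ
    representations m =
      ∑[ t ∈ 1⋯ x ] ∑[ s ∈ 1⋯ x ] (α t * (ind (s ℕ.* s ℕ.* t ℕ.≟ m) + ind (s ℕ.* s ℕ.* (2 ℕ.* t) ℕ.≟ m)))

    1≤representations : ∀ {m s t} → 1 ℕ.≤ m → m ℕ.≤ x → Good t →
      m ≡ s ℕ.* s ℕ.* t ⊎ m ≡ s ℕ.* s ℕ.* (2 ℕ.* t) → 1ℚ ≤ representations m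
    1≤representations {m} {s} {t} 1≤m m≤x good h = ≤-trans (1≤f h)
      (≤-trans (∑-≥-term (1⋯ x) {f = f t} (λ {s} _ → 0≤f t s) (divisor∈ s∣m))
        (∑-≥-term (1⋯ x) {f = λ t → ∑ (1⋯ x) (f t)} (λ {t} _ → 0≤∑ (1⋯ x) λ {s} _ → 0≤f t s) (divisor∈ t∣m)))
      where
      f : ℕ → ℕ → ℚ
      f t s = α t * (ind (s ℕ.* s ℕ.* t ℕ.≟ m) + ind (s ℕ.* s ℕ.* (2 ℕ.* t) ℕ.≟ m))
      0≤f : ∀ t s → 0ℚ ≤ f t s
      0≤f t s = 0≤-* (0≤α t) (0≤-+ (0≤ind (s ℕ.* s ℕ.* t ℕ.≟ m)) (0≤ind (s ℕ.* s ℕ.* (2 ℕ.* t) ℕ.≟ m)))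
      divisor∈ : ∀ {d} → d ∣ m → d ∈ 1⋯ x
      divisor∈ d∣m = ∈-range⁺ (∣⇒1≤ 1≤m d∣m) (ℕP.≤-trans (∣⇒≤′ 1≤m d∣m) m≤x)
      ss : ∀ k → s ∣ s ℕ.* s ℕ.* k
      ss k = ∣m⇒∣m*n k (m∣m*n s)
      s∣m : s ∣ m
      s∣m = [ (λ e → subst (s ∣_) (sym e) (ss t)) , (λ e → subst (s ∣_) (sym e) (ss (2 ℕ.* t))) ]′ h
      t∣m : t ∣ m
      t∣m = [ (λ e → subst (t ∣_) (sym e) (n∣m*n (s ℕ.* s)))
            , (λ e → subst (t ∣_) (sym e) (∣n⇒∣m*n (s ℕ.* s) (n∣m*n 2))) ]′ h
      1≤f : m ≡ s ℕ.* s ℕ.* t ⊎ m ≡ s ℕ.* s ℕ.* (2 ℕ.* t) → 1ℚ ≤ f t s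
      1≤f h = ≤-trans (1≤sum h) (≤-reflexive (sym (ind-*-one (good? t) good)))
        where
        1≤sum : m ≡ s ℕ.* s ℕ.* t ⊎ m ≡ s ℕ.* s ℕ.* (2 ℕ.* t) →
          1ℚ ≤ ind (s ℕ.* s ℕ.* t ℕ.≟ m) + ind (s ℕ.* s ℕ.* (2 ℕ.* t) ℕ.≟ m)
        1≤sum (inj₁ e) = nonNeg⇒≤ (ind (s ℕ.* s ℕ.* (2 ℕ.* t) ℕ.≟ m)) (0≤ind (s ℕ.* s ℕ.* (2 ℕ.* t) ℕ.≟ m))
          (cong (_+ ind (s ℕ.* s ℕ.* (2 ℕ.* t) ℕ.≟ m)) (sym (ind-yes (s ℕ.* s ℕ.* t ℕ.≟ m) (sym e))))
        1≤sum (inj₂ e) = nonNeg⇒≤ (ind (s ℕ.* s ℕ.* t ℕ.≟ m)) (0≤ind (s ℕ.* s ℕ.* t ℕ.≟ m))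
          (trans (+-comm 1ℚ (ind (s ℕ.* s ℕ.* t ℕ.≟ m)))
            (cong (ind (s ℕ.* s ℕ.* t ℕ.≟ m) +_) (sym (ind-yes (s ℕ.* s ℕ.* (2 ℕ.* t) ℕ.≟ m) (sym e)))))

    edges : ℚ
    edges = ∑ pairs up

    -- Double counting: the label of every edge has a representation, while a pair `(s, t)` accounts
    -- for at most two edges, labelled `s² t` and `2 s² t`. Either label can occur only if
    -- `s² t ≤ x`.
    edges≤ : edges ≤ fromℕℚ 2 * goodSquares
    edges≤ = ≤-trans (∑-mono pairs λ { {i , j} _ → atEdge i j })
      (≤-trans (≤-reflexive (trans
        (∑-cong pairs λ e → trans (∑-*ˡ (up e) (1⋯ x) _) (∑-cong (1⋯ x) λ t → ∑-*ˡ (up e) (1⋯ x) _))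
        (trans (∑-swap pairs (1⋯ x) _) (∑-cong (1⋯ x) λ t → ∑-swap pairs (1⋯ x) _))))
      (≤-trans (∑-mono (1⋯ x) λ {t} _ → ∑-mono (1⋯ x) λ {s} _ → ≤-trans (≤-reflexive (regroup t s)) (termwise t s))
      (≤-reflexive (sym (trans (∑-*ˡ (fromℕℚ 2) (1⋯ x) _) (∑-cong (1⋯ x) λ t → ∑-*ˡ (fromℕℚ 2) (1⋯ x) _))))))
      where
      atEdge : ∀ i j → up (i , j) ≤ up (i , j) * representations (n (i , j))
      atEdge i j = ≤-trans (≤-reflexive (sym (*-identityʳ (up (i , j))))) (ind-*-mono (toℕ i ℕ.<? toℕ j) λ i<j →
        let i≢j = <⇒≢ᶠ i<j ; s , t , good , h = n-factor i≢j
        in 1≤representations {s = s} {t} (proj₁ (n-range i≢j)) (proj₂ (n-range i≢j)) good h)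
      A B : ℕ → ℕ → ℕ
      A t s = s ℕ.* s ℕ.* t
      B t s = s ℕ.* s ℕ.* (2 ℕ.* t)
      regroup : ∀ t s → ∑[ e ∈ pairs ] (up e * (α t * (ind (A t s ℕ.≟ n e) + ind (B t s ℕ.≟ n e)))) ≡
        α t * (hits (A t s) + hits (B t s))
      regroup t s = trans
        (∑-cong pairs λ e → solve 4 (λ u a b c → u :* (a :* (b :+ c)) := a :* (u :* b :+ u :* c)) refl
          (up e) (α t) (ind (A t s ℕ.≟ n e)) (ind (B t s ℕ.≟ n e)))
        (trans (sym (∑-*ˡ (α t) pairs _)) (cong (α t *_) (sym (∑-+ pairs _ _))))
      termwise : ∀ t s → α t * (hits (A t s) + hits (B t s)) ≤ fromℕℚ 2 * (α t * ind (A t s ℕ.≤? x))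
      termwise t s = ≤-trans (*-monoˡ (α t) (0≤α t) (+-mono-≤ (hits≤ (A t s))
          (≤-trans (hits≤ (B t s)) (ind-mono (B t s ℕ.≤? x) (A t s ℕ.≤? x)
            (ℕP.≤-trans (ℕP.*-monoʳ-≤ (s ℕ.* s) (ℕP.m≤m+n t (t ℕ.+ 0))))))))
        (≤-reflexive (solve 2 (λ a i → a :* (i :+ i) := con (fromℕℚ 2) :* (a :* i)) refl (α t) (ind (A t s ℕ.≤? x))))

    size : ℚ
    size = ∑[ i ∈ Q ] 1ℚ

    -- The ordered pairs of elements of `Q` are the diagonal together with every edge in both
    -- directions.
    size²≤ : size * size ≤ size + fromℕℚ 4 * goodSquares
    size²≤ = ≤-trans (≤-reflexive (∑-*-∑ Q Q (λ _ → 1ℚ) (λ _ → 1ℚ)))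
      (≤-trans (∑-mono Q λ {i} _ → ≤-trans (∑-mono Q λ {j} _ → trichotomy i j) (≤-reflexive (sym (trans
          (cong (_+ ∑[ j ∈ Q ] up (j , i)) (∑-+ Q (λ j → same i j) (λ j → up (i , j))))
          (∑-+ Q (λ j → same i j + up (i , j)) (λ j → up (j , i)))))))
      (≤-trans (≤-reflexive (sym (trans
          (cong (_+ ∑[ i ∈ Q ] ∑[ j ∈ Q ] up (j , i)) (∑-+ Q (λ i → ∑ Q (same i)) (λ i → ∑[ j ∈ Q ] up (i , j))))
          (∑-+ Q (λ i → ∑ Q (same i) + ∑[ j ∈ Q ] up (i , j)) (λ i → ∑[ j ∈ Q ] up (j , i))))))
      (≤-trans (+-mono-≤ (+-mono-≤ (≤-reflexive (∑-cong∈ Q diagonal)) (≤-trans (≤-reflexive (sym (∑-cartesian Q Q up))) edges≤))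
          (≤-trans (≤-reflexive (trans (∑-swap Q Q _) (sym (∑-cartesian Q Q up)))) edges≤))
      (≤-reflexive (solve 2 (λ k g → k :+ con (fromℕℚ 2) :* g :+ con (fromℕℚ 2) :* g := k :+ con (fromℕℚ 4) :* g) refl size goodSquares)))))
      where
      same : Fin N → Fin N → ℚ
      same i j = ind (i FinP.≟ j)
      diagonal : ∀ {i} → i ∈ Q → ∑ Q (same i) ≡ 1ℚ
      diagonal {i} i∈ = trans (∑-single (same i) Q-unique i∈ λ {j} _ j≢i → ind-no (i FinP.≟ j) λ i≡j → j≢i (sym i≡j))
        (ind-yes (i FinP.≟ i) refl)
      trichotomy : ∀ i j → 1ℚ * 1ℚ ≤ same i j + up (i , j) + up (j , i)
      trichotomy i j with ℕP.<-cmp (toℕ i) (toℕ j)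
      ... | tri< i<j _ _ = nonNeg⇒≤ (same i j + up (j , i)) (0≤-+ (0≤ind (i FinP.≟ j)) (0≤up (j , i)))
        (trans (cong (_+ (same i j + up (j , i))) (sym (ind-yes (toℕ i ℕ.<? toℕ j) i<j)))
          (solve 3 (λ a b c → a :+ (b :+ c) := b :+ a :+ c) refl (up (i , j)) (same i j) (up (j , i))))
      ... | tri≈ _ i≡j _ = nonNeg⇒≤ (up (i , j) + up (j , i)) (0≤-+ (0≤up (i , j)) (0≤up (j , i)))
        (trans (cong (_+ (up (i , j) + up (j , i))) (sym (ind-yes (i FinP.≟ j) (toℕ-injective i≡j))))
          (sym (+-assoc (same i j) (up (i , j)) (up (j , i)))))
      ... | tri> _ _ j<i = nonNeg⇒≤ (same i j + up (i , j)) (0≤-+ (0≤ind (i FinP.≟ j)) (0≤up (i , j)))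
        (trans (cong (_+ (same i j + up (i , j))) (sym (ind-yes (toℕ j ℕ.<? toℕ i) j<i)))
          (+-comm (up (j , i)) (same i j + up (i , j))))

    size⁴≤ : 1 ℕ.≤ x → size * size * (size * size) ≤ fromℕℚ 81 * (goodSquares * goodSquares)
    size⁴≤ 1≤x = ≤-trans (sq-mono-≤ (0≤-* 0≤k 0≤k) k²≤9G)
      (≤-reflexive (solve 1 (λ g → con (fromℕℚ 9) :* g :* (con (fromℕℚ 9) :* g) := con (fromℕℚ 81) :* (g :* g)) refl G))
      where
      k G : ℚ
      k = size
      G = goodSquares
      0≤k : 0ℚ ≤ k
      0≤k = 0≤∑ Q λ _ → 0≤1
      0≤sq : ∀ a → 0ℚ ≤ a * a
      0≤sq a with ≤-total 0ℚ a
      ... | inj₁ 0≤a = 0≤-* 0≤a 0≤a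
      ... | inj₂ a≤0 = subst (0ℚ ≤_) (solve 1 (λ a → (:- a) :* (:- a) := a :* a) refl a)
        (0≤-* {p = - a} {q = - a} (neg-antimono-≤ a≤0) (neg-antimono-≤ a≤0))
      -- 9G − k² = 2 (k + 4G − k²) + (k − 1)² + (G − 1)
      k²≤9G : k * k ≤ fromℕℚ 9 * G
      k²≤9G = nonNeg⇒≤ (fromℕℚ 2 * (k + fromℕℚ 4 * G - k * k) + (k - 1ℚ) * (k - 1ℚ) + (G - 1ℚ))
        (0≤-+ (0≤-+ (0≤-* (0≤fromℕℚ 2) (≤⇒nonNeg size²≤)) (0≤sq (k - 1ℚ))) (≤⇒nonNeg (1≤goodSquares 1≤x)))
        (solve 2 (λ k g → k :* k :+ (con (fromℕℚ 2) :* (k :+ con (fromℕℚ 4) :* g :- k :* k) :+ (k :- con 1ℚ) :* (k :- con 1ℚ) :+ (g :- con 1ℚ))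
          := con (fromℕℚ 9) :* g) refl k G)

  -- The grid

  ι-∣-∣² : ∀ a b → (fromℕℚ a - fromℕℚ b) * (fromℕℚ a - fromℕℚ b) ≡ fromℕℚ (ℕ.∣ a - b ∣ ℕ.* ℕ.∣ a - b ∣)
  ι-∣-∣² a b with ℕP.≤-total a b
  ... | inj₁ a≤b = trans
    (cong (λ z → (fromℕℚ a - z) * (fromℕℚ a - z)) (trans (cong fromℕℚ (sym (ℕP.m∸n+n≡m a≤b))) (fromℕℚ-+ (b ℕ.∸ a) a)))
    (trans (solve 2 (λ a c → (a :- (c :+ a)) :* (a :- (c :+ a)) := c :* c) refl (fromℕℚ a) (fromℕℚ (b ℕ.∸ a)))
    (trans (sym (fromℕℚ-* (b ℕ.∸ a) (b ℕ.∸ a))) (cong (λ k → fromℕℚ (k ℕ.* k)) (sym (ℕP.m≤n⇒∣m-n∣≡n∸m a≤b)))))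
  ... | inj₂ b≤a = trans
    (cong (λ z → (z - fromℕℚ b) * (z - fromℕℚ b)) (trans (cong fromℕℚ (sym (ℕP.m∸n+n≡m b≤a))) (fromℕℚ-+ (a ℕ.∸ b) b)))
    (trans (solve 2 (λ b c → (c :+ b :- b) :* (c :+ b :- b) := c :* c) refl (fromℕℚ b) (fromℕℚ (a ℕ.∸ b)))
    (trans (sym (fromℕℚ-* (a ℕ.∸ b) (a ℕ.∸ b))) (cong (λ k → fromℕℚ (k ℕ.* k)) (sym (ℕP.m≤n⇒∣n-m∣≡n∸m b≤a)))))

  seq-≡⇒≈ : ∀ x y → (∀ n → seq x n ≡ seq y n) → x ≈ᴿ y
  seq-≡⇒≈ x y h ε 0<ε = 0 , λ n _ → <⇒∣-∣< (near (h n)) (near (sym (h n)))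
    where
    near : ∀ {p q} → p ≡ q → p < q + ε
    near p≡q = pos⇒< ε 0<ε (cong (_+ ε) p≡q)

  1≤m²+n² : ∀ {m n} → 0 ℕ.< m ⊎ 0 ℕ.< n → 1 ℕ.≤ m ℕ.* m ℕ.+ n ℕ.* n
  1≤m²+n² {m} {n} (inj₁ 0<m) = ℕP.≤-trans (ℕP.*-mono-≤ 0<m 0<m) (ℕP.m≤m+n (m ℕ.* m) (n ℕ.* n))
  1≤m²+n² {m} {n} (inj₂ 0<n) = ℕP.≤-trans (ℕP.*-mono-≤ 0<n 0<n) (ℕP.m≤n+m (n ℕ.* n) (m ℕ.* m))

  -- The coordinates of a point are the two digits of its index in base `side`. As `N < side²`, both
  -- are at most `isqrt N`, whence squared distances are at most `2N`.
  module Grid (N : ℕ) where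

    side : ℕ
    side = suc (isqrt N)

    col row : Fin N → ℕ
    col i = toℕ i ℕ.% side
    row i = toℕ i ℕ./ side

    col≤ : ∀ i → col i ℕ.≤ isqrt N
    col≤ i = ℕP.≤-pred (m%n<n (toℕ i) side)

    row≤ : ∀ i → row i ℕ.≤ isqrt N
    row≤ i = ℕP.≤-pred (m<n*o⇒m/o<n (ℕP.<-trans (toℕ<n i) (isqrt-upper N)))

    col-row-injective : ∀ {i j} → col i ≡ col j → row i ≡ row j → i ≡ j
    col-row-injective {i} {j} c r = toℕ-injective (trans (m≡m%n+[m/n]*n (toℕ i) side)
      (trans (cong₂ (λ a b → a ℕ.+ b ℕ.* side) c r) (sym (m≡m%n+[m/n]*n (toℕ j) side))))

    grid : PointSet N
    grid = (λ i → fromℕ (col i) , fromℕ (row i)) ,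
      λ e → col-row-injective (fromℕ-injective (proj₁ e)) (fromℕ-injective (proj₂ e))

    Δcol Δrow : Fin N → Fin N → ℕ
    Δcol i j = ℕ.∣ col i - col j ∣
    Δrow i j = ℕ.∣ row i - row j ∣

    sqDist : Fin N × Fin N → ℕ
    sqDist (i , j) = Δcol i j ℕ.* Δcol i j ℕ.+ Δrow i j ℕ.* Δrow i j

    dist-seq : ∀ i j n → seq (dist (proj₁ grid i) (proj₁ grid j)) n ≡ sqrtℚ n (fromℕℚ (sqDist (i , j)))
    dist-seq i j n = cong (sqrtℚ n) (trans (cong₂ _+_ (ι-∣-∣² (col i) (col j)) (ι-∣-∣² (row i) (row j)))
      (sym (fromℕℚ-+ (Δcol i j ℕ.* Δcol i j) (Δrow i j ℕ.* Δrow i j))))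

    sqDist-≡⇒dist-≈ : ∀ i j k l → sqDist (i , j) ≡ sqDist (k , l) →
      dist (proj₁ grid i) (proj₁ grid j) ≈ᴿ dist (proj₁ grid k) (proj₁ grid l)
    sqDist-≡⇒dist-≈ i j k l e = seq-≡⇒≈ (dist (proj₁ grid i) (proj₁ grid j)) (dist (proj₁ grid k) (proj₁ grid l)) λ n →
      trans (dist-seq i j n) (trans (cong (λ z → sqrtℚ n (fromℕℚ z)) e) (sym (dist-seq k l n)))

    1≤sqDist : ∀ {i j} → i ≢ j → 1 ℕ.≤ sqDist (i , j)
    1≤sqDist {i} {j} i≢j = 1≤m²+n² (apart (col i ℕ.≟ col j))
      where
      positive-∣-∣ : ∀ {a b} → a ≢ b → 0 ℕ.< ℕ.∣ a - b ∣
      positive-∣-∣ a≢b = ℕP.n≢0⇒n>0 λ e → a≢b (ℕP.∣m-n∣≡0⇒m≡n e)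
      apart : Dec (col i ≡ col j) → 0 ℕ.< Δcol i j ⊎ 0 ℕ.< Δrow i j
      apart (no  c≢) = inj₁ (positive-∣-∣ c≢)
      apart (yes c≡) = inj₂ (positive-∣-∣ λ r≡ → i≢j (col-row-injective c≡ r≡))

    sqDist≤ : ∀ i j → sqDist (i , j) ℕ.≤ 2 ℕ.* N
    sqDist≤ i j = ℕP.≤-trans (ℕP.+-mono-≤ (square≤ (col≤ i) (col≤ j)) (square≤ (row≤ i) (row≤ j)))
      (ℕP.≤-reflexive (cong (N ℕ.+_) (sym (ℕP.+-identityʳ N))))
      where
      square≤ : ∀ {a b} → a ℕ.≤ isqrt N → b ℕ.≤ isqrt N → ℕ.∣ a - b ∣ ℕ.* ℕ.∣ a - b ∣ ℕ.≤ N
      square≤ {a} {b} a≤ b≤ = ℕP.≤-trans (ℕP.*-mono-≤ ∣-∣≤ ∣-∣≤) (isqrt-lower N)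
        where
        ∣-∣≤ : ℕ.∣ a - b ∣ ℕ.≤ isqrt N
        ∣-∣≤ = ℕP.≤-trans (ℕP.∣m-n∣≤m⊔n a b) (ℕP.⊔-lub a≤ b≤)

    -- 2N < 2^exponent ≤ 4N
    exponent : ℕ
    exponent = suc (suc (lg N))

    grid-bound : 1 ℕ.≤ N → ∀ {k} → IsΔ grid k →
      fromℕℚ exponent * (fromℕℚ k * fromℕℚ k * (fromℕℚ k * fromℕℚ k)) ≤ fromℕℚ 1336336 * (fromℕℚ N * fromℕℚ N)
    grid-bound 1≤N ((Q , distinct , refl) , _) = ≤-trans
      (*-monoˡ κ (0≤fromℕℚ exponent)
        (subst (λ k → k * k * (k * k) ≤ fromℕℚ 81 * (G * G)) (∑-elements-1 Q) (size⁴≤ (ℕP.m^n>0 2 exponent))))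
      (≤-trans (≤-reflexive (solve 2 (λ κ g → κ :* (con (fromℕℚ 81) :* (g :* g)) := con (fromℕℚ 81) :* (κ :* (g :* g))) refl κ G))
      (≤-trans (*-monoˡ (fromℕℚ 81) (0≤fromℕℚ 81) (goodSquares-bound {exponent} (s≤s z≤n)))
      (≤-trans (*-monoˡ (fromℕℚ 81) (0≤fromℕℚ 81) (*-monoˡ (fromℕℚ 972) (0≤fromℕℚ 972) (sq-mono-≤ (0≤fromℕℚ x) x≤)))
      (≤-trans (≤-reflexive (solve 1 (λ n → con (fromℕℚ 81) :* (con (fromℕℚ 972) :* (con (fromℕℚ 4) :* n :* (con (fromℕℚ 4) :* n)))
          := con (fromℕℚ 1259712) :* (n :* n)) refl (fromℕℚ N)))
      -- The constant 1259712 = 81 · 972 · 4² is rounded up to the fourth power 34⁴ = 1336336, so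
      -- that 34 can serve as the final constant.
      (*-monoʳ (fromℕℚ N * fromℕℚ N) (0≤-* (0≤fromℕℚ N) (0≤fromℕℚ N)) (fromℕℚ-≤ (ℕP.m≤m+n 1259712 76624)))))))
      where
      κ = fromℕℚ exponent
      x = 2 ℕ.^ exponent
      range : ∀ {i j} → i ≢ j → 1 ℕ.≤ sqDist (i , j) × sqDist (i , j) ℕ.≤ x
      range {i} {j} i≢j = 1≤sqDist i≢j , ℕP.≤-trans (sqDist≤ i j) (ℕP.*-monoʳ-≤ 2 (ℕP.<⇒≤ (lg-upper N)))
      factor : ∀ {i j} → i ≢ j → ∃₂ λ s t →
        Good t × (sqDist (i , j) ≡ s ℕ.* s ℕ.* t ⊎ sqDist (i , j) ≡ s ℕ.* s ℕ.* (2 ℕ.* t))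
      factor {i} {j} i≢j = ²+²-factor (Δcol i j) (Δrow i j) (1≤sqDist i≢j)
      injective : ∀ {i j k l} → i ∈ elements Q → j ∈ elements Q → k ∈ elements Q → l ∈ elements Q →
        i ≢ j → k ≢ l → sqDist (i , j) ≡ sqDist (k , l) → (i ≡ k × j ≡ l) ⊎ (i ≡ l × j ≡ k)
      injective {i} {j} {k} {l} i∈ j∈ k∈ l∈ i≢j k≢l e =
        distinct i j k l (elements-⊆ Q i∈) (elements-⊆ Q j∈) (elements-⊆ Q k∈) (elements-⊆ Q l∈)
          i≢j k≢l (sqDist-≡⇒dist-≈ i j k l e)
      open Edges (elements Q) (elements-unique Q) x sqDist range factor injective
      G = Counting.goodSquares x
      x≤ : fromℕℚ x ≤ fromℕℚ 4 * fromℕℚ N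
      x≤ = ≤-trans (fromℕℚ-≤ (ℕP.≤-trans (ℕP.≤-reflexive (sym (ℕP.*-assoc 2 2 (2 ℕ.^ lg N)))) (ℕP.*-monoʳ-≤ 4 (lg-lower N 1≤N))))
        (≤-reflexive (fromℕℚ-* 4 N))

  -- Comparison with the real logarithm and roots

  harmonic-H : ∀ M K → harmonic M K + H M ≡ H (K ℕ.+ M)
  harmonic-H M zero    = +-identityˡ (H M)
  harmonic-H M (suc K) = trans (solve 3 (λ a u h → a :+ u :+ h := u :+ (a :+ h)) refl (harmonic M K) (unit (M ℕ.+ K)) (H M))
    (cong₂ _+_ (cong unit (ℕP.+-comm M K)) (harmonic-H M K))

  -- With `P = 2 ^ n`, the Riemann sum is `H (N P) - H P`, and `N P` is below `2 ^ (lg N + 1)` times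
  -- `P`; each doubling adds at most 1 to `H`.
  logSeq≤ : ∀ {N} n → 1 ℕ.≤ N → logSeq N n ≤ fromℕℚ (suc (lg N))
  logSeq≤ {N@(suc M)} n 1≤N = cancel (≤-trans (≤-reflexive (harmonic-H P (M ℕ.* P)))
    (≤-trans (∑-range-extend rc (ℕP.≤-trans (ℕP.≤-reflexive (ℕP.+-comm (M ℕ.* P) P)) (ℕP.*-monoˡ-≤ P (ℕP.<⇒≤ (lg-upper N)))) 0≤rc)
      (H-2^ (suc (lg N)) (ℕP.m^n>0 2 n))))
    where
    P = 2 ℕ.^ n
    cancel : ∀ {a b} → a + H P ≤ b + H P → a ≤ b
    cancel {a} {b} e = subst₂ _≤_
      (solve 2 (λ a h → a :+ h :- h := a) refl a (H P)) (solve 2 (λ a h → a :+ h :- h := a) refl b (H P))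
      (+-monoˡ-≤ (- H P) e)

  -- Positivity excludes the default value 0, which `sqrtℚ` takes at negative `q` and whose square
  -- exceeds `q`.
  sqrtℚ² : ∀ n q → 0ℚ < sqrtℚ n q → sqrtℚ n q * sqrtℚ n q ≤ q
  sqrtℚ² n q 0<s with sqrtℚ-lower n q
  ... | inj₁ s≡0 = ⊥-elim (<-irrefl (sym s≡0) 0<s)
  ... | inj₂ s²≤q = s²≤q

  -- e and b stand for approximations of √N and (log N)^(1/4), and u for the error of the first.
  no-gap : ∀ {N κ k e b u ε c} → 0ℚ ≤ N → 0ℚ ≤ k → 0ℚ ≤ e → 0ℚ ≤ u → 0ℚ < ε → 0ℚ < c → c < b →
    N < (e + u) * (e + u) → b * b * (b * b) ≤ κ →
    κ * (k * k * (k * k)) ≤ fromℕℚ 1336336 * (N * N) → fromℕℚ 34 * u < ε * c →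
    ¬ (fromℕℚ 34 * e * inv b + ε < k)
  no-gap {N} {κ} {k} {e} {b} {u} {ε} {c} 0≤N 0≤k 0≤e 0≤u 0<ε 0<c c<b N< b⁴≤κ bound 34u<εc h =
    -- Multiplying the supposed gap by `b` gives `34 e + ε b < k b ≤ 34 (e + u)`. Hence
    -- `ε c < ε b < 34 u`, against the smallness of `u`.
    <-irrefl refl (<-trans 34u<εc (+-cancel (<-≤-trans (<-trans (+-monoʳ-< (C * e) (*-monoʳ-<-pos ε {{positive 0<ε}} c<b)) gap) kb≤)))
    where
    C = fromℕℚ 34
    0<b : 0ℚ < b
    0<b = <-trans 0<c c<b
    0<C : 0ℚ < C
    0<C = 0<fromℕℚ-suc 33
    0≤eu : 0ℚ ≤ e + u
    0≤eu = 0≤-+ 0≤e 0≤u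
    gap : C * e + ε * b < k * b
    gap = subst (_< k * b)
      (trans (solve 5 (λ C e i b ε → (C :* e :* i :+ ε) :* b := C :* e :* (b :* i) :+ ε :* b) refl C e (inv b) b ε)
        (trans (cong (λ z → C * e * z + ε * b) (inv-inverseʳ 0<b)) (cong (_+ ε * b) (*-identityʳ (C * e)))))
      (*-monoˡ-<-pos b {{positive 0<b}} h)
    +-cancel : ∀ {a b} → C * e + a < C * (e + b) → a < C * b
    +-cancel {a} {b} q = subst₂ _<_ (solve 3 (λ C e a → :- (C :* e) :+ (C :* e :+ a) := a) refl C e a)
      (solve 3 (λ C e b → :- (C :* e) :+ C :* (e :+ b) := C :* b) refl C e b) (+-monoʳ-< (- (C * e)) q)
    -- Fourth powers are compared: `(k b)⁴ ≤ κ k⁴ ≤ 34⁴ N²`, while `N < (e + u)²`.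
    kb≤ : k * b ≤ C * (e + u)
    kb≤ = ≮⇒≥ λ C<kb → <-irrefl refl (<-≤-trans strict (≤-trans (*-mono (0≤-* 0≤s 0≤s) (0≤-* 0≤t 0≤t)
        (sq-mono-≤ 0≤s (<⇒≤ C<kb)) (sq-mono-≤ 0≤s (<⇒≤ C<kb))) kb⁴≤))
      where
      s t : ℚ
      s = C * (e + u)
      t = k * b
      0≤s : 0ℚ ≤ s
      0≤s = 0≤-* (<⇒≤ 0<C) 0≤eu
      0≤t : 0ℚ ≤ t
      0≤t = 0≤-* 0≤k (<⇒≤ 0<b)
      kb⁴≤ : t * t * (t * t) ≤ fromℕℚ 1336336 * (N * N)
      kb⁴≤ = ≤-trans (≤-reflexive (solve 2 (λ k b → k :* b :* (k :* b) :* (k :* b :* (k :* b)) := b :* b :* (b :* b) :* (k :* k :* (k :* k))) refl k b))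
        (≤-trans (*-monoʳ (k * k * (k * k)) (0≤-* (0≤-* 0≤k 0≤k) (0≤-* 0≤k 0≤k)) b⁴≤κ) bound)
      strict : fromℕℚ 1336336 * (N * N) < s * s * (s * s)
      strict = <-≤-trans (*-monoʳ-<-pos (fromℕℚ 1336336) {{positive (0<fromℕℚ-suc 1336335)}}
          (≤-<-trans (*-monoˡ N 0≤N (<⇒≤ N<)) (*-monoˡ-<-pos ((e + u) * (e + u)) {{positive (≤-<-trans 0≤N N<)}} N<)))
        (≤-reflexive (solve 1 (λ e → con (fromℕℚ 1336336) :* (e :* e :* (e :* e)) :=
          con (fromℕℚ 34) :* e :* (con (fromℕℚ 34) :* e) :* (con (fromℕℚ 34) :* e :* (con (fromℕℚ 34) :* e))) refl (e + u)))

  fourthRootLog : ℕ → ℕ → ℚ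
  fourthRootLog N n = sqrtℚ n (sqrtℚ n (logSeq N n))

  -- The inner root inherits positivity from `0 < b² ≤ sqrtℚ n (logSeq N n)`. The right-hand side is
  -- the exponent of `grid-bound`.
  fourthRootLog⁴≤ : ∀ {N} n → 1 ℕ.≤ N → 0ℚ < fourthRootLog N n →
    fourthRootLog N n * fourthRootLog N n * (fourthRootLog N n * fourthRootLog N n) ≤ fromℕℚ (suc (suc (lg N)))
  fourthRootLog⁴≤ {N} n 1≤N 0<b = ≤-trans (sq-mono-≤ (0≤-* (<⇒≤ 0<b) (<⇒≤ 0<b)) b²≤a)
    (≤-trans (sqrtℚ² n (logSeq N n) (<-≤-trans (0<-* 0<b 0<b) b²≤a))
    (≤-trans (logSeq≤ n 1≤N) (fromℕℚ-≤ (ℕP.n≤1+n (suc (lg N))))))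
    where
    b²≤a : fourthRootLog N n * fourthRootLog N n ≤ sqrtℚ n (logSeq N n)
    b²≤a = sqrtℚ² n (sqrtℚ n (logSeq N n)) 0<b

  34*<⇐ : ∀ {u v} → u < v * unit 33 → fromℕℚ 34 * u < v
  34*<⇐ {u} {v} small = subst (fromℕℚ 34 * u <_)
    (trans (solve 3 (λ t w u → t :* (w :* u) := w :* (u :* t)) refl (fromℕℚ 34) v (unit 33))
      (trans (cong (v *_) (unit-* 33)) (*-identityʳ v)))
    (*-monoʳ-<-pos (fromℕℚ 34) {{positive (0<fromℕℚ-suc 33)}} small)

  no-gap-at : ∀ {N d k ε c} n → 1 ℕ.≤ N → d ℕ.≤ k → IsΔ (Grid.grid N) k → 0ℚ < ε → 0ℚ < c →
    0ℚ + c < fourthRootLog N n → unit n < ε * c * unit 33 →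
    ¬ (fromℕℚ 34 * sqrtℚ n (fromℕℚ N) * inv (fourthRootLog N n) + ε < fromℕℚ d)
  no-gap-at {N} {d} {k} {ε} {c} n 1≤N d≤k Δ≡k 0<ε 0<c c<b small gap =
    no-gap {fromℕℚ N} {fromℕℚ (suc (suc (lg N)))} {fromℕℚ k} {sqrtℚ n (fromℕℚ N)} {fourthRootLog N n} {unit n} {ε} {c}
      (0≤fromℕℚ N) (0≤fromℕℚ k) (0≤sqrtℚ n (fromℕℚ N)) (<⇒≤ (0<unit n)) 0<ε 0<c c<b′
      (sqrtℚ-upper n (fromℕℚ N)) (fourthRootLog⁴≤ {N} n 1≤N (<-trans 0<c c<b′)) (Grid.grid-bound N 1≤N {k} Δ≡k)
      (34*<⇐ {unit n} {ε * c} small) (<-≤-trans gap (fromℕℚ-≤ d≤k))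
    where
    c<b′ : c < fourthRootLog N n
    c<b′ = subst (_< fourthRootLog N n) (+-identityˡ c) c<b

  eventually₃ : ∀ {P Q R : ℕ → Set} → Eventually P → Eventually Q → Eventually R → ∃ λ n → P n × Q n × R n
  eventually₃ (M₁ , p) (M₂ , q) (M₃ , r) = M₁ ℕ.⊔ M₂ ℕ.⊔ M₃ ,
    p _ (ℕP.≤-trans (ℕP.m≤m⊔n M₁ M₂) (ℕP.m≤m⊔n (M₁ ℕ.⊔ M₂) M₃)) ,
    q _ (ℕP.≤-trans (ℕP.m≤n⊔m M₁ M₂) (ℕP.m≤m⊔n (M₁ ℕ.⊔ M₂) M₃)) ,
    r _ (ℕP.m≤n⊔m (M₁ ℕ.⊔ M₂) M₃)

  -- One index refutes the gap: late enough that the fourth root exceeds `c`, that the error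
  -- `unit n` of the square root is below `ε c / 34`, and that the gap is in force.
  no-eventual-gap : ∀ {N d k ε} → 1 ℕ.≤ N → d ℕ.≤ k → IsΔ (Grid.grid N) k → 0ℚ < ε →
    (∃[ c ] 0ℚ < c × Eventually λ n → 0ℚ + c < fourthRootLog N n) →
    ¬ (Eventually λ n → fromℕℚ 34 * sqrtℚ n (fromℕℚ N) * inv (fourthRootLog N n) + ε < fromℕℚ d)
  no-eventual-gap {N} {d} {k} {ε} 1≤N d≤k Δ≡k 0<ε (c , 0<c , c<b) gap =
    finish (eventually₃ c<b (archimedean {ε * c * unit 33} (0<-* (0<-* 0<ε 0<c) (0<unit 33))) gap)
    where
    finish : (∃ λ n → 0ℚ + c < fourthRootLog N n × unit n < ε * c * unit 33 ×
      fromℕℚ 34 * sqrtℚ n (fromℕℚ N) * inv (fourthRootLog N n) + ε < fromℕℚ d) → ⊥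
    finish (n , c<bₙ , small , gapₙ) = no-gap-at {N} {d} {k} {ε} {c} n 1≤N d≤k Δ≡k 0<ε 0<c c<bₙ small gapₙ

  0<34 : 0ᴿ <ᴿ fromℕ 34
  0<34 = 1ℚ , positive⁻¹ 1ℚ , 0 , λ _ _ → fromℕℚ-< {1} {34} (s≤s (s≤s z≤n))

open import Data.Nat using (ℕ; _≤_)
open import Data.Nat.Properties using (<⇒≤)
open import Data.Product using (_×_; _,_; ∃-syntax)

proposition1p2 : ∃[ C ] (0ᴿ <ᴿ C) ×
    (∀ (N : ℕ) (2≤N : 2 ≤ N) (d : ℕ) → Isδ N d →
    fromℕ d ≤ᴿ C *ᴿ √ (fromℕ N)
    *ᴿ recip (√ (√ (log N))) (√-pos (√ (log N)) (√-pos (log N) (log-pos 2≤N))))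
proposition1p2 = fromℕ 34 , 0<34 , λ { N 2≤N d (_ , d≤) (ε , 0<ε , gap) →
  -- As `≤ᴿ` is a negation, the goal is `⊥`, and the doubly negated existence of Δ for the grid may
  -- be used. Minimality of `d` then gives `d ≤ k`.
  Δ-exists (Grid.grid N) λ { (k , Δ≡k) →
    no-eventual-gap {N} {d} {k} {ε} (<⇒≤ 2≤N) (d≤ k (Grid.grid N , Δ≡k)) Δ≡k 0<ε
      (√-pos (√ (log N)) (√-pos (log N) (log-pos 2≤N))) gap } }
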